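{- Let $n\ge 2$ and $d$ be integers with $0\le d\le (\sqrt{8n-15}-1)/4$. If $G$ is an $n$-vertex graph with minimum degree $\delta(G)\ge \frac{n+d}{2}-1$, then $G$ is $d$-rigid.
   Context: Graphs are finite and simple; $\delta(G)$ denotes the minimum degree of $G$. A $d$-dimensional framework is a pair $(G,\mathbf{p})$ with $G=(V,E)$ a graph and $\mathbf{p}:V\to\mathbb{R}^d$. It is rigid if every continuous motion of the vertices starting from $\mathbf{p}$ that preserves the distances between all pairs of adjacent vertices is trivial (arises from translations and rotations of the whole framework). $\mathbf{p}$ is generic if its $d|V|$ coordinates are algebraically independent over $\mathbb{Q}$. $G$ is $d$-rigid if $(G,\mathbf{p})$ is rigid for a generic $\mathbf{p}$ (this does not depend on the generic $\mathbf{p}$). It is assumed that $|V|\ge d+1$ when discussing $d$-rigidity. Equivalently (Asimow–Roth), $G$ is $d$-rigid if, for a generic $\mathbf{p}$, the rigidity matrix $\mathsf{R}(G,\mathbf{p})$ has rank $d|V|-\binom{d+1}{2}$ (the maximum possible), where $\mathsf{R}(G,\mathbf{p})$ has rows indexed by $E$, columns indexed by $V\times[d]$, and the entry in row $e$ and column $(u,i)$ is $\mathbf{p}(u)_i-\mathbf{p}(v)_i$ if $e=\{u,v\}$ for some $v\in V$, and $0$ if $u\notin e$. -}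

module Defs where

open import Algebra.Bundles.Raw using (RawSemiring)
import Algebra.Definitions.RawSemiring as RawSemiringDefinitions
open import Data.Bool.Base using (Bool; true; false; T; if_then_else_)
open import Data.Fin.Base as Fin using (Fin)
import Data.Fin.Properties as Fin
open import Data.Fin.Subset using (Subset; ∣_∣)
open import Data.List.Base as List using (List; []; _∷_)
open import Data.List.Extrema.Nat using (min)
open import Data.Nat.Base as ℕ using (ℕ; suc; _∸_)
open import Data.Nat.Combinatorics using (_C_)
import Data.Nat.Properties as ℕ
open import Data.Product.Base using (Σ-syntax; ∃-syntax; _×_; _,_)
open import Data.Rational.Base as ℚ using (ℚ; 0ℚ; 1ℚ; ½)
import Data.Rational.Properties as ℚ
open import Data.Rational.Solver using (module +-*-Solver)
open import Data.Vec.Base as Vec using (Vec)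
open import Data.Vec.Functional using (Vector; concat)
import Data.Vec.Properties as Vec
open import Function.Base using (case_of_)
open import Level using (0ℓ)
open import Relation.Binary.PropositionalEquality using (_≡_; refl; sym; trans; cong; cong₂; subst)
open import Relation.Nullary using (¬_; does)

private
  variable
    m n d : ℕ

Cauchy : (ℕ → ℚ) → Set
Cauchy s = ∀ ε → 0ℚ ℚ.< ε →
  ∃[ N ] (∀ i j → N ℕ.≤ i → N ℕ.≤ j → ℚ.∣ s i ℚ.- s j ∣ ℚ.< ε)

-- The reals as Cauchy sequences of rationals, with equality _≈_ (not _≡_) and
-- termwise operations.
record ℝ : Set where
  constructor _,_
  field
    seq    : ℕ → ℚ
    cauchy : Cauchy seq

open ℝ public

infix 4 _≈_

_≈_ : ℝ → ℝ → Set
x ≈ y = ∀ ε → 0ℚ ℚ.< ε →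
  ∃[ N ] (∀ i → N ℕ.≤ i → ℚ.∣ seq x i ℚ.- seq y i ∣ ℚ.< ε)

fromℚ : ℚ → ℝ
fromℚ q = (λ _ → q) , λ ε 0<ε →
  0 , λ _ _ _ _ → subst (ℚ._< ε) (sym (cong ℚ.∣_∣ (ℚ.+-inverseʳ q))) 0<ε

private
  open +-*-Solver using (solve; _:=_; _:+_; _:*_; _:-_; :-_)

  half-pos : ∀ {ε} → 0ℚ ℚ.< ε → 0ℚ ℚ.< ½ ℚ.* ε
  half-pos {ε} 0<ε =
    subst (ℚ._< ½ ℚ.* ε) (ℚ.*-zeroʳ ½) (ℚ.*-monoʳ-<-pos ½ 0<ε)

  halves : ∀ ε → ½ ℚ.* ε ℚ.+ ½ ℚ.* ε ≡ ε
  halves ε = trans (sym (ℚ.*-distribʳ-+ ε ½ ½)) (ℚ.*-identityˡ ε)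

  +-split : ∀ a b c e → (a ℚ.+ b) ℚ.- (c ℚ.+ e) ≡ (a ℚ.- c) ℚ.+ (b ℚ.- e)
  +-split = solve 4 (λ a b c e → (a :+ b) :- (c :+ e) := (a :- c) :+ (b :- e)) refl

  *-split : ∀ a b c e →
    (a ℚ.* b) ℚ.- (c ℚ.* e) ≡ a ℚ.* (b ℚ.- e) ℚ.+ e ℚ.* (a ℚ.- c)
  *-split = solve 4
    (λ a b c e → (a :* b) :- (c :* e) := a :* (b :- e) :+ e :* (a :- c)) refl

  neg-split : ∀ a b → (ℚ.- a) ℚ.- (ℚ.- b) ≡ ℚ.- (a ℚ.- b)
  neg-split = solve 2 (λ a b → (:- a) :- (:- b) := :- (a :- b)) refl

  +-cancel : ∀ a b → (a ℚ.- b) ℚ.+ b ≡ a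
  +-cancel = solve 2 (λ a b → (a :- b) :+ b := a) refl

  ∣+∣<  : ∀ {a b ε} → ℚ.∣ a ∣ ℚ.< ½ ℚ.* ε → ℚ.∣ b ∣ ℚ.< ½ ℚ.* ε → ℚ.∣ a ℚ.+ b ∣ ℚ.< ε
  ∣+∣< {a} {b} {ε} a< b< = subst (ℚ.∣ a ℚ.+ b ∣ ℚ.<_) (halves ε)
    (ℚ.≤-<-trans (ℚ.∣p+q∣≤∣p∣+∣q∣ a b) (ℚ.+-mono-< a< b<))

  bounded : ∀ {s} → Cauchy s →
    ∃[ B ] (0ℚ ℚ.< B × ∃[ N ] (∀ i → N ℕ.≤ i → ℚ.∣ s i ∣ ℚ.≤ B))
  bounded {s} c with c 1ℚ (ℚ.positive⁻¹ 1ℚ)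
  ... | N , near = 1ℚ ℚ.+ ℚ.∣ s N ∣
    , ℚ.+-mono-<-≤ (ℚ.positive⁻¹ 1ℚ) (ℚ.0≤∣p∣ (s N))
    , N , λ i N≤i →
      subst (ℚ._≤ 1ℚ ℚ.+ ℚ.∣ s N ∣) (cong ℚ.∣_∣ (+-cancel (s i) (s N)))
        (ℚ.≤-trans (ℚ.∣p+q∣≤∣p∣+∣q∣ (s i ℚ.- s N) (s N))
          (ℚ.+-monoˡ-≤ ℚ.∣ s N ∣ (ℚ.<⇒≤ (near i N N≤i ℕ.≤-refl))))

  abstract
    +-cauchy : ∀ {s t} → Cauchy s → Cauchy t → Cauchy (λ i → s i ℚ.+ t i)
    +-cauchy {s} {t} cs ct ε 0<ε
      with cs (½ ℚ.* ε) (half-pos 0<ε) | ct (½ ℚ.* ε) (half-pos 0<ε)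
    ... | M , near-s | N , near-t = M ℕ.⊔ N , λ i j ≤i ≤j →
      subst (ℚ._< ε) (cong ℚ.∣_∣ (sym (+-split (s i) (t i) (s j) (t j))))
        (∣+∣< {s i ℚ.- s j} {t i ℚ.- t j}
          (near-s i j (ℕ.m⊔n≤o⇒m≤o M N ≤i) (ℕ.m⊔n≤o⇒m≤o M N ≤j))
          (near-t i j (ℕ.m⊔n≤o⇒n≤o M N ≤i) (ℕ.m⊔n≤o⇒n≤o M N ≤j)))

    neg-cauchy : ∀ {s} → Cauchy s → Cauchy (λ i → ℚ.- s i)
    neg-cauchy {s} cs ε 0<ε with cs ε 0<ε
    ... | N , near = N , λ i j ≤i ≤j →
      subst (ℚ._< ε)
        (sym (trans (cong ℚ.∣_∣ (neg-split (s i) (s j))) (ℚ.∣-p∣≡∣p∣ (s i ℚ.- s j))))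
        (near i j ≤i ≤j)

  scaled : ∀ {B a b δ} → 0ℚ ℚ.< B → ℚ.∣ a ∣ ℚ.≤ B → ℚ.∣ b ∣ ℚ.< δ →
    ℚ.∣ a ℚ.* b ∣ ℚ.< B ℚ.* δ
  scaled {B} {a} {b} 0<B a≤B b<δ = subst (ℚ._< _) (sym (ℚ.∣p*q∣≡∣p∣*∣q∣ a b))
    (ℚ.≤-<-trans
      (ℚ.*-monoʳ-≤-nonNeg ℚ.∣ b ∣ {{ℚ.nonNegative (ℚ.0≤∣p∣ b)}} a≤B)
      (ℚ.*-monoʳ-<-pos B {{ℚ.positive 0<B}} b<δ))

  divided : ∀ {B e} → 0ℚ ℚ.< B → 0ℚ ℚ.< e → ∃[ δ ] (0ℚ ℚ.< δ × B ℚ.* δ ≡ e)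
  divided {B} {e} 0<B 0<e = B⁻¹ ℚ.* e
    , subst (ℚ._< B⁻¹ ℚ.* e) (ℚ.*-zeroʳ B⁻¹)
        (ℚ.*-monoʳ-<-pos B⁻¹ {{ℚ.1/pos⇒pos B {{ℚ.positive 0<B}}}} 0<e)
    , trans (sym (ℚ.*-assoc B B⁻¹ e))
        (trans (cong (ℚ._* e) (ℚ.*-inverseʳ B {{B≢0}})) (ℚ.*-identityˡ e))
    where
    B≢0 = ℚ.pos⇒nonZero B {{ℚ.positive 0<B}}
    B⁻¹ = ℚ.1/_ B {{B≢0}}

  ⊔-bounds : ∀ K L M N {i} → (K ℕ.⊔ L) ℕ.⊔ (M ℕ.⊔ N) ℕ.≤ i →
    (K ℕ.≤ i × L ℕ.≤ i) × (M ℕ.≤ i × N ℕ.≤ i)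
  ⊔-bounds K L M N h =
    (ℕ.m⊔n≤o⇒m≤o K L KL≤ , ℕ.m⊔n≤o⇒n≤o K L KL≤) ,
    (ℕ.m⊔n≤o⇒m≤o M N MN≤ , ℕ.m⊔n≤o⇒n≤o M N MN≤)
    where
    KL≤ = ℕ.m⊔n≤o⇒m≤o (K ℕ.⊔ L) (M ℕ.⊔ N) h
    MN≤ = ℕ.m⊔n≤o⇒n≤o (K ℕ.⊔ L) (M ℕ.⊔ N) h

  *-near : ∀ {A B α β ε} a b c e → 0ℚ ℚ.< A → 0ℚ ℚ.< B →
    A ℚ.* α ≡ ½ ℚ.* ε → B ℚ.* β ≡ ½ ℚ.* ε →
    ℚ.∣ a ∣ ℚ.≤ A → ℚ.∣ e ∣ ℚ.≤ B →
    ℚ.∣ b ℚ.- e ∣ ℚ.< α → ℚ.∣ a ℚ.- c ∣ ℚ.< β →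
    ℚ.∣ a ℚ.* b ℚ.- c ℚ.* e ∣ ℚ.< ε
  *-near {ε = ε} a b c e 0<A 0<B Aα≡ Bβ≡ a≤A e≤B b≈e a≈c =
    subst (ℚ._< ε) (cong ℚ.∣_∣ (sym (*-split a b c e)))
      (∣+∣< {a ℚ.* (b ℚ.- e)} {e ℚ.* (a ℚ.- c)}
        (subst (ℚ.∣ a ℚ.* (b ℚ.- e) ∣ ℚ.<_) Aα≡ (scaled {a = a} {b ℚ.- e} 0<A a≤A b≈e))
        (subst (ℚ.∣ e ℚ.* (a ℚ.- c) ∣ ℚ.<_) Bβ≡ (scaled {a = e} {a ℚ.- c} 0<B e≤B a≈c)))

  abstract
    *-cauchy : ∀ {s t} → Cauchy s → Cauchy t → Cauchy (λ i → s i ℚ.* t i)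
    *-cauchy {s} {t} cs ct ε 0<ε =
      case bounded cs of λ { (A , 0<A , K , s≤A) →
      case bounded ct of λ { (B , 0<B , L , t≤B) →
      case divided 0<A (half-pos 0<ε) of λ { (α , 0<α , Aα≡) →
      case divided 0<B (half-pos 0<ε) of λ { (β , 0<β , Bβ≡) →
      case ct α 0<α of λ { (M , t-near) →
      case cs β 0<β of λ { (N , s-near) →
        (K ℕ.⊔ L) ℕ.⊔ (M ℕ.⊔ N) , λ i j ≤i ≤j →
          let (K≤i , _) , (M≤i , N≤i) = ⊔-bounds K L M N ≤i
              (_ , L≤j) , (M≤j , N≤j) = ⊔-bounds K L M N ≤j
          in *-near (s i) (t i) (s j) (t j) 0<A 0<B Aα≡ Bβ≡
               (s≤A i K≤i) (t≤B j L≤j) (t-near i j M≤i M≤j) (s-near i j N≤i N≤j) }}}}}}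

infixl 6 _+_ _-_
infixl 7 _*_
infix  8 -_

0ℝ 1ℝ : ℝ
0ℝ = fromℚ 0ℚ
1ℝ = fromℚ 1ℚ

_+_ _*_ : ℝ → ℝ → ℝ
(s , cs) + (t , ct) = (λ i → s i ℚ.+ t i) , +-cauchy {s} {t} cs ct
(s , cs) * (t , ct) = (λ i → s i ℚ.* t i) , *-cauchy {s} {t} cs ct

-_ : ℝ → ℝ
- (s , cs) = (λ i → ℚ.- s i) , neg-cauchy {s} cs

_-_ : ℝ → ℝ → ℝ
x - y = x + (- y)

ℝ-rawSemiring : RawSemiring 0ℓ 0ℓ
ℝ-rawSemiring = record
  { Carrier = ℝ ; _≈_ = _≈_ ; _+_ = _+_ ; _*_ = _*_ ; 0# = 0ℝ ; 1# = 1ℝ }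

open RawSemiringDefinitions ℝ-rawSemiring public using (sum; product; _^_)

-- A polynomial in m variables is a formal sum of terms (coefficient , exponents).
-- Exponent vectors may repeat, so the polynomial is determined by `coeff`.
Polynomial : ℕ → Set
Polynomial m = List (ℚ × Vec ℕ m)

coeff : Polynomial m → Vec ℕ m → ℚ
coeff []            e = 0ℚ
coeff ((c , k) ∷ f) e =
  if does (Vec.≡-dec ℕ._≟_ k e) then c ℚ.+ coeff f e else coeff f e

eval : Polynomial m → Vector ℝ m → ℝ
eval []            x = 0ℝ
eval ((c , k) ∷ f) x = fromℚ c * product (λ i → x i ^ Vec.lookup k i) + eval f x

-- Independence over ℚ: only the zero polynomial vanishes at x.
AlgebraicallyIndependent : Vector ℝ m → Set
AlgebraicallyIndependent {m} x =
  (f : Polynomial m) → eval f x ≈ 0ℝ → ∀ e → coeff f e ≡ 0ℚ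

Matrix : Set → Set → Set
Matrix I J = I → J → ℝ

LinearlyIndependentRows : ∀ {I J r} → Matrix I J → (Fin r → I) → Set
LinearlyIndependentRows {r = r} A ρ =
  (c : Vector ℝ r) → (∀ j → sum (λ k → c k * A (ρ k) j) ≈ 0ℝ) → ∀ k → c k ≈ 0ℝ

-- The rank is the maximum size of a linearly independent family of rows.
HasRank : ∀ {I J} → Matrix I J → ℕ → Set
HasRank {I} A r =
  (Σ[ ρ ∈ (Fin r → I) ] LinearlyIndependentRows A ρ) ×
  ((ρ : Fin (suc r) → I) → ¬ LinearlyIndependentRows A ρ)

-- Finite simple graphs on the vertex set Fin n.
record Graph (n : ℕ) : Set where
  field
    adj       : Fin n → Fin n → Bool
    symmetric : ∀ u v → adj u v ≡ adj v u
    loopless  : ∀ v → adj v v ≡ false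

  neighbours : Fin n → Subset n
  neighbours v = Vec.tabulate (adj v)

  degree : Fin n → ℕ
  degree v = ∣ neighbours v ∣

open Graph public

-- Each degree is less than n, so the initial value n of the minimum only
-- matters for the graph without vertices.
δ : Graph n → ℕ
δ {n} G = min n (List.tabulate (degree G))

-- An unordered pair {u,v} is represented with u < v.
record Edge (G : Graph n) : Set where
  field
    u v      : Fin n
    u<v      : u Fin.< v
    adjacent : T (adj G u v)

Placement : ℕ → ℕ → Set
Placement n d = Fin n → Vector ℝ d

-- The d * n coordinates, listed in one vector.
Generic : Placement n d → Set
Generic p = AlgebraicallyIndependent (concat p)

rigidityMatrix : (G : Graph n) → Placement n d → Matrix (Edge G) (Fin n × Fin d)
rigidityMatrix G p e (w , i) =
  if does (w Fin.≟ u) then p u i - p v i else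
  if does (w Fin.≟ v) then p v i - p u i else 0ℝ
  where open Edge e

-- Rigidity of G in dimension d, through the rank criterion of Asimow and Roth.
-- The rank is the same for all generic p, so "for a generic p" is stated for all.
-- As usual this is meant for graphs with n ≥ d + 1 vertices, in which case
-- d * n ≥ (d + 1) C 2 and the subtraction does not truncate.
Rigid : (d : ℕ) → Graph n → Set
Rigid {n} d G = (p : Placement n d) → Generic p →
  HasRank (rigidityMatrix G p) (d ℕ.* n ∸ (d ℕ.+ 1) C 2)

module Submission where

-- The rank is read off from the closure of G, which joins u and v whenever the row of uv
-- lies in the span of the rows of G at the generic placement.  An affine dependency λ of
-- d + 2 points gives the stress λᵤλᵥ of the complete graph on them, so two vertices joined
-- to a common d-clique of the closure are adjacent in the closure.  In particular the
-- pairs meeting a fixed d-set span all rows, which bounds the rank from above, and the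
-- lower bound is immediate when the closure is complete.
--
-- Otherwise build up an independent family of pairs of the closure by inserting the
-- vertices one at a time.  A vertex with a earlier neighbours contributes min(a , d), and
-- d + 1 if a > d and these neighbours do not form a clique.  The degree condition gives
-- any two non-adjacent vertices d common neighbours, so a neighbourhood that is a clique
-- would force the closure to be complete; hence a random order gains more than d per
-- vertex up to a small error, and the method of conditional expectations makes it explicit.

open import Algebra.Bundles using (CommutativeRing; RawRing)
import Algebra.Properties.CommutativeMonoid.Sum as Sum
import Algebra.Properties.Monoid.Mult as Mult
import Algebra.Properties.Semiring.Sum as SemiringSum
import Algebra.Solver.Ring as RingSolver
open import Algebra.Solver.Ring.AlmostCommutativeRing using (_-Raw-AlmostCommutative⟶_; fromCommutativeRing; Induced-equivalence)
open import Data.Bool.Base using (Bool; true; false; not; _∧_; _∨_; if_then_else_)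
import Data.Bool.Properties as Bool
open import Data.Empty using (⊥-elim)
open import Data.Fin.Base as Fin using (Fin; zero; suc; punchIn; toℕ; fromℕ<; inject≤; combine; remQuot; splitAt; _↑ˡ_; _↑ʳ_)
import Data.Fin.Properties as Fin
open import Data.Fin.Subset using (∣_∣)
open import Data.List.Base as List using (List)
open import Data.List.Extrema.Nat using (min≤xs)
open import Data.List.Relation.Unary.All as All using (All)
import Data.List.Relation.Unary.All.Properties as All
open import Data.Maybe.Base using (just; nothing)
open import Data.Nat.Base as ℕ using (ℕ; zero; suc; _∸_; _⊓_; _≤_; _<_; z≤n; s≤s)
import Data.Nat.Properties as ℕ
open import Data.Nat.Tactic.RingSolver using (solve-∀)
open import Data.Product.Base using (_×_; _,_; Σ-syntax; ∃-syntax; proj₁; proj₂)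
open import Data.Rational.Base as ℚ using (ℚ; 0ℚ; 1ℚ; ½)
import Data.Rational.Properties as ℚ
open import Data.Rational.Solver using (module +-*-Solver)
open import Data.Sum.Base using (_⊎_; inj₁; inj₂; [_,_]′)
open import Data.Vec.Base as Vec using (Vec; lookup)
import Data.Vec.Functional as Vector
open import Data.Vec.Functional using (Vector)
import Data.Vec.Functional.Properties as Vector
import Data.Vec.Properties as Vec
open import Defs as D using (ℝ; Cauchy; seq; cauchy; fromℚ; Polynomial; coeff; LinearlyIndependentRows; rigidityMatrix; Graph; δ; Edge; Rigid)
open import Function.Base using (_∘_; _⟨_⟩_; case_of_)
open import Function.Bundles using (module Equivalence)
open import Level using (0ℓ)
open import Relation.Binary.Definitions using (WeaklyDecidable; tri<; tri≈; tri>)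
open import Relation.Binary.PropositionalEquality as ≡ using (_≡_; _≢_; refl; sym; trans; cong; cong₂; subst; subst₂)
open import Relation.Nullary using (¬_; Dec; does; yes; no; contradiction; _×-dec_; ¬?)
open import Relation.Nullary.Decidable using (dec-true; dec-false; decidable-stable)

-- Equality of reals is undecidable, so neither pivots nor a maximal independent family of rows can
-- be chosen by inspecting entries. Genericity repairs this: a polynomial with rational coefficients
-- vanishes at the generic point only if its coefficients do, and that is decidable. Hence all
-- elimination is done without division and with polynomial coefficients. Where nothing can be
-- decided, the argument runs under a double negation, which is harmless because its goals,
-- vanishing of a scalar and inequalities of naturals, are stable. The same polynomials carry
-- independence from one special position to the generic one, so an extension step may be checked in
-- a convenient position.
--
-- The constants: against the ideal gain d + 1 a vertex loses on average at most 1/2 + d(d + 2)/2M,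
-- where 2M is at least n - d + 2. The family thus has at least (d + 1/2)n - n d(d + 2)/2M members,
-- which reaches d n - d(d + 1)/2 as soon as n d(d + 2) is at most M(n + d(d + 1)). For this n has
-- to be quadratic in d.

-- Cauchy reals: equality to zero, apartness and the ring structure.

module RealNumbers where
  open +-*-Solver using (solve; _:=_; _:+_; _:*_; _:-_; :-_)

  -+-cancel : ∀ a b → (a ℚ.- b) ℚ.+ b ≡ a
  -+-cancel = solve 2 (λ a b → (a :- b) :+ b := a) refl

  neg-minus : ∀ a b → ℚ.- (a ℚ.- b) ≡ b ℚ.- a
  neg-minus = solve 2 (λ a b → :- (a :- b) := b :- a) refl

  minus-chain : ∀ a b c → (a ℚ.- b) ℚ.+ (b ℚ.- c) ≡ a ℚ.- c
  minus-chain = solve 3 (λ a b c → (a :- b) :+ (b :- c) := a :- c) refl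

  +-minus-+ : ∀ a b c e → (a ℚ.- b) ℚ.+ (c ℚ.- e) ≡ (a ℚ.+ c) ℚ.- (b ℚ.+ e)
  +-minus-+ = solve 4 (λ a b c e → (a :- b) :+ (c :- e) := (a :+ c) :- (b :+ e)) refl

  neg-minus-neg : ∀ a b → ℚ.- (a ℚ.- b) ≡ (ℚ.- a) ℚ.- (ℚ.- b)
  neg-minus-neg = solve 2 (λ a b → :- (a :- b) := (:- a) :- (:- b)) refl

  *-minus-* : ∀ a b c e → a ℚ.* (c ℚ.- e) ℚ.+ e ℚ.* (a ℚ.- b) ≡ (a ℚ.* c) ℚ.- (b ℚ.* e)
  *-minus-* = solve 4 (λ a b c e → a :* (c :- e) :+ e :* (a :- b) := (a :* c) :- (b :* e)) refl

  Null : (ℕ → ℚ) → Set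
  Null s = ∀ ε → 0ℚ ℚ.< ε → ∃[ N ] (∀ i → N ℕ.≤ i → ℚ.∣ s i ∣ ℚ.< ε)

  -- The positive form of being nonzero; for a Cauchy sequence `¬ Null` yields it only under a
  -- double negation.
  Apart : (ℕ → ℚ) → Set
  Apart s = ∃[ κ ] (0ℚ ℚ.< κ × ∃[ N ] (∀ i → N ℕ.≤ i → κ ℚ.< ℚ.∣ s i ∣))

  half-pos : ∀ {ε} → 0ℚ ℚ.< ε → 0ℚ ℚ.< ½ ℚ.* ε
  half-pos {ε} 0<ε = subst (ℚ._< ½ ℚ.* ε) (ℚ.*-zeroʳ ½) (ℚ.*-monoʳ-<-pos ½ 0<ε)

  halves : ∀ ε → ½ ℚ.* ε ℚ.+ ½ ℚ.* ε ≡ ε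
  halves ε = trans (sym (ℚ.*-distribʳ-+ ε ½ ½)) (ℚ.*-identityˡ ε)

  null-cong : ∀ {s t} → (∀ i → s i ≡ t i) → Null s → Null t
  null-cong s≡t ns ε 0<ε with ns ε 0<ε
  ... | N , small = N , λ i N≤i → subst (λ x → ℚ.∣ x ∣ ℚ.< ε) (s≡t i) (small i N≤i)

  null-0 : Null (λ _ → 0ℚ)
  null-0 ε 0<ε = 0 , λ _ _ → 0<ε

  null-neg : ∀ {s} → Null s → Null (λ i → ℚ.- s i)
  null-neg {s} ns ε 0<ε with ns ε 0<ε
  ... | N , small = N , λ i N≤i → subst (ℚ._< ε) (sym (ℚ.∣-p∣≡∣p∣ (s i))) (small i N≤i)

  null-+ : ∀ {s t} → Null s → Null t → Null (λ i → s i ℚ.+ t i)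
  null-+ {s} {t} ns nt ε 0<ε with ns _ (half-pos 0<ε) | nt _ (half-pos 0<ε)
  ... | M , s< | N , t< = M ℕ.⊔ N , λ i ≤i →
    subst (ℚ.∣ s i ℚ.+ t i ∣ ℚ.<_) (halves ε)
      (ℚ.≤-<-trans (ℚ.∣p+q∣≤∣p∣+∣q∣ (s i) (t i))
        (ℚ.+-mono-< (s< i (ℕ.m⊔n≤o⇒m≤o M N ≤i)) (t< i (ℕ.m⊔n≤o⇒n≤o M N ≤i))))

  cauchy-bounded : ∀ {s} → Cauchy s →
    ∃[ B ] (0ℚ ℚ.< B × ∃[ N ] (∀ i → N ℕ.≤ i → ℚ.∣ s i ∣ ℚ.≤ B))
  cauchy-bounded {s} c with c 1ℚ (ℚ.positive⁻¹ 1ℚ)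
  ... | N , near = 1ℚ ℚ.+ ℚ.∣ s N ∣
    , ℚ.+-mono-<-≤ (ℚ.positive⁻¹ 1ℚ) (ℚ.0≤∣p∣ (s N))
    , N , λ i N≤i →
      subst (λ x → ℚ.∣ x ∣ ℚ.≤ 1ℚ ℚ.+ ℚ.∣ s N ∣)
        (-+-cancel (s i) (s N))
        (ℚ.≤-trans (ℚ.∣p+q∣≤∣p∣+∣q∣ (s i ℚ.- s N) (s N))
          (ℚ.+-monoˡ-≤ ℚ.∣ s N ∣ (ℚ.<⇒≤ (near i N N≤i ℕ.≤-refl))))

  scaled-< : ∀ {B a b δ} → 0ℚ ℚ.< B → ℚ.∣ a ∣ ℚ.≤ B → ℚ.∣ b ∣ ℚ.< δ →
    ℚ.∣ a ℚ.* b ∣ ℚ.< B ℚ.* δ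
  scaled-< {B} {a} {b} 0<B a≤B b<δ = subst (ℚ._< _) (sym (ℚ.∣p*q∣≡∣p∣*∣q∣ a b))
    (ℚ.≤-<-trans
      (ℚ.*-monoʳ-≤-nonNeg ℚ.∣ b ∣ {{ℚ.nonNegative (ℚ.0≤∣p∣ b)}} a≤B)
      (ℚ.*-monoʳ-<-pos B {{ℚ.positive 0<B}} b<δ))

  divided : ∀ {B e} → 0ℚ ℚ.< B → 0ℚ ℚ.< e → ∃[ δ ] (0ℚ ℚ.< δ × B ℚ.* δ ≡ e)
  divided {B} {e} 0<B 0<e = B⁻¹ ℚ.* e
    , subst (ℚ._< B⁻¹ ℚ.* e) (ℚ.*-zeroʳ B⁻¹)
        (ℚ.*-monoʳ-<-pos B⁻¹ {{ℚ.1/pos⇒pos B {{ℚ.positive 0<B}}}} 0<e)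
    , trans (sym (ℚ.*-assoc B B⁻¹ e))
        (trans (cong (ℚ._* e) (ℚ.*-inverseʳ B {{B≢0}})) (ℚ.*-identityˡ e))
    where
    B≢0 = ℚ.pos⇒nonZero B {{ℚ.positive 0<B}}
    B⁻¹ = ℚ.1/_ B {{B≢0}}

  null-* : ∀ {s t} → Cauchy s → Null t → Null (λ i → s i ℚ.* t i)
  null-* {s} {t} cs nt ε 0<ε =
    case cauchy-bounded cs of λ { (B , 0<B , M , s≤B) →
    case divided 0<B 0<ε of λ { (δ , 0<δ , Bδ≡ε) →
    case nt δ 0<δ of λ { (N , t<δ) →
      M ℕ.⊔ N , λ i ≤i →
        subst (ℚ.∣ s i ℚ.* t i ∣ ℚ.<_) Bδ≡ε
          (scaled-< {a = s i} {t i} 0<B (s≤B i (ℕ.m⊔n≤o⇒m≤o M N ≤i)) (t<δ i (ℕ.m⊔n≤o⇒n≤o M N ≤i))) }}}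

  triangle : ∀ a b → ℚ.∣ a ∣ ℚ.≤ ℚ.∣ a ℚ.- b ∣ ℚ.+ ℚ.∣ b ∣
  triangle a b = subst (λ x → ℚ.∣ x ∣ ℚ.≤ ℚ.∣ a ℚ.- b ∣ ℚ.+ ℚ.∣ b ∣) (-+-cancel a b)
    (ℚ.∣p+q∣≤∣p∣+∣q∣ (a ℚ.- b) b)

  near-small : ∀ {a b κ η ε} → κ ℚ.+ κ ≡ η → η ℚ.+ η ≡ ε → 0ℚ ℚ.< κ →
    ℚ.∣ a ℚ.- b ∣ ℚ.< κ → ℚ.∣ b ∣ ℚ.< η → ℚ.∣ a ∣ ℚ.< ε
  near-small {a} {b} {κ} {η} {ε} κ+κ η+η 0<κ a≈b b<η = subst (ℚ.∣ a ∣ ℚ.<_) η+η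
    (ℚ.≤-<-trans (triangle a b) (ℚ.+-mono-< (ℚ.<-trans a≈b κ<η) b<η))
    where
    κ<η : κ ℚ.< η
    κ<η = subst₂ ℚ._<_ (ℚ.+-identityʳ κ) κ+κ (ℚ.+-monoʳ-< κ 0<κ)

  near-apart : ∀ {a b κ η} → κ ℚ.+ κ ≡ η →
    ℚ.∣ b ℚ.- a ∣ ℚ.< κ → ¬ (ℚ.∣ b ∣ ℚ.< η) → κ ℚ.< ℚ.∣ a ∣
  near-apart {a} {b} {κ} {η} κ+κ b≈a b≮η = ℚ.≰⇒> λ a≤κ →
    b≮η (subst (ℚ.∣ b ∣ ℚ.<_) κ+κ (ℚ.≤-<-trans (triangle b a) (ℚ.+-mono-<-≤ b≈a a≤κ)))

  -- One rational comparison decides this alternative: from N on the terms differ by less than ε/4,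
  -- so comparing `s N` with ε/2 settles the whole tail.
  small-or-apart : ∀ {s} → Cauchy s → ∀ ε → 0ℚ ℚ.< ε →
    (∃[ N ] (∀ i → N ℕ.≤ i → ℚ.∣ s i ∣ ℚ.< ε)) ⊎ Apart s
  small-or-apart {s} cs ε 0<ε = decide (½ ℚ.* ε) (½ ℚ.* (½ ℚ.* ε))
    (halves ε) (halves (½ ℚ.* ε)) (half-pos (half-pos 0<ε))
    where
    decide : ∀ η κ → η ℚ.+ η ≡ ε → κ ℚ.+ κ ≡ η → 0ℚ ℚ.< κ →
      (∃[ N ] (∀ i → N ℕ.≤ i → ℚ.∣ s i ∣ ℚ.< ε)) ⊎ Apart s
    decide η κ η+η κ+κ 0<κ with cs κ 0<κ
    ... | N , near with ℚ.∣ s N ∣ ℚ.<? η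
    ... | yes small = inj₁ (N , λ i N≤i →
            near-small {s i} {s N} κ+κ η+η 0<κ (near i N N≤i ℕ.≤-refl) small)
    ... | no large = inj₂ (κ , 0<κ , N , λ i N≤i →
            near-apart {s i} {s N} κ+κ (near N i ℕ.≤-refl N≤i) large)

  apart⇒¬null : ∀ {s} → Apart s → ¬ Null s
  apart⇒¬null (κ , 0<κ , M , far) ns with ns κ 0<κ
  ... | N , small = ℚ.<-asym (far (M ℕ.⊔ N) (ℕ.m≤m⊔n M N)) (small (M ℕ.⊔ N) (ℕ.m≤n⊔m M N))

  -- Smallness is asserted for one ε at a time, and for each ε the alternative of being apart
  -- contradicts the double negation.
  null-stable : ∀ {s} → Cauchy s → ¬ ¬ Null s → Null s
  null-stable cs ¬¬ns ε 0<ε with small-or-apart cs ε 0<ε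
  ... | inj₁ small = small
  ... | inj₂ apart = ⊥-elim (¬¬ns (apart⇒¬null apart))

  ¬null⇒¬¬apart : ∀ {s} → Cauchy s → ¬ Null s → ¬ ¬ Apart s
  ¬null⇒¬¬apart {s} cs ¬ns ¬apart = ¬ns λ ε 0<ε → small ε 0<ε
    where
    small : Null s
    small ε 0<ε with small-or-apart cs ε 0<ε
    ... | inj₁ x = x
    ... | inj₂ apart = ⊥-elim (¬apart apart)

  product-apart : ∀ {a b κ η} → 0ℚ ℚ.< κ → 0ℚ ℚ.< η → κ ℚ.< ℚ.∣ a ∣ → η ℚ.< ℚ.∣ b ∣ →
    κ ℚ.* η ℚ.< ℚ.∣ a ℚ.* b ∣
  product-apart {a} {b} {κ} {η} 0<κ 0<η a> b> = subst (κ ℚ.* η ℚ.<_) (sym (ℚ.∣p*q∣≡∣p∣*∣q∣ a b))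
    (ℚ.<-trans
      (ℚ.*-monoʳ-<-pos κ {{ℚ.positive 0<κ}} b>)
      (ℚ.*-monoˡ-<-pos ℚ.∣ b ∣ {{ℚ.positive (ℚ.<-trans 0<η b>)}} a>))

  apart-* : ∀ {s t} → Apart s → Apart t → Apart (λ i → s i ℚ.* t i)
  apart-* {s} {t} (κ , 0<κ , M , s>) (η , 0<η , N , t>) = κ ℚ.* η
    , subst (ℚ._< κ ℚ.* η) (ℚ.*-zeroʳ κ) (ℚ.*-monoʳ-<-pos κ {{ℚ.positive 0<κ}} 0<η)
    , M ℕ.⊔ N , λ i ≤i → product-apart {s i} {t i} 0<κ 0<η
        (s> i (ℕ.m⊔n≤o⇒m≤o M N ≤i)) (t> i (ℕ.m⊔n≤o⇒n≤o M N ≤i))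

  -- A product of two factors apart from zero is apart from zero; stability of the conclusion
  -- absorbs the double negations.
  null-*-cancel : ∀ {s t} → Cauchy s → Cauchy t →
    Null (λ i → s i ℚ.* t i) → ¬ Null s → Null t
  null-*-cancel cs ct nst ¬ns = null-stable ct λ ¬nt →
    ¬null⇒¬¬apart cs ¬ns λ as → ¬null⇒¬¬apart ct ¬nt λ at →
      apart⇒¬null (apart-* as at) nst

  -- A wrapper around the equality of ℝ, which unfolds to a Π-type and would leave
  -- Agda unable to infer the two sides.
  record _≋_ (x y : ℝ) : Set where
    constructor wrap
    field unwrap : x D.≈ y
  open _≋_ public

  infix 4 _≋_

  termwise : ∀ {x y} → (∀ i → seq x i ≡ seq y i) → x ≋ y
  termwise {x} {y} x≡y .unwrap =
    null-cong (λ i → sym (trans (cong (ℚ._- seq y i) (x≡y i)) (ℚ.+-inverseʳ (seq y i)))) null-0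

  ℝ-commutativeRing : CommutativeRing 0ℓ 0ℓ
  ℝ-commutativeRing = record
    { Carrier = ℝ ; _≈_ = _≋_ ; _+_ = D._+_ ; _*_ = D._*_ ; -_ = D.-_ ; 0# = D.0ℝ ; 1# = D.1ℝ
    ; isCommutativeRing = record
      { isRing = record
        { +-isAbelianGroup = record
          { isGroup = record
            { isMonoid = record
              { isSemigroup = record
                { isMagma = record
                  { isEquivalence = record { refl = ≋-refl ; sym = ≋-sym ; trans = ≋-trans }
                  ; ∙-cong = +-cong }
                ; assoc = λ x y z → termwise λ i → ℚ.+-assoc (seq x i) (seq y i) (seq z i) }
              ; identity = (λ x → termwise λ i → ℚ.+-identityˡ (seq x i))
                         , (λ x → termwise λ i → ℚ.+-identityʳ (seq x i)) }
            ; inverse = (λ x → termwise λ i → ℚ.+-inverseˡ (seq x i))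
                      , (λ x → termwise λ i → ℚ.+-inverseʳ (seq x i))
            ; ⁻¹-cong = neg-cong }
          ; comm = λ x y → termwise λ i → ℚ.+-comm (seq x i) (seq y i) }
        ; *-cong = *-cong
        ; *-assoc = λ x y z → termwise λ i → ℚ.*-assoc (seq x i) (seq y i) (seq z i)
        ; *-identity = (λ x → termwise λ i → ℚ.*-identityˡ (seq x i))
                     , (λ x → termwise λ i → ℚ.*-identityʳ (seq x i))
        ; distrib = (λ x y z → termwise λ i → ℚ.*-distribˡ-+ (seq x i) (seq y i) (seq z i))
                  , (λ x y z → termwise λ i → ℚ.*-distribʳ-+ (seq x i) (seq y i) (seq z i)) }
      ; *-comm = λ x y → termwise λ i → ℚ.*-comm (seq x i) (seq y i) } }
    where
    ≋-refl : ∀ {x} → x ≋ x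
    ≋-refl = termwise λ _ → refl

    ≋-sym : ∀ {x y} → x ≋ y → y ≋ x
    ≋-sym {x} {y} p .unwrap = null-cong (λ i → neg-minus (seq x i) (seq y i)) (null-neg (unwrap p))

    ≋-trans : ∀ {x y z} → x ≋ y → y ≋ z → x ≋ z
    ≋-trans {x} {y} {z} p q .unwrap =
      null-cong (λ i → minus-chain (seq x i) (seq y i) (seq z i)) (null-+ (unwrap p) (unwrap q))

    +-cong : ∀ {x y u v} → x ≋ y → u ≋ v → x D.+ u ≋ y D.+ v
    +-cong {x} {y} {u} {v} p q .unwrap =
      null-cong (λ i → +-minus-+ (seq x i) (seq y i) (seq u i) (seq v i)) (null-+ (unwrap p) (unwrap q))

    neg-cong : ∀ {x y} → x ≋ y → D.- x ≋ D.- y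
    neg-cong {x} {y} p .unwrap =
      null-cong (λ i → neg-minus-neg (seq x i) (seq y i)) (null-neg (unwrap p))

    *-cong : ∀ {x y u v} → x ≋ y → u ≋ v → x D.* u ≋ y D.* v
    *-cong {x} {y} {u} {v} p q .unwrap =
      null-cong (λ i → *-minus-* (seq x i) (seq y i) (seq u i) (seq v i))
        (null-+ {λ i → seq x i ℚ.* (seq u i ℚ.- seq v i)} {λ i → seq v i ℚ.* (seq x i ℚ.- seq y i)}
          (null-* {seq x} (cauchy x) (unwrap q)) (null-* {seq v} (cauchy v) (unwrap p)))

  minus-0 : ∀ x → x ℚ.- 0ℚ ≡ x
  minus-0 = ℚ.+-identityʳ

  ≋0⇒null : ∀ {x} → x ≋ D.0ℝ → Null (seq x)
  ≋0⇒null {x} p = null-cong (λ i → minus-0 (seq x i)) (unwrap p)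

  null⇒≋0 : ∀ {x} → Null (seq x) → x ≋ D.0ℝ
  null⇒≋0 {x} nx .unwrap = null-cong (λ i → sym (minus-0 (seq x i))) nx

  ≋0-stable : ∀ {x} → ¬ ¬ (x ≋ D.0ℝ) → x ≋ D.0ℝ
  ≋0-stable {x} ¬¬p = null⇒≋0 (null-stable (cauchy x) λ ¬n → ¬¬p λ p → ¬n (≋0⇒null p))

  *-cancel-≋0 : ∀ {x y} → x D.* y ≋ D.0ℝ → ¬ (x ≋ D.0ℝ) → y ≋ D.0ℝ
  *-cancel-≋0 {x} {y} xy≋0 x≉0 = null⇒≋0
    (null-*-cancel (cauchy x) (cauchy y) (≋0⇒null xy≋0) λ nx → x≉0 (null⇒≋0 nx))

  fromℚ-nonzero : ∀ {q} → ¬ q ≡ 0ℚ → ¬ (fromℚ q ≋ D.0ℝ)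
  fromℚ-nonzero {q} q≢0 p with ≋0⇒null p ℚ.∣ q ∣
    (ℚ.≰⇒> λ le → q≢0 (ℚ.∣p∣≡0⇒p≡0 q (ℚ.≤-antisym le (ℚ.0≤∣p∣ q))))
  ... | N , small = ℚ.<-irrefl refl (small N ℕ.≤-refl)

-- The interface to the scalars.

ℚ-rawRing : RawRing 0ℓ 0ℓ
ℚ-rawRing = CommutativeRing.rawRing ℚ.+-*-commutativeRing

-- What the proof uses of ℝ; it is kept abstract because Agda would otherwise unfold the
-- arithmetic of Cauchy sequences.
record Scalars : Set₁ where
  field
    commutativeRing : CommutativeRing 0ℓ 0ℓ
  open CommutativeRing commutativeRing
  field
    embedding : ℚ-rawRing -Raw-AlmostCommutative⟶ fromCommutativeRing commutativeRing
    stable    : ∀ {x} → ¬ ¬ (x ≈ 0#) → x ≈ 0#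
    cancel    : ∀ {x y} → x * y ≈ 0# → ¬ (x ≈ 0#) → y ≈ 0#
  open _-Raw-AlmostCommutative⟶_ embedding
  field
    faithful  : ∀ {q} → q ≢ 0ℚ → ¬ (⟦ q ⟧ ≈ 0#)

module ScalarAlgebra (S : Scalars) where
  open Scalars S public
  open CommutativeRing commutativeRing public renaming (refl to ≈-refl; sym to ≈-sym; trans to ≈-trans) hiding (zero)
  open _-Raw-AlmostCommutative⟶_ embedding public renaming (⟦_⟧ to ι)
  open SemiringSum semiring public
    using (sum; sum-cong-≋; sum-remove; ∑-distrib-+; ∑-comm; *-distribˡ-sum; *-distribʳ-sum; sum-replicate-zero)
  open import Relation.Binary.Reasoning.Setoid setoid public

  private
    coeff≟ : WeaklyDecidable (Induced-equivalence embedding)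
    coeff≟ p q with p ℚ.≟ q
    ... | yes refl = just ≈-refl
    ... | no _     = nothing

  module Solver = RingSolver ℚ-rawRing (fromCommutativeRing commutativeRing) embedding coeff≟

-- Polynomials with rational coefficients and their values.

module Polynomials (S : Scalars) where
  open import Data.List.Base using ([]; _∷_; _++_; length)
  open import Data.Vec.Base using ([]; _∷_)
  open import Data.List.Relation.Unary.All using ([]; _∷_)
  open ScalarAlgebra S
  open Solver using (solve; _:=_; _:+_; _:*_; _:-_; :-_; con)
  module Prod = Sum *-commutativeMonoid
  module Pow = Mult *-monoid

  private
    variable
      m : ℕ

  monomial : Vec ℕ m → Vector Carrier m → Carrier
  monomial k x = Prod.sum (λ i → lookup k i Pow.× x i)

  ev : Polynomial m → Vector Carrier m → Carrier
  ev []            x = 0#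
  ev ((c , k) ∷ f) x = ι c * monomial k x + ev f x

  infixl 6 _⊕_
  infixl 7 _⊗_

  _⊕_ : Polynomial m → Polynomial m → Polynomial m
  _⊕_ = _++_

  scale : ℚ × Vec ℕ m → Polynomial m → Polynomial m
  scale (c , k) []             = []
  scale (c , k) ((c′ , k′) ∷ g) = (c ℚ.* c′ , Vec.zipWith ℕ._+_ k k′) ∷ scale (c , k) g

  _⊗_ : Polynomial m → Polynomial m → Polynomial m
  []      ⊗ g = []
  (t ∷ f) ⊗ g = scale t g ⊕ f ⊗ g

  constant : ℚ → Polynomial m
  constant q = (q , Vec.replicate _ 0) ∷ []

  unit : Fin m → Vec ℕ m
  unit zero    = 1 ∷ Vec.replicate _ 0
  unit (suc i) = 0 ∷ unit i

  indeterminate : Fin m → Polynomial m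
  indeterminate i = (1ℚ , unit i) ∷ []

  ⊖_ : Polynomial m → Polynomial m
  ⊖ f = constant (ℚ.- 1ℚ) ⊗ f

  ev-⊕ : ∀ (f g : Polynomial m) x → ev (f ⊕ g) x ≈ ev f x + ev g x
  ev-⊕ []            g x = ≈-sym (+-identityˡ _)
  ev-⊕ ((c , k) ∷ f) g x = ≈-trans (+-congˡ (ev-⊕ f g x)) (≈-sym (+-assoc _ _ _))

  monomial-+ : ∀ (k l : Vec ℕ m) x → monomial (Vec.zipWith ℕ._+_ k l) x ≈ monomial k x * monomial l x
  monomial-+ []      []      x = ≈-sym (*-identityˡ _)
  monomial-+ (a ∷ k) (b ∷ l) x = begin
    (a ℕ.+ b) Pow.× x zero * monomial (Vec.zipWith ℕ._+_ k l) x′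
      ≈⟨ *-cong (Pow.×-homo-+ (x zero) a b) (monomial-+ k l x′) ⟩
    ((a Pow.× x zero) * (b Pow.× x zero)) * (monomial k x′ * monomial l x′)
      ≈⟨ solve 4 (λ p q r s → (p :* q) :* (r :* s) := (p :* r) :* (q :* s)) ≈-refl _ _ _ _ ⟩
    ((a Pow.× x zero) * monomial k x′) * ((b Pow.× x zero) * monomial l x′) ∎
    where x′ = λ i → x (suc i)

  ev-scale : ∀ c k (g : Polynomial m) x → ev (scale (c , k) g) x ≈ (ι c * monomial k x) * ev g x
  ev-scale c k []              x = ≈-sym (zeroʳ _)
  ev-scale c k ((c′ , k′) ∷ g) x = begin
    ι (c ℚ.* c′) * monomial (Vec.zipWith ℕ._+_ k k′) x + ev (scale (c , k) g) x
      ≈⟨ +-cong (*-cong (*-homo c c′) (monomial-+ k k′ x)) (ev-scale c k g x) ⟩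
    (ι c * ι c′) * (monomial k x * monomial k′ x) + (ι c * monomial k x) * ev g x
      ≈⟨ solve 5 (λ a b p q e → (a :* b) :* (p :* q) :+ (a :* p) :* e := (a :* p) :* (b :* q :+ e))
           ≈-refl _ _ _ _ _ ⟩
    (ι c * monomial k x) * (ι c′ * monomial k′ x + ev g x) ∎

  ev-⊗ : ∀ (f g : Polynomial m) x → ev (f ⊗ g) x ≈ ev f x * ev g x
  ev-⊗ []            g x = ≈-sym (zeroˡ _)
  ev-⊗ ((c , k) ∷ f) g x = begin
    ev (scale (c , k) g ⊕ f ⊗ g) x          ≈⟨ ev-⊕ (scale (c , k) g) (f ⊗ g) x ⟩
    ev (scale (c , k) g) x + ev (f ⊗ g) x   ≈⟨ +-cong (ev-scale c k g x) (ev-⊗ f g x) ⟩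
    (ι c * monomial k x) * ev g x + ev f x * ev g x ≈⟨ distribʳ _ _ _ ⟨
    (ι c * monomial k x + ev f x) * ev g x  ∎

  monomial-0 : ∀ {m} (x : Vector Carrier m) → monomial (Vec.replicate m 0) x ≈ 1#
  monomial-0 {zero}  x = ≈-refl
  monomial-0 {suc m} x = ≈-trans (*-identityˡ _) (monomial-0 (λ i → x (suc i)))

  monomial-unit : ∀ (i : Fin m) x → monomial (unit i) x ≈ x i
  monomial-unit zero    x = ≈-trans (*-cong (*-identityʳ _) (monomial-0 (λ i → x (suc i)))) (*-identityʳ _)
  monomial-unit (suc i) x = ≈-trans (*-identityˡ _) (monomial-unit i (λ j → x (suc j)))

  ev-constant : ∀ q (x : Vector Carrier m) → ev (constant q) x ≈ ι q
  ev-constant q x = ≈-trans (+-identityʳ _) (≈-trans (*-congˡ (monomial-0 x)) (*-identityʳ _))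

  ev-variable : ∀ (i : Fin m) x → ev (indeterminate i) x ≈ x i
  ev-variable i x = ≈-trans (+-identityʳ _)
    (≈-trans (*-cong 1-homo (monomial-unit i x)) (*-identityˡ _))

  ev-⊖ : ∀ (f : Polynomial m) x → ev (⊖ f) x ≈ - ev f x
  ev-⊖ f x = ≈-trans (ev-⊗ (constant (ℚ.- 1ℚ)) f x)
    (≈-trans (*-congʳ (ev-constant (ℚ.- 1ℚ) x))
      (solve 1 (λ a → con (ℚ.- 1ℚ) :* a := :- a) ≈-refl _))

  -- Exponents may repeat in the list. Taking out all their occurrences at once trades them for a
  -- single term with the total coefficient, as in `ev-remove`.
  remove : Vec ℕ m → Polynomial m → Polynomial m
  remove k []            = []
  remove k ((c , l) ∷ f) with does (Vec.≡-dec ℕ._≟_ l k)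
  ... | true  = remove k f
  ... | false = (c , l) ∷ remove k f

  length-remove : ∀ (k : Vec ℕ m) f → length (remove k f) ℕ.≤ length f
  length-remove k []            = ℕ.z≤n
  length-remove k ((c , l) ∷ f) with does (Vec.≡-dec ℕ._≟_ l k)
  ... | true  = ℕ.m≤n⇒m≤1+n (length-remove k f)
  ... | false = ℕ.s≤s (length-remove k f)

  ev-remove : ∀ (k : Vec ℕ m) f x → ev f x ≈ ι (coeff f k) * monomial k x + ev (remove k f) x
  ev-remove k []            x = ≈-sym (≈-trans (+-identityʳ _)
    (≈-trans (*-congʳ 0-homo) (zeroˡ _)))
  ev-remove k ((c , l) ∷ f) x with Vec.≡-dec ℕ._≟_ l k
  ... | yes refl = begin
    ι c * monomial k x + ev f x
      ≈⟨ +-congˡ (ev-remove k f x) ⟩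
    ι c * monomial k x + (ι (coeff f k) * monomial k x + ev (remove k f) x)
      ≈⟨ solve 4 (λ a b p e → a :* p :+ (b :* p :+ e) := (a :+ b) :* p :+ e) ≈-refl _ _ _ _ ⟩
    (ι c + ι (coeff f k)) * monomial k x + ev (remove k f) x
      ≈⟨ +-congʳ (*-congʳ (≈-sym (+-homo c (coeff f k)))) ⟩
    ι (c ℚ.+ coeff f k) * monomial k x + ev (remove k f) x ∎
  ... | no _ = begin
    ι c * monomial l x + ev f x
      ≈⟨ +-congˡ (ev-remove k f x) ⟩
    ι c * monomial l x + (ι (coeff f k) * monomial k x + ev (remove k f) x)
      ≈⟨ solve 3 (λ a b e → a :+ (b :+ e) := b :+ (a :+ e)) ≈-refl _ _ _ ⟩
    ι (coeff f k) * monomial k x + (ι c * monomial l x + ev (remove k f) x) ∎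

  coeff-remove-same : ∀ (k : Vec ℕ m) f → coeff (remove k f) k ≡ 0ℚ
  coeff-remove-same k []            = refl
  coeff-remove-same k ((c , l) ∷ f) with Vec.≡-dec ℕ._≟_ l k
  ... | yes _  = coeff-remove-same k f
  ... | no l≢k rewrite dec-false (Vec.≡-dec ℕ._≟_ l k) l≢k = coeff-remove-same k f

  coeff-remove-other : ∀ {k e : Vec ℕ m} f → k ≢ e → coeff (remove k f) e ≡ coeff f e
  coeff-remove-other []            k≢e = refl
  coeff-remove-other {k = k} {e} ((c , l) ∷ f) k≢e with Vec.≡-dec ℕ._≟_ l k
  ... | yes refl rewrite dec-false (Vec.≡-dec ℕ._≟_ k e) k≢e = coeff-remove-other f k≢e
  ... | no _ with does (Vec.≡-dec ℕ._≟_ l e)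
  ...   | true  = cong (c ℚ.+_) (coeff-remove-other f k≢e)
  ...   | false = coeff-remove-other f k≢e

  coeff-remove-0 : ∀ (k e : Vec ℕ m) f → coeff f e ≡ 0ℚ → coeff (remove k f) e ≡ 0ℚ
  coeff-remove-0 k e f fe≡0 with Vec.≡-dec ℕ._≟_ k e
  ... | yes refl = coeff-remove-same k f
  ... | no k≢e   = ≡.trans (coeff-remove-other f k≢e) fe≡0

  length-remove-head : ∀ c (k : Vec ℕ m) f → length (remove k ((c , k) ∷ f)) ℕ.≤ length f
  length-remove-head c k f rewrite dec-true (Vec.≡-dec ℕ._≟_ k k) refl = length-remove k f

  -- Induction on the number of terms: removing the exponents of the head shortens the list, leaves
  -- the value unchanged because their total coefficient is zero, and keeps all coefficients zero.
  vanishes : ∀ (f : Polynomial m) → (∀ e → coeff f e ≡ 0ℚ) → ∀ x → ev f x ≈ 0#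
  vanishes f = go (length f) f ℕ.≤-refl
    where
    go : ∀ N f → length f ℕ.≤ N → (∀ e → coeff f e ≡ 0ℚ) → ∀ x → ev f x ≈ 0#
    go N       []            _    _   x = ≈-refl
    go (suc N) ((c , k) ∷ f) (ℕ.s≤s le) f≡0 x = begin
      ev ((c , k) ∷ f) x
        ≈⟨ ev-remove k ((c , k) ∷ f) x ⟩
      ι (coeff ((c , k) ∷ f) k) * monomial k x + ev (remove k ((c , k) ∷ f)) x
        ≈⟨ +-cong (*-congʳ (≈-trans (reflexive (cong ι (f≡0 k))) 0-homo))
             (go N (remove k ((c , k) ∷ f)) (ℕ.≤-trans (length-remove-head c k f) le)
               (λ e → coeff-remove-0 k e ((c , k) ∷ f) (f≡0 e)) x) ⟩
      0# * monomial k x + 0#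
        ≈⟨ ≈-trans (+-identityʳ _) (zeroˡ _) ⟩
      0# ∎

  coeff-support : ∀ {P : Vec ℕ m → Set} {e} f → All (λ t → P (proj₂ t)) f → coeff f e ≢ 0ℚ → P e
  coeff-support []            []       fe≢0 = contradiction refl fe≢0
  coeff-support {e = e} ((c , k) ∷ f) (p ∷ ps) fe≢0 with Vec.≡-dec ℕ._≟_ k e
  ... | yes refl = p
  ... | no _     = coeff-support f ps fe≢0

  zero? : (f : Polynomial m) → Dec (∀ e → coeff f e ≡ 0ℚ)
  zero? f with All.all? (λ t → coeff f (proj₂ t) ℚ.≟ 0ℚ) f
  ... | no ¬all = no λ f≡0 → ¬all (All.universal (λ t → f≡0 (proj₂ t)) f)
  ... | yes all = yes λ e → case-≡0 e (coeff f e ℚ.≟ 0ℚ)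
    where
    case-≡0 : ∀ e → Dec (coeff f e ≡ 0ℚ) → coeff f e ≡ 0ℚ
    case-≡0 e (yes p) = p
    -- A nonzero coefficient would put `e` among the listed exponents, and all of those were checked
    -- to have coefficient zero.
    case-≡0 e (no ¬p) = coeff-support {P = λ k → coeff f k ≡ 0ℚ} f all ¬p

  Independent : Vector Carrier m → Set
  Independent {m} p = (f : Polynomial m) → ev f p ≈ 0# → ∀ e → coeff f e ≡ 0ℚ

  generic⇒everywhere : ∀ {p : Vector Carrier m} → Independent p → ∀ f → ev f p ≈ 0# → ∀ x → ev f x ≈ 0#
  generic⇒everywhere ind f fp≈0 = vanishes f (ind f fp≈0)

  -- The source of every decision about scalars below.
  ev-≈0? : ∀ {p : Vector Carrier m} → Independent p → ∀ f → Dec (ev f p ≈ 0#)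
  ev-≈0? {p = p} ind f with zero? f
  ... | yes f≡0 = yes (vanishes f f≡0 p)
  ... | no ¬f≡0 = no λ fp≈0 → ¬f≡0 (ind f fp≈0)

-- Independence, functionals and spans without decidable equality.

module LinearAlgebra (S : Scalars) where
  open import Data.List.Base using ([]; _∷_)
  open import Data.Vec.Functional using (insertAt)
  open ScalarAlgebra S
  open Solver using (solve; _:=_; _:+_; _:*_; _:-_; :-_; con)

  private
    variable
      m r : ℕ
      J : Set

  1≉0 : ¬ (1# ≈ 0#)
  1≉0 1≈0 = faithful {1ℚ} (λ ()) (≈-trans 1-homo 1≈0)

  *-nonzero : ∀ {x y} → ¬ (x ≈ 0#) → ¬ (y ≈ 0#) → ¬ (x * y ≈ 0#)
  *-nonzero x≉0 y≉0 xy≈0 = y≉0 (cancel xy≈0 x≉0)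

  sum-0 : ∀ {n} (f : Vector Carrier n) → (∀ i → f i ≈ 0#) → sum f ≈ 0#
  sum-0 {n} f f≈0 = ≈-trans (sum-cong-≋ f≈0) (sum-replicate-zero n)

  sum-single : ∀ {n} (f : Vector Carrier n) i → (∀ j → j ≢ i → f j ≈ 0#) → sum f ≈ f i
  sum-single {suc n} f i f≈0 = begin
    sum f                            ≈⟨ sum-remove {i = i} f ⟩
    f i + sum (λ j → f (punchIn i j)) ≈⟨ +-congˡ (sum-0 _ λ j → f≈0 _ (Fin.punchInᵢ≢i i j)) ⟩
    f i + 0#                         ≈⟨ +-identityʳ _ ⟩
    f i                              ∎

  LI : (Fin r → J → Carrier) → Set
  LI {r} A = (c : Vector Carrier r) → (∀ j → sum (λ k → c k * A k j) ≈ 0#) → ∀ k → c k ≈ 0#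

  LI-dimension : ∀ {m r} (A : Fin m → Fin r → Carrier) → LI A → m ℕ.≤ r
  LI-dimension {zero}  {r}     A li = ℕ.z≤n
  LI-dimension {suc m} {zero}  A li = contradiction (li (λ _ → 1#) (λ ()) zero) 1≉0
  LI-dimension {suc m} {suc r} A li = decidable-stable (suc m ℕ.≤? suc r) λ m≰r →
    m≰r (ℕ.m≤n⇒m≤1+n (LI-dimension (λ k l → A k (suc l)) λ c rel → li c λ
      { zero    → sum-0 (λ k → c k * A k zero) λ k → ≈-trans (*-congˡ (stable λ Ak0≉0 →
                    m≰r (ℕ.s≤s (LI-dimension _ (reduced k Ak0≉0))))) (zeroʳ (c k))
      ; (suc l) → rel l }))
    where
    reduced : ∀ p → ¬ (A p zero ≈ 0#) →
      LI (λ i l → A p zero * A (punchIn p i) (suc l) - A (punchIn p i) zero * A p (suc l))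
    reduced p a≉0 y rel i = cancel (≈-trans (reflexive (≡.sym (Vector.insertAt-punchIn z p z₀ i))) (li c rel′ (punchIn p i))) a≉0
      where
      a = A p zero
      -- A relation `y` among the reduced rows lifts to the original ones: the other rows get the
      -- pivot times `y`, the pivot row gets what cancels column zero.
      z : Vector Carrier m
      z i = a * y i
      z₀ = - sum (λ i → y i * A (punchIn p i) zero)
      c = insertAt z p z₀
      expand : ∀ l → sum (λ k → c k * A k l) ≈ z₀ * A p l + sum (λ i → z i * A (punchIn p i) l)
      expand l = ≈-trans (sum-remove {i = p} (λ k → c k * A k l))
        (+-cong (*-congʳ (reflexive (Vector.insertAt-lookup z p z₀)))
          (sum-cong-≋ λ i → *-congʳ (reflexive (Vector.insertAt-punchIn z p z₀ i))))
      rel′ : ∀ l → sum (λ k → c k * A k l) ≈ 0#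
      rel′ l = begin
        sum (λ k → c k * A k l)
          ≈⟨ expand l ⟩
        z₀ * A p l + sum (λ i → z i * A (punchIn p i) l)
          ≈⟨ +-congʳ (≈-trans (solve 2 (λ x b → (:- x) :* b := x :* (:- b)) ≈-refl _ _)
               (*-distribʳ-sum (- A p l) (λ i → y i * A (punchIn p i) zero))) ⟩
        sum (λ i → (y i * A (punchIn p i) zero) * - A p l) + sum (λ i → z i * A (punchIn p i) l)
          ≈⟨ ≈-sym (∑-distrib-+ (λ i → (y i * A (punchIn p i) zero) * - A p l) (λ i → z i * A (punchIn p i) l)) ⟩
        sum (λ i → (y i * A (punchIn p i) zero) * - A p l + z i * A (punchIn p i) l)
          ≈⟨ combined l ⟩
        0# ∎
        where
        combined : ∀ l → sum (λ i → (y i * A (punchIn p i) zero) * - A p l + z i * A (punchIn p i) l) ≈ 0#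
        combined zero    = sum-0 _ λ i →
          ≈-trans (solve 3 (λ y b a → (y :* b) :* (:- a) :+ (a :* y) :* b := con 0ℚ) ≈-refl (y i) _ a) 0-homo
        combined (suc l) = ≈-trans (sum-cong-≋ λ i →
          solve 5 (λ y b e a g → (y :* b) :* (:- e) :+ (a :* y) :* g := y :* (a :* g :- b :* e)) ≈-refl (y i) _ _ a _)
          (rel l)

  -- Finitely supported linear forms, as lists of weighted coordinates; this asks nothing of `J`.
  Functional : Set → Set
  Functional J = List (Carrier × J)

  ⟪_,_⟫ : Functional J → (J → Carrier) → Carrier
  ⟪ []          , w ⟫ = 0#
  ⟪ (c , j) ∷ φ , w ⟫ = c * w j + ⟪ φ , w ⟫

  ⟪⟫-cong : ∀ (φ : Functional J) {w w′} → (∀ j → w j ≈ w′ j) → ⟪ φ , w ⟫ ≈ ⟪ φ , w′ ⟫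
  ⟪⟫-cong []            w≈ = ≈-refl
  ⟪⟫-cong ((c , j) ∷ φ) w≈ = +-cong (*-congˡ (w≈ j)) (⟪⟫-cong φ w≈)

  ⟪⟫-0 : ∀ (φ : Functional J) {w} → (∀ j → w j ≈ 0#) → ⟪ φ , w ⟫ ≈ 0#
  ⟪⟫-0 []            w≈0 = ≈-refl
  ⟪⟫-0 ((c , j) ∷ φ) w≈0 = ≈-trans (+-cong (≈-trans (*-congˡ (w≈0 j)) (zeroʳ c)) (⟪⟫-0 φ w≈0)) (+-identityʳ _)

  ⟪⟫-+ : ∀ (φ : Functional J) w w′ → ⟪ φ , (λ j → w j + w′ j) ⟫ ≈ ⟪ φ , w ⟫ + ⟪ φ , w′ ⟫
  ⟪⟫-+ []            w w′ = ≈-sym (+-identityʳ _)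
  ⟪⟫-+ ((c , j) ∷ φ) w w′ = ≈-trans (+-congˡ (⟪⟫-+ φ w w′))
    (solve 5 (λ c a b e f → c :* (a :+ b) :+ (e :+ f) := (c :* a :+ e) :+ (c :* b :+ f)) ≈-refl _ _ _ _ _)

  ⟪⟫-* : ∀ (φ : Functional J) a w → ⟪ φ , (λ j → a * w j) ⟫ ≈ a * ⟪ φ , w ⟫
  ⟪⟫-* []            a w = ≈-sym (zeroʳ a)
  ⟪⟫-* ((c , j) ∷ φ) a w = ≈-trans (+-congˡ (⟪⟫-* φ a w))
    (solve 4 (λ c a b e → c :* (a :* b) :+ a :* e := a :* (c :* b :+ e)) ≈-refl _ _ _ _)

  ⟪⟫-sum : ∀ (φ : Functional J) (A : Fin r → J → Carrier) →
    ⟪ φ , (λ j → sum (λ k → A k j)) ⟫ ≈ sum (λ k → ⟪ φ , A k ⟫)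
  ⟪⟫-sum {r = zero}  φ A = ⟪⟫-0 φ λ _ → ≈-refl
  ⟪⟫-sum {r = suc r} φ A = ≈-trans (⟪⟫-+ φ (A zero) _) (+-congˡ (⟪⟫-sum φ (A ∘ suc)))

  ⟪⟫-combination : ∀ (φ : Functional J) (c : Vector Carrier r) (A : Fin r → J → Carrier) →
    ⟪ φ , (λ j → sum (λ k → c k * A k j)) ⟫ ≈ sum (λ k → c k * ⟪ φ , A k ⟫)
  ⟪⟫-combination φ c A = ≈-trans (⟪⟫-sum φ (λ k j → c k * A k j)) (sum-cong-≋ λ k → ⟪⟫-* φ (c k) (A k))

  -- The dual description of the span, free of coefficients and hence of division;
  -- `Span⇒combination` recovers coefficients from a certificate.
  Span : (Fin r → J → Carrier) → (J → Carrier) → Set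
  Span B a = ∀ ψ → (∀ k → ⟪ ψ , B k ⟫ ≈ 0#) → ⟪ ψ , a ⟫ ≈ 0#

-- Division-free elimination and specialisation to generic points.

module Elimination (S : Scalars) where
  open import Data.List.Base using ([]; _∷_; _++_)
  open ScalarAlgebra S
  open Solver using (solve; _:=_; _:+_; _:*_; _:-_; :-_; con)
  open Polynomials S
  open LinearAlgebra S

  private
    variable
      m r : ℕ
      J : Set

  at : (J → Polynomial m) → Vector Carrier m → J → Carrier
  at w x j = ev (w j) x

  -- Polynomial coefficients make one dual family serve all points, so that a certificate obtained
  -- at one point can be used at another.
  PolyFunctional : ℕ → Set → Set
  PolyFunctional m J = List (Polynomial m × J)

  _at′_ : PolyFunctional m J → Vector Carrier m → Functional J
  []            at′ x = []
  ((c , j) ∷ φ) at′ x = (ev c x , j) ∷ (φ at′ x)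

  at′-++ : ∀ (φ ψ : PolyFunctional m J) x w →
    ⟪ (φ ++ ψ) at′ x , w ⟫ ≈ ⟪ φ at′ x , w ⟫ + ⟪ ψ at′ x , w ⟫
  at′-++ []            ψ x w = ≈-sym (+-identityˡ _)
  at′-++ ((c , j) ∷ φ) ψ x w = ≈-trans (+-congˡ (at′-++ φ ψ x w)) (≈-sym (+-assoc _ _ _))

  infixr 7 _·_
  _·_ : Polynomial m → PolyFunctional m J → PolyFunctional m J
  f · []            = []
  f · ((c , j) ∷ φ) = (f ⊗ c , j) ∷ f · φ

  at′-· : ∀ (f : Polynomial m) (φ : PolyFunctional m J) x w →
    ⟪ (f · φ) at′ x , w ⟫ ≈ ev f x * ⟪ φ at′ x , w ⟫
  at′-· f []            x w = ≈-sym (zeroʳ _)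
  at′-· f ((c , j) ∷ φ) x w = ≈-trans (+-cong (*-congʳ (ev-⊗ f c x)) (at′-· f φ x w))
    (solve 4 (λ f c w e → (f :* c) :* w :+ f :* e := f :* (c :* w :+ e)) ≈-refl _ _ _ _)

  ∑F : (Fin r → PolyFunctional m J) → PolyFunctional m J
  ∑F {r = zero}  φ = []
  ∑F {r = suc r} φ = φ zero ++ ∑F (φ ∘ suc)

  at′-∑F : ∀ (φ : Fin r → PolyFunctional m J) x w → ⟪ ∑F φ at′ x , w ⟫ ≈ sum (λ k → ⟪ φ k at′ x , w ⟫)
  at′-∑F {r = zero}  φ x w = ≈-refl
  at′-∑F {r = suc r} φ x w = ≈-trans (at′-++ (φ zero) _ x w) (+-congˡ (at′-∑F (φ ∘ suc) x w))

  pair : PolyFunctional m J → (J → Polynomial m) → Polynomial m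
  pair []            w = []
  pair ((c , j) ∷ φ) w = c ⊗ w j ⊕ pair φ w

  ev-pair : ∀ (φ : PolyFunctional m J) w x → ev (pair φ w) x ≈ ⟪ φ at′ x , at w x ⟫
  ev-pair []            w x = ≈-refl
  ev-pair ((c , j) ∷ φ) w x = ≈-trans (ev-⊕ (c ⊗ w j) _ x) (+-cong (ev-⊗ c (w j) x) (ev-pair φ w x))

  -- A dual family, up to the common factor s, certifies independence of the rows at
  -- every point where s does not vanish.
  record Certificate (A : Fin r → J → Polynomial m) (q : Vector Carrier m) : Set where
    field
      s          : Polynomial m
      s≉0        : ¬ (ev s q ≈ 0#)
      dual       : Fin r → PolyFunctional m J
      dual-same  : ∀ k x → ⟪ dual k at′ x , at (A k) x ⟫ ≈ ev s x
      dual-other : ∀ {k l} x → l ≢ k → ⟪ dual k at′ x , at (A l) x ⟫ ≈ 0#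

    dual-sum : ∀ (c : Vector Carrier r) l x → sum (λ k → c k * ⟪ dual k at′ x , at (A l) x ⟫) ≈ c l * ev s x
    dual-sum c l x = ≈-trans
      (sum-single _ l λ k k≢l → ≈-trans (*-congˡ (dual-other x (k≢l ∘ ≡.sym))) (zeroʳ _))
      (*-congˡ (dual-same l x))

    independent-at : ∀ x → ¬ (ev s x ≈ 0#) → LI (λ k → at (A k) x)
    independent-at x sx≉0 c rel l = cancel (≈-trans (*-comm _ _) (≈-trans (≈-sym eq) (⟪⟫-0 (dual l at′ x) rel))) sx≉0
      where
      eq : ⟪ dual l at′ x , (λ j → sum (λ k → c k * at (A k) x j)) ⟫ ≈ c l * ev s x
      eq = ≈-trans (⟪⟫-combination (dual l at′ x) c (λ k → at (A k) x))
        (≈-trans (sum-single _ l λ k k≢l → ≈-trans (*-congˡ (dual-other x k≢l)) (zeroʳ _))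
          (*-congˡ (dual-same l x)))

    -- On `w` it gives, scaled by `s`, entry `j` of `w` minus that of the combination of rows which
    -- the dual family predicts for `w`. It is zero on the rows, so a nonzero value shows that `w`
    -- is outside their span.
    annihilator : J → PolyFunctional m J
    annihilator j = (s , j) ∷ ∑F (λ k → (⊖ A k j) · dual k)

    annihilator-value : ∀ j x w →
      ⟪ annihilator j at′ x , w ⟫ ≈ ev s x * w j - sum (λ k → ev (A k j) x * ⟪ dual k at′ x , w ⟫)
    annihilator-value j x w = +-congˡ (begin
      ⟪ ∑F (λ k → (⊖ A k j) · dual k) at′ x , w ⟫
        ≈⟨ at′-∑F (λ k → (⊖ A k j) · dual k) x w ⟩
      sum (λ k → ⟪ ((⊖ A k j) · dual k) at′ x , w ⟫)
        ≈⟨ sum-cong-≋ (λ k → ≈-trans (at′-· (⊖ A k j) (dual k) x w) (≈-trans (*-congʳ (ev-⊖ (A k j) x))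
             (solve 2 (λ a b → (:- a) :* b := (a :* b) :* con (ℚ.- 1ℚ)) ≈-refl _ _))) ⟩
      sum (λ k → (ev (A k j) x * ⟪ dual k at′ x , w ⟫) * ι (ℚ.- 1ℚ))
        ≈⟨ ≈-sym (*-distribʳ-sum (ι (ℚ.- 1ℚ)) (λ k → ev (A k j) x * ⟪ dual k at′ x , w ⟫)) ⟩
      sum (λ k → ev (A k j) x * ⟪ dual k at′ x , w ⟫) * ι (ℚ.- 1ℚ)
        ≈⟨ solve 1 (λ a → a :* con (ℚ.- 1ℚ) := :- a) ≈-refl _ ⟩
      - sum (λ k → ev (A k j) x * ⟪ dual k at′ x , w ⟫) ∎)

    annihilates : ∀ j x l → ⟪ annihilator j at′ x , at (A l) x ⟫ ≈ 0#
    annihilates j x l = begin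
      ⟪ annihilator j at′ x , at (A l) x ⟫ ≈⟨ annihilator-value j x (at (A l) x) ⟩
      ev s x * ev (A l j) x - sum (λ k → ev (A k j) x * ⟪ dual k at′ x , at (A l) x ⟫)
        ≈⟨ +-congˡ (-‿cong (dual-sum (λ k → ev (A k j) x) l x)) ⟩
      ev s x * ev (A l j) x - ev (A l j) x * ev s x
        ≈⟨ solve 2 (λ a b → a :* b :- b :* a := con 0ℚ) ≈-refl _ _ ⟩
      ι 0ℚ ≈⟨ 0-homo ⟩
      0# ∎

    Span⇒combination : ∀ {a x} → Span (λ k → at (A k) x) a → ∀ j →
      ev s x * a j ≈ sum (λ k → ev (A k j) x * ⟪ dual k at′ x , a ⟫)
    Span⇒combination {a} {x} span j = begin
      ev s x * a j ≈⟨ solve 2 (λ p q → p := (p :- q) :+ q) ≈-refl _ _ ⟩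
      ev s x * a j - Σ + Σ ≈⟨ +-congʳ (≈-trans (≈-sym (annihilator-value j x a)) (span (annihilator j at′ x) (annihilates j x))) ⟩
      0# + Σ ≈⟨ +-identityˡ _ ⟩
      Σ ∎
      where Σ = sum (λ k → ev (A k j) x * ⟪ dual k at′ x , a ⟫)

  open Certificate

  restrict : ∀ {r′} {A : Fin r → J → Polynomial m} {q} {f : Fin r′ → Fin r} → (∀ {a b} → f a ≡ f b → a ≡ b) →
    Certificate A q → Certificate (A ∘ f) q
  restrict {f = f} f-injective C = record
    { s = s C ; s≉0 = s≉0 C ; dual = dual C ∘ f
    ; dual-same = dual-same C ∘ f ; dual-other = λ x l≢k → dual-other C x (l≢k ∘ f-injective) }

  residual : ∀ {A : Fin r → J → Polynomial m} {q} → Certificate A q → (J → Polynomial m) → J → Polynomial m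
  residual C a j = pair (annihilator C j) a

  extend : ∀ {A : Fin (suc r) → J → Polynomial m} {q} (C : Certificate (A ∘ suc) q) j →
    ¬ (ev (residual C (A zero) j) q ≈ 0#) → Certificate A q
  extend {r} {J} {m} {A} {q} C j t≉0 = record
    { s = s C ⊗ t
    ; s≉0 = λ st≈0 → *-nonzero (s≉0 C) t≉0 (≈-trans (≈-sym (ev-⊗ (s C) t q)) st≈0)
    ; dual = new
    ; dual-same = same
    ; dual-other = other
    }
    where
    a = A zero
    β = annihilator C j
    t = pair β a
    -- Orthogonalisation without division: the new row gets `s` times `β`, and from each old dual,
    -- scaled by `t`, the multiple of `β` is subtracted that makes it kill the new row. The common
    -- diagonal value becomes `s` times `t`.
    new : Fin (suc r) → PolyFunctional m J
    new zero    = s C · β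
    new (suc k) = t · dual C k ++ (⊖ pair (dual C k) a) · β
    new-suc : ∀ k x w → ⟪ new (suc k) at′ x , w ⟫ ≈
      ev t x * ⟪ dual C k at′ x , w ⟫ + (- ⟪ dual C k at′ x , at a x ⟫) * ⟪ β at′ x , w ⟫
    new-suc k x w = ≈-trans (at′-++ (t · dual C k) _ x w)
      (+-cong (at′-· t (dual C k) x w)
        (≈-trans (at′-· (⊖ pair (dual C k) a) β x w)
          (*-congʳ (≈-trans (ev-⊖ (pair (dual C k) a) x) (-‿cong (ev-pair (dual C k) a x))))))
    new-suc-A : ∀ k l x → ⟪ new (suc k) at′ x , at (A (suc l)) x ⟫ ≈ ev t x * ⟪ dual C k at′ x , at (A (suc l)) x ⟫
    new-suc-A k l x = ≈-trans (new-suc k x _)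
      (≈-trans (+-congˡ (≈-trans (*-congˡ (annihilates C j x l)) (zeroʳ _))) (+-identityʳ _))
    same : ∀ k x → ⟪ new k at′ x , at (A k) x ⟫ ≈ ev (s C ⊗ t) x
    same zero    x = ≈-trans (at′-· (s C) β x (at a x))
      (≈-trans (*-congˡ (≈-sym (ev-pair β a x))) (≈-sym (ev-⊗ (s C) t x)))
    same (suc k) x = ≈-trans (new-suc-A k k x)
      (≈-trans (*-congˡ (dual-same C k x)) (≈-trans (*-comm _ _) (≈-sym (ev-⊗ (s C) t x))))
    other : ∀ {k l} x → l ≢ k → ⟪ new k at′ x , at (A l) x ⟫ ≈ 0#
    other {zero}  {zero}  x l≢k = contradiction refl l≢k
    other {zero}  {suc l} x l≢k = ≈-trans (at′-· (s C) β x _) (≈-trans (*-congˡ (annihilates C j x l)) (zeroʳ _))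
    other {suc k} {zero}  x l≢k = begin
      ⟪ new (suc k) at′ x , at a x ⟫ ≈⟨ new-suc k x (at a x) ⟩
      ev t x * ⟪ dual C k at′ x , at a x ⟫ + (- ⟪ dual C k at′ x , at a x ⟫) * ⟪ β at′ x , at a x ⟫
        ≈⟨ +-congʳ (*-congʳ (ev-pair β a x)) ⟩
      ⟪ β at′ x , at a x ⟫ * ⟪ dual C k at′ x , at a x ⟫ + (- ⟪ dual C k at′ x , at a x ⟫) * ⟪ β at′ x , at a x ⟫
        ≈⟨ solve 2 (λ b e → b :* e :+ (:- e) :* b := con 0ℚ) ≈-refl _ _ ⟩
      ι 0ℚ ≈⟨ 0-homo ⟩
      0# ∎
    other {suc k} {suc l} x l≢k = ≈-trans (new-suc-A k l x)
      (≈-trans (*-congˡ (dual-other C x (l≢k ∘ cong suc))) (zeroʳ _))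

  empty : ∀ {A : Fin 0 → J → Polynomial m} {q} → Certificate A q
  empty {q = q} = record
    { s = constant 1ℚ ; s≉0 = λ e → 1≉0 (≈-trans (≈-sym 1-homo) (≈-trans (≈-sym (ev-constant 1ℚ q)) e))
    ; dual = λ () ; dual-same = λ () ; dual-other = λ { {()} } }

  -- Zero residuals write `s` times `a` as a combination of the rows, and `s` is nonzero at `q`, so
  -- it cancels.
  residual-0⇒Span : ∀ {A : Fin r → J → Polynomial m} {q} (C : Certificate A q) a →
    (∀ j → ev (residual C a j) q ≈ 0#) → Span (λ k → at (A k) q) (at a q)
  residual-0⇒Span {r} {A = A} {q} C a res≈0 ψ ψA≈0 = cancel (≈-trans (≈-sym lhs) rhs) (s≉0 C)
    where
    c = λ k → ⟪ dual C k at′ q , at a q ⟫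
    lhs : ⟪ ψ , (λ j → ev (s C) q * at a q j) ⟫ ≈ ev (s C) q * ⟪ ψ , at a q ⟫
    lhs = ⟪⟫-* ψ (ev (s C) q) (at a q)
    eq : ∀ j → ev (s C) q * at a q j ≈ sum (λ k → c k * ev (A k j) q)
    eq j = begin
      ev (s C) q * at a q j ≈⟨ solve 2 (λ p q → p := (p :- q) :+ q) ≈-refl _ _ ⟩
      ev (s C) q * at a q j - Σ + Σ
        ≈⟨ +-congʳ (≈-trans (≈-sym (annihilator-value C j q (at a q))) (≈-trans (≈-sym (ev-pair (annihilator C j) a q)) (res≈0 j))) ⟩
      0# + Σ ≈⟨ +-identityˡ _ ⟩
      Σ ≈⟨ sum-cong-≋ {r} (λ k → *-comm (ev (A k j) q) (c k)) ⟩
      sum (λ k → c k * ev (A k j) q) ∎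
      where Σ = sum (λ k → ev (A k j) q * ⟪ dual C k at′ q , at a q ⟫)
    rhs : ⟪ ψ , (λ j → ev (s C) q * at a q j) ⟫ ≈ 0#
    rhs = ≈-trans (⟪⟫-cong ψ eq) (≈-trans (⟪⟫-combination ψ c (λ k → at (A k) q))
      (sum-0 _ λ k → ≈-trans (*-congˡ (ψA≈0 k)) (zeroʳ _)))

  LI-tail : (A : Fin (suc r) → J → Carrier) → LI A → LI (A ∘ suc)
  LI-tail A li c rel k = li c′ rel′ (suc k)
    where
    c′ : Vector Carrier _
    c′ zero    = 0#
    c′ (suc k) = c k
    rel′ = λ j → ≈-trans (+-cong (zeroˡ _) (rel j)) (+-identityʳ _)

  -- At an arbitrary point no nonzero residual can be exhibited, hence the double negation. If all
  -- residuals of the new row vanished, the row would satisfy a relation in which its own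
  -- coefficient is the nonzero value of `s`.
  LI⇒¬¬Certificate : ∀ (A : Fin r → J → Polynomial m) q → LI (λ k → at (A k) q) → ¬ ¬ Certificate A q
  LI⇒¬¬Certificate {r = zero}  A q li ¬cert = ¬cert empty
  LI⇒¬¬Certificate {r = suc r} A q li ¬cert =
    LI⇒¬¬Certificate (A ∘ suc) q (LI-tail (λ k → at (A k) q) li) λ C →
      let c : Vector Carrier (suc r)
          c = λ { zero → ev (s C) q ; (suc k) → - ⟪ dual C k at′ q , at (A zero) q ⟫ }
      in s≉0 C (li c (λ j → relation C j (stable λ t≉0 → ¬cert (extend C j t≉0))) zero)
    where
    relation : ∀ (C : Certificate (A ∘ suc) q) j → ev (residual C (A zero) j) q ≈ 0# →
      ev (s C) q * at (A zero) q j + sum (λ k → (- ⟪ dual C k at′ q , at (A zero) q ⟫) * at (A (suc k)) q j) ≈ 0#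
    relation C j t≈0 = begin
      ev (s C) q * a + sum (λ k → (- c k) * B k)
        ≈⟨ +-congˡ (sum-cong-≋ λ k → solve 2 (λ c b → (:- c) :* b := (b :* c) :* con (ℚ.- 1ℚ)) ≈-refl (c k) (B k)) ⟩
      ev (s C) q * a + sum (λ k → (B k * c k) * ι (ℚ.- 1ℚ))
        ≈⟨ +-congˡ (≈-sym (*-distribʳ-sum (ι (ℚ.- 1ℚ)) (λ k → B k * c k))) ⟩
      ev (s C) q * a + sum (λ k → B k * c k) * ι (ℚ.- 1ℚ)
        ≈⟨ solve 2 (λ p a → p :+ a :* con (ℚ.- 1ℚ) := p :- a) ≈-refl _ _ ⟩
      ev (s C) q * a - sum (λ k → B k * c k)
        ≈⟨ ≈-sym (annihilator-value C j q (at (A zero) q)) ⟩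
      ⟪ annihilator C j at′ q , at (A zero) q ⟫
        ≈⟨ ≈-sym (ev-pair (annihilator C j) (A zero) q) ⟩
      ev (residual C (A zero) j) q ≈⟨ t≈0 ⟩
      0# ∎
      where
      a = at (A zero) q j
      c = λ k → ⟪ dual C k at′ q , at (A zero) q ⟫
      B = λ k → at (A (suc k)) q j

  -- The coordinates of `A` with respect to `B`, up to the factor `s`, form an r′ by r matrix. A
  -- relation among its rows is one among the vectors of `A`, so `LI-dimension` applies.
  Steinitz : ∀ {r′} (B : Fin r → J → Polynomial m) p (A : Fin r′ → J → Carrier) →
    LI (λ k → at (B k) p) → LI A → (∀ k → Span (λ l → at (B l) p) (A k)) → r′ ℕ.≤ r
  Steinitz {r} {J} {m} {r′} B p A liB liA span = decidable-stable (r′ ℕ.≤? r) λ r′≰r →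
    LI⇒¬¬Certificate B p liB λ C → r′≰r (LI-dimension (λ k l → ⟪ dual C l at′ p , A k ⟫) λ c rel →
      liA c λ j → cancel (begin
        ev (s C) p * sum (λ k → c k * A k j)
          ≈⟨ *-distribˡ-sum (ev (s C) p) (λ k → c k * A k j) ⟩
        sum (λ k → ev (s C) p * (c k * A k j))
          ≈⟨ sum-cong-≋ (λ k → ≈-trans (solve 3 (λ s c a → s :* (c :* a) := c :* (s :* a)) ≈-refl _ _ _)
               (*-congˡ (Span⇒combination C (span k) j))) ⟩
        sum (λ k → c k * sum (λ l → ev (B l j) p * ⟪ dual C l at′ p , A k ⟫))
          ≈⟨ sum-cong-≋ (λ k → *-distribˡ-sum (c k) (λ l → ev (B l j) p * ⟪ dual C l at′ p , A k ⟫)) ⟩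
        sum (λ k → sum (λ l → c k * (ev (B l j) p * ⟪ dual C l at′ p , A k ⟫)))
          ≈⟨ ∑-comm (λ k l → c k * (ev (B l j) p * ⟪ dual C l at′ p , A k ⟫)) ⟩
        sum (λ l → sum (λ k → c k * (ev (B l j) p * ⟪ dual C l at′ p , A k ⟫)))
          ≈⟨ sum-0 _ (λ l → ≈-trans (sum-cong-≋ {r′} λ k → solve 3 (λ c b e → c :* (b :* e) := b :* (c :* e)) ≈-refl
               (c k) (ev (B l j) p) ⟪ dual C l at′ p , A k ⟫)
               (≈-trans (≈-sym (*-distribˡ-sum (ev (B l j) p) (λ k → c k * ⟪ dual C l at′ p , A k ⟫)))
                 (≈-trans (*-congˡ (rel l)) (zeroʳ _)))) ⟩
        0# ∎) (s≉0 C))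

  module Generic {m} {p : Vector Carrier m} (generic : Independent p) where

    -- If the factor `s` of a certificate at `q` vanished at the generic point, it would vanish
    -- everywhere, also at `q`.
    specialise : ∀ (A : Fin r → J → Polynomial m) q → LI (λ k → at (A k) q) → LI (λ k → at (A k) p)
    specialise A q li c rel k = stable λ ck≉0 → LI⇒¬¬Certificate A q li λ C →
      ck≉0 (independent-at C p (λ sp≈0 → s≉0 C (generic⇒everywhere generic (s C) sp≈0 q)) c rel k)

    Search : Set → Set₁
    Search J = ∀ {P : J → Set} → (∀ j → Dec (P j)) → (∀ j → P j) ⊎ ∃[ j ] ¬ P j

    residual? : Search J → ∀ {A : Fin r → J → Polynomial m} (C : Certificate A p) a →
      (∀ j → ev (residual C a j) p ≈ 0#) ⊎ ∃[ j ] ¬ (ev (residual C a j) p ≈ 0#)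
    residual? search C a = search λ j → ev-≈0? generic (residual C a j)

    span? : Search J → ∀ {A : Fin r → J → Polynomial m} → Certificate A p → ∀ a →
      Span (λ k → at (A k) p) (at a p) ⊎
      ∃[ ψ ] ((∀ k → ⟪ ψ , at (A k) p ⟫ ≈ 0#) × ¬ (⟪ ψ , at a p ⟫ ≈ 0#))
    span? search C a with residual? search C a
    ... | inj₁ res≈0       = inj₁ (residual-0⇒Span C a res≈0)
    ... | inj₂ (j , res≉0) = inj₂ (annihilator C j at′ p , annihilates C j p
      , λ e → res≉0 (≈-trans (ev-pair (annihilator C j) a p) e))

    -- At the generic point residuals can be decided, so the greedy choice of a maximal independent
    -- family is an actual construction, with a certificate and no double negation.
    basis : Search J → ∀ {N} (A : Fin N → J → Polynomial m) (f : Fin N → Bool) →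
      Σ[ r ∈ ℕ ] Σ[ ρ ∈ (Fin r → Fin N) ] ((∀ k → f (ρ k) ≡ true) × Certificate (A ∘ ρ) p
        × (∀ i → f i ≡ true → Span (λ k → at (A (ρ k)) p) (at (A i) p)))
    basis search {zero}  A f = 0 , (λ ()) , (λ ()) , empty , λ ()
    basis search {suc N} A f with basis search (A ∘ suc) (f ∘ suc) | f zero in f0
    ... | r , ρ , fρ , C , spans | false = r , suc ∘ ρ , fρ , C , λ
      { zero f0′ → contradiction (≡.trans (≡.sym f0) f0′) λ () ; (suc i) → spans i }
    ... | r , ρ , fρ , C , spans | true with residual? search C (A zero)
    ... | inj₁ res≈0 = r , suc ∘ ρ , fρ , C , λ
      { zero _ → residual-0⇒Span C (A zero) res≈0 ; (suc i) → spans i }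
    ... | inj₂ (j , res≉0) = suc r , ρ′ , (λ { zero → f0 ; (suc k) → fρ k }) , extend C j res≉0 , λ
      { zero _ → λ ψ ψ≈0 → ψ≈0 zero ; (suc i) fi → λ ψ ψ≈0 → spans i fi ψ (ψ≈0 ∘ suc) }
      where
      ρ′ : Fin (suc r) → Fin (suc N)
      ρ′ zero    = zero
      ρ′ (suc k) = suc (ρ k)

-- Injective families and concatenation.

Distinct : ∀ {k n} → (Fin k → Fin n) → Set
Distinct U = ∀ {a b} → U a ≡ U b → a ≡ b

∷-distinct : ∀ {k n} {v : Fin n} {U : Fin k → Fin n} → (∀ a → U a ≢ v) → Distinct U → Distinct (v Vector.∷ U)
∷-distinct U≢v dist {zero}  {zero}  eq = refl
∷-distinct U≢v dist {zero}  {suc b} eq = contradiction (≡.sym eq) (U≢v b)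
∷-distinct U≢v dist {suc a} {zero}  eq = contradiction eq (U≢v a)
∷-distinct U≢v dist {suc a} {suc b} eq = cong suc (dist eq)

++-↑ˡ : ∀ {A : Set} {k r} (xs : Vector A k) (ys : Vector A r) a → (xs Vector.++ ys) (a ↑ˡ r) ≡ xs a
++-↑ˡ {k = k} {r} xs ys a rewrite Fin.splitAt-↑ˡ k a r = refl

++-↑ʳ : ∀ {A : Set} {k r} (xs : Vector A k) (ys : Vector A r) b → (xs Vector.++ ys) (k ↑ʳ b) ≡ ys b
++-↑ʳ {k = k} {r} xs ys b rewrite Fin.splitAt-↑ʳ k r b = refl

-- Rows of the rigidity matrix: extension steps and stresses.

module Rows (S : Scalars) (n d : ℕ) where
  open import Data.Vec.Functional using (_∷_; _++_; concat)
  open ScalarAlgebra S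
  open Solver using (solve; _:=_; _:+_; _:*_; _:-_; :-_; con)
  open Polynomials S
  open LinearAlgebra S
  open Elimination S

  private
    variable
      k r : ℕ

  Pair Column : Set
  Pair = Fin n × Fin n
  Column = Fin n × Fin d

  Placement : Set
  Placement = Fin n → Fin d → Carrier

  χ : Fin n → Fin n → Carrier
  χ w u = if does (w Fin.≟ u) then 1# else 0#

  χ-same : ∀ u → χ u u ≈ 1#
  χ-same u rewrite dec-true (u Fin.≟ u) refl = ≈-refl

  χ-other : ∀ {w u} → w ≢ u → χ w u ≈ 0#
  χ-other {w} {u} w≢u rewrite dec-false (w Fin.≟ u) w≢u = ≈-refl

  -- Total on ordered pairs: orientation does not matter and a loop gives the zero row, so edges and
  -- pairs of the closure are treated alike.
  row : Placement → Pair → Column → Carrier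
  row q (u , v) (w , i) = χ w u * (q u i - q v i) + χ w v * (q v i - q u i)

  Ind : Placement → (Fin r → Pair) → Set
  Ind q E = LI (λ k → row q (E k))

  row-loop : ∀ q u j → row q (u , u) j ≈ 0#
  row-loop q u (w , i) = ≈-trans (solve 2 (λ c a → c :* (a :- a) :+ c :* (a :- a) := con 0ℚ) ≈-refl _ _) 0-homo

  row-swap : ∀ q u v j → row q (u , v) j ≈ row q (v , u) j
  row-swap q u v (w , i) = +-comm _ _

  row-away : ∀ q {u v w} i → w ≢ u → w ≢ v → row q (u , v) (w , i) ≈ 0#
  row-away q {u} {v} {w} i w≢u w≢v =
    ≈-trans (+-cong (*-congʳ (χ-other w≢u)) (*-congʳ (χ-other w≢v))) (≈-trans (+-cong (zeroˡ _) (zeroˡ _)) (+-identityʳ _))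

  row-first : ∀ q {u v} i → u ≢ v → row q (u , v) (u , i) ≈ q u i - q v i
  row-first q {u} {v} i u≢v = ≈-trans (+-cong (*-congʳ (χ-same u)) (*-congʳ (χ-other u≢v)))
    (≈-trans (+-cong (*-identityˡ _) (zeroˡ _)) (+-identityʳ _))

  flat : Placement → Vector Carrier (n ℕ.* d)
  flat = concat

  flat-combine : ∀ q u i → flat q (combine u i) ≡ q u i
  flat-combine q u i = cong (λ t → q (proj₁ t) (proj₂ t)) (Fin.remQuot-combine u i)

  Poly : Set
  Poly = Polynomial (n ℕ.* d)

  coordinate : Fin n → Fin d → Poly
  coordinate u i = indeterminate (combine u i)

  ev-coordinate : ∀ q u i → ev (coordinate u i) (flat q) ≈ q u i
  ev-coordinate q u i = ≈-trans (ev-variable (combine u i) (flat q)) (reflexive (flat-combine q u i))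

  χP : Fin n → Fin n → Poly
  χP w u = if does (w Fin.≟ u) then constant 1ℚ else constant 0ℚ

  ev-χP : ∀ w u x → ev (χP w u) x ≈ χ w u
  ev-χP w u x with does (w Fin.≟ u)
  ... | true  = ≈-trans (ev-constant 1ℚ x) 1-homo
  ... | false = ≈-trans (ev-constant 0ℚ x) 0-homo

  difference : Fin n → Fin n → Fin d → Poly
  difference u v i = coordinate u i ⊕ ⊖ coordinate v i

  ev-difference : ∀ q u v i → ev (difference u v i) (flat q) ≈ q u i - q v i
  ev-difference q u v i = ≈-trans (ev-⊕ (coordinate u i) (⊖ coordinate v i) (flat q))
    (+-cong (ev-coordinate q u i) (≈-trans (ev-⊖ (coordinate v i) (flat q)) (-‿cong (ev-coordinate q v i))))

  rowP : Pair → Column → Poly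
  rowP (u , v) (w , i) = χP w u ⊗ difference u v i ⊕ χP w v ⊗ difference v u i

  ev-rowP : ∀ q e j → at (rowP e) (flat q) j ≈ row q e j
  ev-rowP q (u , v) (w , i) = ≈-trans (ev-⊕ (χP w u ⊗ difference u v i) (χP w v ⊗ difference v u i) (flat q))
    (+-cong (≈-trans (ev-⊗ (χP w u) (difference u v i) (flat q)) (*-cong (ev-χP w u _) (ev-difference q u v i)))
            (≈-trans (ev-⊗ (χP w v) (difference v u i) (flat q)) (*-cong (ev-χP w v _) (ev-difference q v u i))))

  LI-cong : ∀ {J : Set} {A B : Fin r → J → Carrier} → (∀ k j → A k j ≈ B k j) → LI A → LI B
  LI-cong {r} A≈B li c rel = li c λ j → ≈-trans (sum-cong-≋ {r} λ k → *-congˡ (A≈B k j)) (rel j)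

  sum-split : ∀ k {r} (f : Vector Carrier (k ℕ.+ r)) →
    sum f ≈ sum (λ a → f (a ↑ˡ r)) + sum (λ b → f (k ↑ʳ b))
  sum-split zero    f = ≈-sym (+-identityˡ _)
  sum-split (suc k) f = ≈-trans (+-congˡ (sum-split k (f ∘ suc))) (≈-sym (+-assoc _ _ _))

  ∀-split : ∀ k {r} {P : Fin (k ℕ.+ r) → Set} → (∀ a → P (a ↑ˡ r)) → (∀ b → P (k ↑ʳ b)) → ∀ i → P i
  ∀-split k {r} {P} Pˡ Pʳ i with splitAt k i | Fin.join-splitAt k r i
  ... | inj₁ a | eq = subst P eq (Pˡ a)
  ... | inj₂ b | eq = subst P eq (Pʳ b)

  combination-++ : ∀ q {k r} (c : Vector Carrier (k ℕ.+ r)) (D : Fin k → Pair) (E : Fin r → Pair) j →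
    sum (λ l → c l * row q ((D ++ E) l) j) ≈
    sum (λ a → c (a ↑ˡ r) * row q (D a) j) + sum (λ b → c (k ↑ʳ b) * row q (E b) j)
  combination-++ q {k} {r} c D E j = ≈-trans (sum-split k (λ l → c l * row q ((D ++ E) l) j))
    (+-cong (sum-cong-≋ {k} λ a → *-congˡ (reflexive (cong (λ e → row q e j) (++-↑ˡ D E a))))
            (sum-cong-≋ {r} λ b → *-congˡ (reflexive (cong (λ e → row q e j) (++-↑ʳ D E b)))))

  star : Fin n → (Fin k → Fin n) → Fin k → Pair
  star v U a = v , U a

  Avoids : Fin n → (Fin r → Pair) → Set
  Avoids v E = ∀ b → v ≢ proj₁ (E b) × v ≢ proj₂ (E b)

  avoided-0 : ∀ q {v} (E : Fin r → Pair) → Avoids v E → ∀ (c : Vector Carrier r) i →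
    sum (λ b → c b * row q (E b) (v , i)) ≈ 0#
  avoided-0 q {v} E avoids c i = sum-0 (λ b → c b * row q (E b) (v , i)) λ b →
    ≈-trans (*-congˡ (row-away q i (proj₁ (avoids b)) (proj₂ (avoids b)))) (zeroʳ _)

  -- Since `E` avoids `v`, only the star contributes to the columns of `v`; what remains there of a
  -- relation is an equilibrium condition at `v`.
  star-at-center : ∀ q {v} {U : Fin k → Fin n} {E : Fin r → Pair} → Avoids v E → (∀ a → U a ≢ v) →
    (c : Vector Carrier (k ℕ.+ r)) →
    (∀ j → sum (λ l → c l * row q ((star v U ++ E) l) j) ≈ 0#) →
    ∀ i → sum (λ a → c (a ↑ˡ r) * (q v i - q (U a) i)) ≈ 0#
  star-at-center {k} {r} q {v} {U} {E} avoids U≢v c rel i = begin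
    sum (λ a → c (a ↑ˡ r) * (q v i - q (U a) i))
      ≈⟨ sum-cong-≋ {k} (λ a → *-congˡ (≈-sym (row-first q i (U≢v a ∘ ≡.sym)))) ⟩
    sum (λ a → c (a ↑ˡ r) * row q (v , U a) (v , i))
      ≈⟨ ≈-sym (+-identityʳ _) ⟩
    sum (λ a → c (a ↑ˡ r) * row q (v , U a) (v , i)) + 0#
      ≈⟨ +-congˡ (≈-sym (avoided-0 q E avoids (λ b → c (k ↑ʳ b)) i)) ⟩
    sum (λ a → c (a ↑ˡ r) * row q (v , U a) (v , i)) + sum (λ b → c (k ↑ʳ b) * row q (E b) (v , i))
      ≈⟨ ≈-sym (combination-++ q c (star v U) E (v , i)) ⟩
    sum (λ l → c l * row q ((star v U ++ E) l) (v , i))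
      ≈⟨ rel (v , i) ⟩
    0# ∎

  sum-differences : ∀ (c : Vector Carrier k) x (y : Vector Carrier k) →
    sum (λ a → c a * (x - y a)) ≈ sum c * x + sum (λ a → (- c a) * y a)
  sum-differences {k} c x y = ≈-trans
    (sum-cong-≋ {k} λ a → solve 3 (λ c x y → c :* (x :- y) := c :* x :+ (:- c) :* y) ≈-refl (c a) x (y a))
    (≈-trans (∑-distrib-+ (λ a → c a * x) (λ a → (- c a) * y a)) (+-congʳ (≈-sym (*-distribʳ-sum x c))))

  sum-neg : ∀ (c : Vector Carrier k) → sum (λ a → - c a) ≈ - sum c
  sum-neg {k} c = ≈-trans (sum-cong-≋ {k} λ a → solve 1 (λ c → :- c := c :* con (ℚ.- 1ℚ)) ≈-refl (c a))
    (≈-trans (≈-sym (*-distribʳ-sum (ι (ℚ.- 1ℚ)) c)) (solve 1 (λ c → c :* con (ℚ.- 1ℚ) := :- c) ≈-refl (sum c)))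

  module AtGeneric {p : Placement} (generic : Independent (flat p)) where
    open Generic generic

    specialise-rows : ∀ {r} (E : Fin r → Pair) q → Ind q E → Ind p E
    specialise-rows E q ind = LI-cong (λ k → ev-rowP p (E k))
      (specialise (rowP ∘ E) (flat q) (LI-cong (λ k j → ≈-sym (ev-rowP q (E k) j)) ind))

    -- Affine dependence is linear dependence of homogeneous coordinates, the constant column
    -- stating that the coefficients sum to zero. By specialisation one affinely independent
    -- position is enough.
    affinely-independent : ∀ {k} (U : Fin k → Fin n) → Distinct U → k ℕ.≤ suc d →
      (c : Vector Carrier k) → sum c ≈ 0# → (∀ i → sum (λ a → c a * p (U a) i) ≈ 0#) → ∀ a → c a ≈ 0#
    affinely-independent {k} U dist k≤ c Σc Σcp = LI-cong A≈ (specialise A (flat q) (LI-cong B≈ liB)) c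
      λ { zero    → ≈-trans (sum-cong-≋ {k} λ a → *-identityʳ (c a)) Σc
        ; (suc i) → Σcp i }
      where
      A : Fin k → Fin (suc d) → Poly
      A a zero    = constant 1ℚ
      A a (suc i) = coordinate (U a) i
      homogeneous : Placement → Fin k → Fin (suc d) → Carrier
      homogeneous q a zero    = 1#
      homogeneous q a (suc i) = q (U a) i
      at-A : ∀ q a j → at (A a) (flat q) j ≈ homogeneous q a j
      at-A q a zero    = ≈-trans (ev-constant 1ℚ (flat q)) 1-homo
      at-A q a (suc i) = ev-coordinate q (U a) i
      A≈ = at-A p
      -- The special position is a simplex: U 0 is the origin, U (suc i) the i-th unit vector.
      hit? : ∀ v (i : Fin d) → Dec (∃[ a ] (U a ≡ v × toℕ a ≡ suc (toℕ i)))
      hit? v i = Fin.any? λ a → (U a Fin.≟ v) ×-dec (toℕ a ℕ.≟ suc (toℕ i))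
      q : Placement
      q v i = if does (hit? v i) then 1# else 0#
      B≈ = λ a j → ≈-sym (at-A q a j)
      q-hit : ∀ a i → toℕ a ≡ suc (toℕ i) → q (U a) i ≈ 1#
      q-hit a i eq rewrite dec-true (hit? (U a) i) (a , refl , eq) = ≈-refl
      q-miss : ∀ a i → toℕ a ≢ suc (toℕ i) → q (U a) i ≈ 0#
      q-miss a i neq rewrite dec-false (hit? (U a) i)
        (λ { (b , Ub≡Ua , eq) → neq (subst (λ a → toℕ a ≡ suc (toℕ i)) (dist Ub≡Ua) eq) }) = ≈-refl
      liB : LI (homogeneous q)
      liB c rel = vanish
        where
        nonzero : ∀ a t → toℕ a ≡ suc t → c a ≈ 0#
        nonzero a t eq = begin
          c a ≈⟨ ≈-sym (*-identityʳ (c a)) ⟩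
          c a * 1# ≈⟨ *-congˡ (≈-sym (q-hit a i (≡.trans eq (cong suc (≡.sym toℕi))))) ⟩
          c a * q (U a) i ≈⟨ ≈-sym (sum-single (λ b → c b * q (U b) i) a λ b b≢a →
            ≈-trans (*-congˡ (q-miss b i λ eq′ → b≢a (Fin.toℕ-injective
              (≡.trans eq′ (≡.trans (cong suc toℕi) (≡.sym eq)))))) (zeroʳ (c b))) ⟩
          sum (λ b → c b * q (U b) i) ≈⟨ rel (suc i) ⟩
          0# ∎
          where
          t<d : t ℕ.< d
          t<d = ℕ.s≤s⁻¹ (ℕ.≤-trans (subst (ℕ._< k) eq (Fin.toℕ<n a)) k≤)
          i = fromℕ< t<d
          toℕi : toℕ i ≡ t
          toℕi = Fin.toℕ-fromℕ< t<d
        vanish : ∀ a → c a ≈ 0#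
        vanish zero    = begin
          c zero      ≈⟨ ≈-sym (*-identityʳ _) ⟩
          c zero * 1# ≈⟨ ≈-sym (sum-single (λ b → c b * 1#) zero λ
            { zero 0≢0 → contradiction refl 0≢0
            ; (suc b) _ → ≈-trans (*-congʳ (nonzero (suc b) (toℕ b) refl)) (zeroˡ _) }) ⟩
          sum (λ b → c b * 1#) ≈⟨ rel zero ⟩
          0# ∎
        vanish (suc a) = nonzero (suc a) (toℕ a) refl

    -- Such a relation is an affine dependency of `v` and the points of `U`, with coefficient
    -- `sum c` at `v` and the negatives of `c` elsewhere; at most d + 1 points occur.
    differences-independent : ∀ {k v} (U : Fin k → Fin n) → Distinct U → (∀ a → U a ≢ v) → k ℕ.≤ d →
      (c : Vector Carrier k) → (∀ i → sum (λ a → c a * (p v i - p (U a) i)) ≈ 0#) → ∀ a → c a ≈ 0#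
    differences-independent {k} {v} U dist U≢v k≤d c rel a = begin
      c a       ≈⟨ solve 1 (λ x → x := :- (:- x)) ≈-refl (c a) ⟩
      - (- c a) ≈⟨ -‿cong (affinely-independent (v ∷ U) (∷-distinct U≢v dist) (ℕ.s≤s k≤d) (sum c ∷ (λ a → - c a))
                     (≈-trans (+-congˡ (sum-neg c)) (-‿inverseʳ _))
                     (λ i → ≈-trans (≈-sym (sum-differences c (p v i) (λ a → p (U a) i))) (rel i)) (suc a)) ⟩
      - 0#      ≈⟨ ≈-trans (≈-sym (+-identityˡ _)) (-‿inverseʳ 0#) ⟩
      0#        ∎

    -- The 0-extension of rigidity theory: equilibrium at `v` forces the coefficients of the star to
    -- vanish, and a relation among `E` is left.
    zero-extension : ∀ {k r v} {U : Fin k → Fin n} {E : Fin r → Pair} → Distinct U → (∀ a → U a ≢ v) → k ℕ.≤ d →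
      Avoids v E → Ind p E → Ind p (star v U ++ E)
    zero-extension {k} {r} {v} {U} {E} dist U≢v k≤d avoids ind c rel =
      ∀-split k c-star (ind (λ b → c (k ↑ʳ b)) λ j → begin
        sum (λ b → c (k ↑ʳ b) * row p (E b) j)
          ≈⟨ ≈-sym (+-identityˡ _) ⟩
        0# + sum (λ b → c (k ↑ʳ b) * row p (E b) j)
          ≈⟨ +-congʳ (≈-sym (sum-0 (λ a → c (a ↑ˡ r) * row p (v , U a) j) λ a → ≈-trans (*-congʳ (c-star a)) (zeroˡ _))) ⟩
        sum (λ a → c (a ↑ˡ r) * row p (v , U a) j) + sum (λ b → c (k ↑ʳ b) * row p (E b) j)
          ≈⟨ ≈-sym (combination-++ p c (star v U) E j) ⟩
        sum (λ l → c l * row p ((star v U ++ E) l) j)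
          ≈⟨ rel j ⟩
        0# ∎)
      where
      c-star : ∀ a → c (a ↑ˡ r) ≈ 0#
      c-star = differences-independent U dist U≢v k≤d (λ a → c (a ↑ˡ r)) (star-at-center p {U = U} avoids U≢v c rel)

    ½≉0 : ¬ (ι ½ ≈ 0#)
    ½≉0 = faithful λ ()

    -- Independence of the extended rows is checked with the new vertex v placed at the
    -- midpoint of x and y, where the rows of vx and vy are both parallel to the row of xy.
    one-extension : ∀ {k r v x y} {U : Fin k → Fin n} {E : Fin r → Pair} →
      Distinct (x ∷ y ∷ U) → (∀ a → (x ∷ y ∷ U) a ≢ v) → suc k ℕ.≤ d →
      Avoids v E → Ind p ((x , y) ∷ E) → Ind p (star v (x ∷ y ∷ U) ++ E)
    one-extension {k} {r} {v} {x} {y} {U} {E} dist U≢v k<d avoids ind =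
      specialise-rows (star v (x ∷ y ∷ U) ++ E) q λ c rel → independent c rel
      where
      mid : Fin d → Carrier
      mid i = ι ½ * (p x i + p y i)
      q : Placement
      q w i = if does (w Fin.≟ v) then mid i else p w i
      q-center : ∀ i → q v i ≈ mid i
      q-center i rewrite dec-true (v Fin.≟ v) refl = ≈-refl
      q-other : ∀ {w} i → w ≢ v → q w i ≈ p w i
      q-other {w} i w≢v rewrite dec-false (w Fin.≟ v) w≢v = ≈-refl
      x≢v = U≢v zero
      y≢v = U≢v (suc zero)
      module _ (c : Vector Carrier (suc (suc k) ℕ.+ r))
        (rel : ∀ j → sum (λ l → c l * row q ((star v (x ∷ y ∷ U) ++ E) l) j) ≈ 0#) where
        cU : Vector Carrier (suc (suc k))
        cU a = c (a ↑ˡ r)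
        cS : Vector Carrier k
        cS a = cU (suc (suc a))
        cE : Vector Carrier r
        cE b = c (suc (suc k) ↑ʳ b)
        c₀ = cU zero
        c₁ = cU (suc zero)
        C  = sum cU
        -- The weight `C` of the midpoint is shared equally between `x` and `y`, which turns the
        -- equilibrium at `v` into an affine dependency of `x`, `y` and `U` alone, at most d + 1
        -- points.
        affine : Vector Carrier (suc (suc k))
        affine = (ι ½ * C - c₀) ∷ (ι ½ * C - c₁) ∷ (λ a → - cS a)
        affine-sum : sum affine ≈ 0#
        affine-sum = ≈-trans (+-congˡ (+-congˡ (sum-neg cS)))
          (≈-trans (solve 3 (λ a b s → let t = a :+ (b :+ s) in
             (con ½ :* t :- a) :+ ((con ½ :* t :- b) :+ (:- s)) := con 0ℚ) ≈-refl c₀ c₁ (sum cS)) 0-homo)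
        affine-moment : ∀ i → sum (λ a → affine a * p ((x ∷ y ∷ U) a) i) ≈ 0#
        affine-moment i = begin
          (ι ½ * C - c₀) * p x i + ((ι ½ * C - c₁) * p y i + sum (λ a → (- cS a) * p (U a) i))
            ≈⟨ solve 6 (λ t a b px py s → (con ½ :* t :- a) :* px :+ ((con ½ :* t :- b) :* py :+ s) :=
                 t :* (con ½ :* (px :+ py)) :+ ((:- a) :* px :+ ((:- b) :* py :+ s))) ≈-refl
                 C c₀ c₁ (p x i) (p y i) (sum (λ a → (- cS a) * p (U a) i)) ⟩
          C * mid i + sum (λ a → (- cU a) * p ((x ∷ y ∷ U) a) i)
            ≈⟨ +-cong (*-congˡ (≈-sym (q-center i)))
                 (sum-cong-≋ {suc (suc k)} λ a → *-congˡ {x = - cU a} (≈-sym (q-other i (U≢v a)))) ⟩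
          C * q v i + sum (λ a → (- cU a) * q ((x ∷ y ∷ U) a) i)
            ≈⟨ ≈-sym (sum-differences cU (q v i) (λ a → q ((x ∷ y ∷ U) a) i)) ⟩
          sum (λ a → cU a * (q v i - q ((x ∷ y ∷ U) a) i))
            ≈⟨ star-at-center q {U = x ∷ y ∷ U} avoids U≢v c rel i ⟩
          0# ∎
        affine-0 = affinely-independent (x ∷ y ∷ U) dist (ℕ.s≤s k<d) affine affine-sum affine-moment
        cS≈0 : ∀ a → cS a ≈ 0#
        cS≈0 a = begin
          cS a       ≈⟨ solve 1 (λ x → x := :- (:- x)) ≈-refl (cS a) ⟩
          - (- cS a) ≈⟨ -‿cong (affine-0 (suc (suc a))) ⟩
          - 0#       ≈⟨ ≈-trans (≈-sym (+-identityˡ _)) (-‿inverseʳ 0#) ⟩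
          0#         ∎
        c₁≈c₀ : c₁ ≈ c₀
        c₁≈c₀ = begin
          c₁ ≈⟨ solve 3 (λ h a b → b := ((h :- a) :+ a) :- (h :- b)) ≈-refl (ι ½ * C) c₀ c₁ ⟩
          ((ι ½ * C - c₀) + c₀) - (ι ½ * C - c₁)
            ≈⟨ +-cong (+-congʳ (affine-0 zero)) (-‿cong (affine-0 (suc zero))) ⟩
          (0# + c₀) - 0# ≈⟨ +-cong (+-identityˡ c₀) (≈-trans (≈-sym (+-identityˡ _)) (-‿inverseʳ 0#)) ⟩
          c₀ + 0# ≈⟨ +-identityʳ c₀ ⟩
          c₀ ∎
        star-row : ∀ {w z} i → w ≢ v → z ≢ v → row q (v , z) (w , i) ≈ χ w z * (p z i - mid i)
        star-row i w≢v z≢v = ≈-trans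
          (+-cong (≈-trans (*-congʳ (χ-other w≢v)) (zeroˡ _)) (*-congˡ (+-cong (q-other i z≢v) (-‿cong (q-center i)))))
          (+-identityˡ _)
        E-row : ∀ b w i → row q (E b) (w , i) ≈ row p (E b) (w , i)
        E-row b w i = +-cong (*-congˡ (+-cong q₁ (-‿cong q₂))) (*-congˡ (+-cong q₂ (-‿cong q₁)))
          where
          q₁ = q-other {proj₁ (E b)} i (proj₁ (avoids b) ∘ ≡.sym)
          q₂ = q-other {proj₂ (E b)} i (proj₂ (avoids b) ∘ ≡.sym)
        -- Away from `v`, the rows of vx and vy with equal coefficients add up to half the row of
        -- xy, because `x` and `y` lie opposite each other with respect to the midpoint.
        relation : ∀ j → (ι ½ * c₀) * row p (x , y) j + sum (λ b → cE b * row p (E b) j) ≈ 0#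
        relation (w , i) with w Fin.≟ v
        ... | yes refl = ≈-trans (+-cong (≈-trans (*-congˡ (row-away p i (x≢v ∘ ≡.sym) (y≢v ∘ ≡.sym))) (zeroʳ _))
                (avoided-0 p E avoids cE i)) (+-identityʳ _)
        ... | no w≢v = begin
          (ι ½ * c₀) * row p (x , y) (w , i) + rest
            ≈⟨ solve 6 (λ c a b px py r → (con ½ :* c) :* (a :* (px :- py) :+ b :* (py :- px)) :+ r :=
                 (c :* (a :* (px :- con ½ :* (px :+ py))) :+ c :* (b :* (py :- con ½ :* (px :+ py)))) :+ r)
                 ≈-refl c₀ (χ w x) (χ w y) (p x i) (p y i) rest ⟩
          (c₀ * (χ w x * (p x i - mid i)) + c₀ * (χ w y * (p y i - mid i))) + rest
            ≈⟨ +-congʳ (+-cong (*-congˡ (≈-sym (star-row i w≢v x≢v)))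
                 (≈-trans (*-cong (≈-sym c₁≈c₀) (≈-sym (star-row i w≢v y≢v))) (≈-sym (+-identityʳ _)))) ⟩
          (c₀ * row q (v , x) (w , i) + (c₁ * row q (v , y) (w , i) + 0#)) + rest
            ≈⟨ +-cong (+-congˡ (+-congˡ (≈-sym (sum-0 (λ a → cS a * row q (v , U a) (w , i)) λ a →
                 ≈-trans (*-congʳ (cS≈0 a)) (zeroˡ _)))))
                 (sum-cong-≋ {r} λ b → *-congˡ (≈-sym (E-row b w i))) ⟩
          sum (λ a → cU a * row q (star v (x ∷ y ∷ U) a) (w , i)) + sum (λ b → cE b * row q (E b) (w , i))
            ≈⟨ ≈-sym (combination-++ q c (star v (x ∷ y ∷ U)) E (w , i)) ⟩
          sum (λ l → c l * row q ((star v (x ∷ y ∷ U) ++ E) l) (w , i))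
            ≈⟨ rel (w , i) ⟩
          0# ∎
          where rest = sum (λ b → cE b * row p (E b) (w , i))
        coefficients-0 : ∀ a → ((ι ½ * c₀) ∷ cE) a ≈ 0#
        coefficients-0 = ind ((ι ½ * c₀) ∷ cE) relation
        c₀≈0 : c₀ ≈ 0#
        c₀≈0 = cancel (coefficients-0 zero) ½≉0
        independent : ∀ l → c l ≈ 0#
        independent = ∀-split (suc (suc k))
          (λ { zero → c₀≈0 ; (suc zero) → ≈-trans c₁≈c₀ c₀≈0 ; (suc (suc a)) → cS≈0 a })
          (coefficients-0 ∘ suc)

    -- With `ψ` read as velocities of the vertices, this is the rate of change of half the squared
    -- length of uv.
    tension : Functional Column → Fin n → Fin n → Carrier
    tension ψ u v = ⟪ ψ , row p (u , v) ⟫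

    tension-loop : ∀ ψ u → tension ψ u u ≈ 0#
    tension-loop ψ u = ⟪⟫-0 ψ (row-loop p u)

    tension-swap : ∀ ψ u v → tension ψ u v ≈ tension ψ v u
    tension-swap ψ u v = ⟪⟫-cong ψ (row-swap p u v)

    -- An affine dependency λ of points is a stress λₐλ_b of the complete graph on them.
    affine-stress : ∀ ψ {k} (U : Fin k → Fin n) (c : Vector Carrier k) → sum c ≈ 0# →
      (∀ i → sum (λ a → c a * p (U a) i) ≈ 0#) →
      sum (λ a → c a * sum (λ b → c b * tension ψ (U a) (U b))) ≈ 0#
    affine-stress ψ {k} U c Σc Σcp = begin
      sum (λ a → c a * sum (λ b → c b * tension ψ (U a) (U b)))
        ≈⟨ sum-cong-≋ {k} (λ a → *-congˡ (≈-sym (⟪⟫-combination ψ c (λ b → row p (U a , U b))))) ⟩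
      sum (λ a → c a * ⟪ ψ , (λ j → sum (λ b → c b * row p (U a , U b) j)) ⟫)
        ≈⟨ ≈-sym (⟪⟫-combination ψ c (λ a j → sum (λ b → c b * row p (U a , U b) j))) ⟩
      ⟪ ψ , (λ j → sum (λ a → c a * sum (λ b → c b * row p (U a , U b) j))) ⟫
        ≈⟨ ⟪⟫-0 ψ stress ⟩
      0# ∎
      where
      balance : ∀ x i → sum (λ b → c b * (x - p (U b) i)) ≈ 0#
      balance x i = ≈-trans (sum-differences c x (λ b → p (U b) i))
        (≈-trans (+-cong (≈-trans (*-congʳ Σc) (zeroˡ x)) (begin
          sum (λ b → (- c b) * p (U b) i)
            ≈⟨ sum-cong-≋ {k} (λ b → solve 2 (λ c y → (:- c) :* y := (c :* y) :* con (ℚ.- 1ℚ)) ≈-refl (c b) _) ⟩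
          sum (λ b → (c b * p (U b) i) * ι (ℚ.- 1ℚ))
            ≈⟨ ≈-sym (*-distribʳ-sum (ι (ℚ.- 1ℚ)) (λ b → c b * p (U b) i)) ⟩
          sum (λ b → c b * p (U b) i) * ι (ℚ.- 1ℚ)
            ≈⟨ ≈-trans (*-congʳ (Σcp i)) (zeroˡ _) ⟩
          0# ∎)) (+-identityʳ _))
      -- A row is a contribution at its first endpoint plus the same with the endpoints exchanged.
      -- Each half of the stress vanishes because the dependency balances about every point.
      half : ∀ w i → sum (λ a → sum (λ b → c a * (c b * (χ w (U a) * (p (U a) i - p (U b) i))))) ≈ 0#
      half w i = sum-0 (λ a → sum (λ b → c a * (c b * (χ w (U a) * (p (U a) i - p (U b) i))))) λ a →
        ≈-trans (sum-cong-≋ {k} λ b →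
          solve 4 (λ a b x e → a :* (b :* (x :* e)) := (a :* x) :* (b :* e)) ≈-refl (c a) (c b) (χ w (U a)) _)
          (≈-trans (≈-sym (*-distribˡ-sum (c a * χ w (U a)) (λ b → c b * (p (U a) i - p (U b) i))))
            (≈-trans (*-congˡ (balance (p (U a) i) i)) (zeroʳ _)))
      stress : ∀ j → sum (λ a → c a * sum (λ b → c b * row p (U a , U b) j)) ≈ 0#
      stress (w , i) = begin
        sum (λ a → c a * sum (λ b → c b * row p (U a , U b) (w , i)))
          ≈⟨ sum-cong-≋ {k} (λ a → *-distribˡ-sum (c a) (λ b → c b * row p (U a , U b) (w , i))) ⟩
        sum (λ a → sum (λ b → c a * (c b * row p (U a , U b) (w , i))))
          ≈⟨ sum-cong-≋ {k} (λ a → ≈-trans (sum-cong-≋ {k} λ b →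
               solve 4 (λ a b f g → a :* (b :* (f :+ g)) := a :* (b :* f) :+ b :* (a :* g)) ≈-refl (c a) (c b) _ _)
               (∑-distrib-+ (λ b → c a * (c b * X a b)) (λ b → c b * (c a * X b a)))) ⟩
        sum (λ a → sum (λ b → c a * (c b * X a b)) + sum (λ b → c b * (c a * X b a)))
          ≈⟨ ∑-distrib-+ (λ a → sum (λ b → c a * (c b * X a b))) (λ a → sum (λ b → c b * (c a * X b a))) ⟩
        sum (λ a → sum (λ b → c a * (c b * X a b))) + sum (λ a → sum (λ b → c b * (c a * X b a)))
          ≈⟨ +-congˡ (∑-comm (λ a b → c b * (c a * X b a))) ⟩
        sum (λ a → sum (λ b → c a * (c b * X a b))) + sum (λ b → sum (λ a → c b * (c a * X b a)))
          ≈⟨ +-cong (half w i) (half w i) ⟩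
        0# + 0# ≈⟨ +-identityʳ _ ⟩
        0# ∎
        where
        X : Fin k → Fin k → Carrier
        X a b = χ w (U a) * (p (U a) i - p (U b) i)

    -- All other tensions being zero, a nonzero tension of xy would force the coefficients of `x`
    -- and `y` in an affine dependency of the d + 2 points to have product zero. Without `x` or `y`
    -- only d + 1 generic points remain, so the dependency would be trivial, which is impossible for
    -- d + 2 points in dimension d.
    clique-closure : ∀ ψ {x y} (U : Fin d → Fin n) → Distinct (x ∷ y ∷ U) →
      (∀ a b → a ≢ b → tension ψ (U a) (U b) ≈ 0#) →
      (∀ a → tension ψ x (U a) ≈ 0#) → (∀ a → tension ψ y (U a) ≈ 0#) → tension ψ x y ≈ 0#
    clique-closure ψ {x} {y} U dist inside from-x from-y = stable λ τ≉0 →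
      ℕ.<-irrefl refl (LI-dimension homogeneous (no-dependency τ≉0))
      where
      W = x ∷ y ∷ U
      τ = tension ψ x y
      homogeneous : Fin (suc (suc d)) → Fin (suc d) → Carrier
      homogeneous a zero    = 1#
      homogeneous a (suc i) = p (W a) i
      no-dependency : ¬ (τ ≈ 0#) → LI homogeneous
      no-dependency τ≉0 c rel = all-0
        where
        Σc : sum c ≈ 0#
        Σc = ≈-trans (sum-cong-≋ {suc (suc d)} λ a → ≈-sym (*-identityʳ (c a))) (rel zero)
        c₀ = c zero
        c₁ = c (suc zero)
        inside′ : ∀ a b → tension ψ (U a) (U b) ≈ 0#
        inside′ a b with a Fin.≟ b
        ... | yes refl = tension-loop ψ (U a)
        ... | no a≢b   = inside a b a≢b
        vanishing : ∀ {t : Vector Carrier d} → (∀ a → t a ≈ 0#) → sum (λ a → c (suc (suc a)) * t a) ≈ 0#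
        vanishing {t} t≈0 = sum-0 (λ a → c (suc (suc a)) * t a) λ a → ≈-trans (*-congˡ (t≈0 a)) (zeroʳ _)
        at-U : ∀ a → c₀ * tension ψ (U a) x + (c₁ * tension ψ (U a) y + sum (λ b → c (suc (suc b)) * tension ψ (U a) (U b))) ≈ 0#
        at-U a = ≈-trans (+-cong
          (≈-trans (*-congˡ (≈-trans (tension-swap ψ (U a) x) (from-x a))) (zeroʳ _))
          (≈-trans (+-cong (≈-trans (*-congˡ (≈-trans (tension-swap ψ (U a) y) (from-y a))) (zeroʳ _))
            (vanishing (inside′ a))) (+-identityʳ _))) (+-identityʳ _)
        -- The double sum meets xy in both orders and equals twice `c₀ * c₁ * τ`, whence the powers
        -- of one half. Each `con 0ℚ` holds the place of a tension, or a sum, known to vanish.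
        scaled-0 : (ι ½ * ι ½) * (c₀ * c₁ * τ) ≈ 0#
        scaled-0 = begin
          (ι ½ * ι ½) * (c₀ * c₁ * τ)
            ≈⟨ solve 3 (λ a b t → (con ½ :* con ½) :* (a :* b :* t) :=
                 (con ½ :* con ½ :* con ½) :* (a :* (a :* con 0ℚ :+ (b :* t :+ con 0ℚ)) :+ (b :* (a :* t :+ (b :* con 0ℚ :+ con 0ℚ)) :+ con 0ℚ)))
                 ≈-refl c₀ c₁ τ ⟩
          _ ≈⟨ *-congˡ (+-cong (*-congˡ (+-cong (*-congˡ (≈-trans 0-homo (≈-sym (tension-loop ψ x))))
                 (+-congˡ (≈-trans 0-homo (≈-sym (vanishing from-x))))))
                 (+-cong (*-congˡ (+-cong (*-congˡ (tension-swap ψ x y))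
                   (+-cong (*-congˡ (≈-trans 0-homo (≈-sym (tension-loop ψ y)))) (≈-trans 0-homo (≈-sym (vanishing from-y))))))
                 (≈-trans 0-homo (≈-sym (vanishing at-U))))) ⟩
          (ι ½ * ι ½ * ι ½) * sum (λ a → c a * sum (λ b → c b * tension ψ (W a) (W b)))
            ≈⟨ *-congˡ (affine-stress ψ W c Σc (rel ∘ suc)) ⟩
          (ι ½ * ι ½ * ι ½) * 0# ≈⟨ zeroʳ _ ⟩
          0# ∎
        product-0 : c₀ * c₁ * τ ≈ 0#
        product-0 = cancel scaled-0 (*-nonzero ½≉0 ½≉0)
        drop-x : Distinct (y ∷ U)
        drop-x eq = Fin.suc-injective (dist eq)
        skip : Fin (suc d) → Fin (suc (suc d))
        skip = punchIn (suc zero)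
        drop-y : Distinct (W ∘ skip)
        drop-y eq = Fin.punchIn-injective (suc zero) _ _ (dist eq)
        c₀-0⇒all : c₀ ≈ 0# → ∀ a → c a ≈ 0#
        c₀-0⇒all c₀≈0 zero    = c₀≈0
        c₀-0⇒all c₀≈0 (suc a) = affinely-independent (y ∷ U) drop-x ℕ.≤-refl (c ∘ suc)
          (≈-trans (≈-sym (≈-trans (+-congʳ c₀≈0) (+-identityˡ _))) Σc)
          (λ i → ≈-trans (≈-sym (≈-trans (+-congʳ (≈-trans (*-congʳ c₀≈0) (zeroˡ _))) (+-identityˡ _))) (rel (suc i))) a
        c₁-0⇒all : c₁ ≈ 0# → c₀ ≈ 0#
        c₁-0⇒all c₁≈0 = affinely-independent (W ∘ skip) drop-y ℕ.≤-refl (c ∘ skip)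
          (≈-trans (+-congˡ (≈-sym (≈-trans (+-congʳ c₁≈0) (+-identityˡ _)))) Σc)
          (λ i → ≈-trans (+-congˡ (≈-sym (≈-trans (+-congʳ (≈-trans (*-congʳ c₁≈0) (zeroˡ _))) (+-identityˡ _)))) (rel (suc i))) zero
        all-0 : ∀ a → c a ≈ 0#
        all-0 a = stable λ ca≉0 → τ≉0 (cancel product-0 (*-nonzero
          (λ c₀≈0 → ca≉0 (c₀-0⇒all c₀≈0 a)) (λ c₁≈0 → ca≉0 (c₀-0⇒all (c₁-0⇒all c₁≈0) a))))

-- Counting and the order of insertion.

module Counting where
  open import Data.Nat.Base using (_+_; _*_)
  open SemiringSum ℕ.+-*-semiring using (sum; ∑-distrib-+; ∑-comm; *-distribˡ-sum; *-distribʳ-sum)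
  open import Data.Vec.Functional using (_∷_)

  private
    variable
      n : ℕ

  𝟙 : Bool → ℕ
  𝟙 true  = 1
  𝟙 false = 0

  count : (Fin n → Bool) → ℕ
  count f = sum (𝟙 ∘ f)

  [_≡_] : Fin n → Fin n → ℕ
  [ u ≡ v ] = 𝟙 (does (u Fin.≟ v))

  sum-mono : ∀ {n} {f g : Vector ℕ n} → (∀ i → f i ≤ g i) → sum f ≤ sum g
  sum-mono {zero}  f≤g = z≤n
  sum-mono {suc n} f≤g = ℕ.+-mono-≤ (f≤g zero) (sum-mono (f≤g ∘ suc))

  sum-const : ∀ n c → sum {n} (λ _ → c) ≡ n * c
  sum-const zero    c = refl
  sum-const (suc n) c = cong (c +_) (sum-const n c)

  sum-point : ∀ {n} (v : Fin n) c → sum (λ w → [ w ≡ v ] * c) ≡ c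
  sum-point {suc n} zero c = cong₂ _+_ (ℕ.*-identityˡ c) (trans (sum-const n 0) (ℕ.*-zeroʳ n)) ⟨ trans ⟩ ℕ.+-identityʳ c
  sum-point {suc n} (suc v) c = sum-point v c

  count-point : ∀ {n} (v : Fin n) → sum (λ w → [ w ≡ v ]) ≡ 1
  count-point v = trans (≡.sym (sum-cong λ w → ℕ.*-identityʳ [ w ≡ v ])) (sum-point v 1)
    where
    sum-cong : ∀ {n} {f g : Vector ℕ n} → (∀ i → f i ≡ g i) → sum f ≡ sum g
    sum-cong f≡g = ℕ.≤-antisym (sum-mono (ℕ.≤-reflexive ∘ f≡g)) (sum-mono (ℕ.≤-reflexive ∘ ≡.sym ∘ f≡g))

  -- Every point of a set exceeding its budget would make the total exceed the budget.
  below-average : ∀ {n} (W : Fin n → Bool) (T : Fin n → ℕ) L →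
    sum (λ w → 𝟙 (W w) * T w) ≤ sum (λ w → 𝟙 (W w) * L) →
    ∀ {w₀} → W w₀ ≡ true → ∃[ w ] (W w ≡ true × T w ≤ L)
  below-average W T L ΣT≤ΣL {w₀} Ww₀ with Fin.any? (λ w → (W w Bool.≟ true) ×-dec (T w ℕ.≤? L))
  ... | yes found = found
  ... | no ¬found = contradiction ΣT≤ΣL (ℕ.<⇒≱ (begin
        suc (sum (λ w → 𝟙 (W w) * L))                         ≡⟨ ℕ.+-comm 1 _ ⟩
        sum (λ w → 𝟙 (W w) * L) + 1                           ≡⟨ cong (sum (λ w → 𝟙 (W w) * L) +_) (count-point w₀) ⟨
        sum (λ w → 𝟙 (W w) * L) + sum (λ w → [ w ≡ w₀ ])      ≡⟨ ∑-distrib-+ (λ w → 𝟙 (W w) * L) (λ w → [ w ≡ w₀ ]) ⟨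
        sum (λ w → 𝟙 (W w) * L + [ w ≡ w₀ ])                  ≤⟨ sum-mono exceeds ⟩
        sum (λ w → 𝟙 (W w) * T w)                             ∎))
    where
    open ℕ.≤-Reasoning
    exceeds : ∀ w → 𝟙 (W w) * L + [ w ≡ w₀ ] ≤ 𝟙 (W w) * T w
    exceeds w with w Fin.≟ w₀ | W w in Ww
    ... | yes refl | false = contradiction (trans (≡.sym Ww) Ww₀) λ ()
    ... | no _     | false = z≤n
    ... | yes refl | true  = ℕ.≤-trans (ℕ.≤-reflexive (ℕ.+-comm (1 * L) 1))
                               (ℕ.≤-trans (s≤s (ℕ.≤-reflexive (ℕ.*-identityˡ L)))
                                 (ℕ.≤-trans (ℕ.≰⇒> λ Tw≤L → ¬found (w , Ww , Tw≤L)) (ℕ.≤-reflexive (≡.sym (ℕ.*-identityˡ (T w))))))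
    ... | no _     | true  = ℕ.≤-trans (ℕ.≤-reflexive (ℕ.+-identityʳ (1 * L)))
                               (ℕ.*-monoʳ-≤ 1 (ℕ.<⇒≤ (ℕ.≰⇒> λ Tw≤L → ¬found (w , Ww , Tw≤L))))

  choose : ∀ {n} (f : Fin n → Bool) k → k ≤ count f →
    Σ[ U ∈ (Fin k → Fin n) ] (Distinct U × (∀ a → f (U a) ≡ true))
  choose {n}     f zero    _    = (λ ()) , (λ { {()} }) , λ ()
  choose {suc n} f (suc k) k≤ with f zero in f0
  ... | true  = let U , dist , fU = choose (f ∘ suc) k (ℕ.s≤s⁻¹ k≤) in
        (zero ∷ (suc ∘ U)) , ∷-distinct (λ _ ()) (dist ∘ Fin.suc-injective) , λ { zero → f0 ; (suc a) → fU a }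
  ... | false = let U , dist , fU = choose (f ∘ suc) (suc k) k≤ in
        (suc ∘ U) , dist ∘ Fin.suc-injective , fU

  ∧-true : ∀ {a b} → a ∧ b ≡ true → a ≡ true × b ≡ true
  ∧-true {true} {true} _ = refl , refl

  infixl 6 _∪_
  _∪_ : (Fin n → Bool) → Fin n → Fin n → Bool
  (P ∪ w) u = does (u Fin.≟ w) ∨ P u

  ∪-here : ∀ (P : Fin n → Bool) w → (P ∪ w) w ≡ true
  ∪-here P w rewrite dec-true (w Fin.≟ w) refl = refl

  ∪-there : ∀ (P : Fin n → Bool) w {u} → P u ≡ true → (P ∪ w) u ≡ true
  ∪-there P w {u} Pu rewrite Pu = Bool.∨-zeroʳ (does (u Fin.≟ w))

  module Greedy {n} (adj : Fin n → Fin n → Bool)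
    (symmetric : ∀ u v → adj u v ≡ adj v u) (loopless : ∀ v → adj v v ≡ false) (k : ℕ) where

    d : ℕ
    d = suc k

    degree : Fin n → ℕ
    degree v = count (adj v)

    adj⇒≢ : ∀ {u v} → adj u v ≡ true → u ≢ v
    adj⇒≢ {u} uv refl = contradiction (trans (≡.sym uv) (loopless u)) λ ()

    swap : ∀ {u v} → adj u v ≡ true → adj v u ≡ true
    swap {u} {v} uv = trans (symmetric v u) uv

    back : Fin n → (Fin n → Bool) → ℕ
    back v P = count (λ z → adj v z ∧ P z)

    NonClique : Fin n → (Fin n → Bool) → Set
    NonClique v P = ∃[ x ] ∃[ y ] (x ≢ y × (adj v x ∧ P x ≡ true) × (adj v y ∧ P y ≡ true) × adj x y ≡ false)

    nonClique? : ∀ v P → Dec (NonClique v P)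
    nonClique? v P = Fin.any? λ x → Fin.any? λ y → ¬? (x Fin.≟ y) ×-dec
      ((adj v x ∧ P x) Bool.≟ true) ×-dec ((adj v y ∧ P y) Bool.≟ true) ×-dec (adj x y Bool.≟ false)

    -- The case with gain d + 1: the non-adjacent pair among the earlier neighbours is the one that
    -- the 1-extension replaces.
    Good : Fin n → (Fin n → Bool) → Set
    Good v P = suc d ≤ back v P × NonClique v P

    good? : ∀ v P → Dec (Good v P)
    good? v P = (suc d ℕ.≤? back v P) ×-dec nonClique? v P

    back-mono : ∀ v P w → back v P ≤ back v (P ∪ w)
    back-mono v P w = sum-mono termwise
      where
      termwise : ∀ z → 𝟙 (adj v z ∧ P z) ≤ 𝟙 (adj v z ∧ (P ∪ w) z)
      termwise z with adj v z | P z | does (z Fin.≟ w)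
      ... | false | _     | _     = z≤n
      ... | true  | false | _     = z≤n
      ... | true  | true  | true  = ℕ.≤-refl
      ... | true  | true  | false = ℕ.≤-refl

    back-∪ : ∀ v P w → adj v w ≡ true → P w ≡ false → suc (back v P) ≤ back v (P ∪ w)
    back-∪ v P w vw w∉P = begin
      suc (back v P)                    ≡⟨ ℕ.+-comm 1 _ ⟩
      back v P + 1                      ≡⟨ cong (back v P +_) (count-point w) ⟨
      back v P + sum (λ z → [ z ≡ w ])  ≡⟨ ∑-distrib-+ (λ z → 𝟙 (adj v z ∧ P z)) (λ z → [ z ≡ w ]) ⟨
      sum (λ z → 𝟙 (adj v z ∧ P z) + [ z ≡ w ]) ≤⟨ sum-mono termwise ⟩
      back v (P ∪ w)                    ∎
      where
      open ℕ.≤-Reasoning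
      termwise : ∀ z → 𝟙 (adj v z ∧ P z) + [ z ≡ w ] ≤ 𝟙 (adj v z ∧ (P ∪ w) z)
      termwise z with z Fin.≟ w
      ... | yes refl rewrite vw | w∉P = ℕ.≤-refl
      ... | no _     = ℕ.≤-reflexive (ℕ.+-identityʳ _)

    front : Fin n → (Fin n → Bool) → ℕ
    front v P = count (λ z → adj v z ∧ not (P z))

    front+back : ∀ v P → degree v ≤ front v P + back v P
    front+back v P = begin
      degree v ≤⟨ sum-mono termwise ⟩
      sum (λ z → 𝟙 (adj v z ∧ not (P z)) + 𝟙 (adj v z ∧ P z))
        ≡⟨ ∑-distrib-+ (λ z → 𝟙 (adj v z ∧ not (P z))) (λ z → 𝟙 (adj v z ∧ P z)) ⟩
      front v P + back v P ∎
      where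
      open ℕ.≤-Reasoning
      termwise : ∀ z → 𝟙 (adj v z) ≤ 𝟙 (adj v z ∧ not (P z)) + 𝟙 (adj v z ∧ P z)
      termwise z with adj v z | P z
      ... | false | _     = z≤n
      ... | true  | true  = ℕ.≤-refl
      ... | true  | false = ℕ.≤-refl

    nonClique-mono : ∀ {v P} w → NonClique v P → NonClique v (P ∪ w)
    nonClique-mono {v} {P} w (x , y , x≢y , vx , vy , xy) =
      x , y , x≢y , grow (∧-true vx) , grow (∧-true vy) , xy
      where
      grow : ∀ {z} → adj v z ≡ true × P z ≡ true → adj v z ∧ (P ∪ w) z ≡ true
      grow (vz , Pz) = cong₂ _∧_ vz (∪-there P w Pz)

    good-mono : ∀ {v P} w → Good v P → Good v (P ∪ w)
    good-mono {v} {P} w (a≥ , nc) = ℕ.≤-trans a≥ (back-mono v P w) , nonClique-mono w nc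

    Complete : Set
    Complete = ∀ {x y} → x ≢ y → adj x y ≡ true

    module Closed
      (closure : ∀ {x y} (U : Fin d → Fin n) → Distinct (x ∷ y ∷ U) →
        (∀ a b → a ≢ b → adj (U a) (U b) ≡ true) →
        (∀ a → adj x (U a) ≡ true) → (∀ a → adj y (U a) ≡ true) → adj x y ≡ true)
      (common : ∀ {x y} → x ≢ y → adj x y ≡ false →
        Σ[ U ∈ (Fin d → Fin n) ] (Distinct U × (∀ a → adj x (U a) ≡ true) × (∀ a → adj y (U a) ≡ true)))
      (incomplete : ¬ Complete)
      (M : ℕ) (M-bound : ∀ v → M + d ≤ degree v + 2) (degree-bound : ∀ v → suc d ≤ degree v) where

      Extends : Fin n → (Fin n → Bool) → Fin n → Set
      Extends v P w = adj v w ≡ true × P w ≡ false × NonClique v (P ∪ w)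

      distinct₂ : ∀ {j x y} {U : Fin j → Fin n} → x ≢ y → (∀ a → U a ≢ x) → (∀ a → U a ≢ y) →
        Distinct U → Distinct (x ∷ y ∷ U)
      distinct₂ x≢y U≢x U≢y dist = ∷-distinct (λ { zero → x≢y ∘ ≡.sym ; (suc a) → U≢x a }) (∷-distinct U≢y dist)

      -- Otherwise N(v) would be a clique, hence v adjacent to every vertex, hence the graph complete.
      clique-extends : ∀ v P → d ≤ back v P → ¬ NonClique v P → ∃[ w ] Extends v P w
      clique-extends v P d≤ ¬nc with
        Fin.any? (λ w → Fin.any? λ z → (adj v w Bool.≟ true) ×-dec (P w Bool.≟ false) ×-dec
          ((adj v z ∧ P z) Bool.≟ true) ×-dec (adj w z Bool.≟ false))
      ... | yes (w , z , vw , w∉P , vz , wz) = w , vw , w∉P , w , z , w≢z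
          , cong₂ _∧_ vw (∪-here P w)
          , cong₂ _∧_ (proj₁ (∧-true vz)) (∪-there P w (proj₂ (∧-true {adj v z} vz))) , wz
        where
        w≢z : w ≢ z
        w≢z refl = contradiction (trans (≡.sym w∉P) (proj₂ (∧-true {adj v z} vz))) λ ()
      ... | no none = ⊥-elim (incomplete complete)
        where
        U = choose (λ z → adj v z ∧ P z) d d≤
        inside : ∀ {w z} → w ≢ z → adj v w ≡ true → adj v z ≡ true → P w ≡ true → P z ≡ true → adj w z ≡ true
        inside {w} {z} w≢z vw vz Pw Pz with adj w z in wz
        ... | true  = refl
        ... | false = contradiction (w , z , w≢z , cong₂ _∧_ vw Pw , cong₂ _∧_ vz Pz , wz) ¬nc
        across : ∀ {w z} → adj v w ≡ true → adj v z ≡ true → P w ≡ false → P z ≡ true → adj w z ≡ true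
        across {w} {z} vw vz Pw Pz with adj w z in wz
        ... | true  = refl
        ... | false = contradiction (w , z , vw , Pw , cong₂ _∧_ vz Pz , wz) none
        UP : ∀ a → adj v (proj₁ U a) ≡ true × P (proj₁ U a) ≡ true
        UP a = ∧-true (proj₂ (proj₂ U) a)
        U≢ : ∀ {w} → P w ≡ false → ∀ a → proj₁ U a ≢ w
        U≢ Pw a refl = contradiction (trans (≡.sym Pw) (proj₂ (UP a))) λ ()
        clique : ∀ {w z} → w ≢ z → adj v w ≡ true → adj v z ≡ true → adj w z ≡ true
        clique {w} {z} w≢z vw vz with P w in Pw | P z in Pz
        ... | true  | true  = inside w≢z vw vz Pw Pz
        ... | false | true  = across vw vz Pw Pz
        ... | true  | false = swap (across vz vw Pz Pw)
        -- Both vertices lie outside `P`, and both are joined to the d-clique `U` inside `P`.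
        ... | false | false = closure (proj₁ U) (distinct₂ w≢z (U≢ Pw) (U≢ Pz) (proj₁ (proj₂ U)))
                (λ a b a≢b → inside (a≢b ∘ proj₁ (proj₂ U)) (proj₁ (UP a)) (proj₁ (UP b)) (proj₂ (UP a)) (proj₂ (UP b)))
                (λ a → across vw (proj₁ (UP a)) Pw (proj₂ (UP a)))
                (λ a → across vz (proj₁ (UP a)) Pz (proj₂ (UP a)))
        universal : ∀ {u} → v ≢ u → adj v u ≡ true
        universal {u} v≢u with adj v u in vu
        ... | true  = refl
        -- The common neighbours lie in the neighbourhood of `v`, which is a clique by now, so the
        -- closure joins `v` and `u` after all.
        ... | false = let W , dist , vW , uW = common v≢u vu in
              trans (≡.sym vu) (closure W (distinct₂ v≢u (λ a → adj⇒≢ (vW a) ∘ ≡.sym) (λ a → adj⇒≢ (uW a) ∘ ≡.sym) dist)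
                (λ a b a≢b → clique (a≢b ∘ dist) (vW a) (vW b)) vW uW)
        complete : Complete
        complete {x} {y} x≢y with v Fin.≟ x | v Fin.≟ y
        ... | yes refl | _        = universal x≢y
        ... | no _     | yes refl = swap (universal (x≢y ∘ ≡.sym))
        ... | no v≢x   | no v≢y   = clique x≢y (universal v≢x) (universal v≢y)

      -- Supplies a competitor of `v` whose earlier insertion saves the whole loss. If the earlier
      -- neighbours are not a clique, any further neighbour will do, and one is left because the
      -- degree exceeds d.
      becomes-good : ∀ v P → d ≤ back v P → ¬ Good v P →
        ∃[ w ] (adj v w ≡ true × P w ≡ false × Good v (P ∪ w))
      becomes-good v P d≤ ¬good with nonClique? v P
      ... | no ¬nc = let w , vw , w∉P , nc = clique-extends v P d≤ ¬nc in
            w , vw , w∉P , ℕ.≤-trans (s≤s d≤) (back-∪ v P w vw w∉P) , nc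
      ... | yes nc = let U , _ , fU = choose (λ z → adj v z ∧ not (P z)) 1 front>0
                         vw , w∉P = ∧-true (fU zero)
                         w∉P = Bool.not-injective {y = false} w∉P
                     in U zero , vw , w∉P , ℕ.≤-trans (s≤s d≤) (back-∪ v P (U zero) vw w∉P) , nonClique-mono (U zero) nc
        where
        back≤d : back v P ≤ d
        back≤d = ℕ.s≤s⁻¹ (ℕ.≰⇒> λ a≥ → ¬good (a≥ , nc))
        front>0 : 1 ≤ front v P
        front>0 = ℕ.+-cancelʳ-≤ d 1 (front v P)
          (ℕ.≤-trans (degree-bound v) (ℕ.≤-trans (front+back v P) (ℕ.+-monoʳ-≤ (front v P) back≤d)))

      lack : Fin n → (Fin n → Bool) → ℕ
      lack v P = d ∸ back v P

      -- Losses are measured against a gain of d + 1, in units of 1 / 2M.  A vertex that already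
      -- has d earlier neighbours expects to lose 1 / 2, hence M; the term b (b + 2) solves the
      -- recurrence for the extra loss of a vertex still lacking b of them.
      loss cost gain : Fin n → (Fin n → Bool) → ℕ
      loss v P = if does (good? v P) then 0 else M + lack v P * (lack v P + 2)
      cost v P = if does (good? v P) then 0 else 2 * M * suc (lack v P)
      gain v P = if does (good? v P) then suc d else d ⊓ back v P

      cost+gain : ∀ v P → 2 * M * suc d ≡ cost v P + 2 * M * gain v P
      cost+gain v P with does (good? v P)
      ... | true  = refl
      ... | false = trans (cong (λ x → 2 * M * suc x) (≡.sym (ℕ.m⊓n+n∸m≡n (back v P) d)))
                      (trans (cong (λ x → 2 * M * suc (x + lack v P)) (ℕ.⊓-comm (back v P) d))
                        (rearrange (2 * M) (d ⊓ back v P) (lack v P)))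
        where
        rearrange : ∀ m x y → m * suc (x + y) ≡ m * suc y + m * x
        rearrange = solve-∀

      loss-good : ∀ {v P} → Good v P → loss v P ≡ 0
      loss-good {v} {P} good rewrite dec-true (good? v P) good = refl

      loss-bad : ∀ {v P} → ¬ Good v P → loss v P ≡ M + lack v P * (lack v P + 2)
      loss-bad {v} {P} bad rewrite dec-false (good? v P) bad = refl

      cost-good : ∀ {v P} → Good v P → cost v P ≡ 0
      cost-good {v} {P} good rewrite dec-true (good? v P) good = refl

      cost-bad : ∀ {v P} → ¬ Good v P → cost v P ≡ 2 * M * suc (lack v P)
      cost-bad {v} {P} bad rewrite dec-false (good? v P) bad = refl

      gain-good : ∀ {v P} → Good v P → gain v P ≡ suc d
      gain-good {v} {P} good rewrite dec-true (good? v P) good = refl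

      gain-bad : ∀ {v P} → ¬ Good v P → gain v P ≡ d ⊓ back v P
      gain-bad {v} {P} bad rewrite dec-false (good? v P) bad = refl

      loss≤ : ∀ v P {b} → lack v P ≤ b → loss v P ≤ M + b * (b + 2)
      loss≤ v P l≤b with does (good? v P)
      ... | true  = z≤n
      ... | false = ℕ.+-monoʳ-≤ M (ℕ.*-mono-≤ l≤b (ℕ.+-monoˡ-≤ 2 l≤b))

      lack-mono : ∀ v P w → lack v (P ∪ w) ≤ lack v P
      lack-mono v P w = ℕ.∸-monoʳ-≤ d (back-mono v P w)

      lack-∪ : ∀ {v P w b} → lack v P ≡ suc b → adj v w ≡ true → P w ≡ false → lack v (P ∪ w) ≤ b
      lack-∪ {v} {P} {w} {b} lack≡ vw w∉P = ℕ.≤-trans (ℕ.∸-monoʳ-≤ d (back-∪ v P w vw w∉P))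
        (ℕ.≤-reflexive (trans (≡.sym (ℕ.pred[m∸n]≡m∸[1+n] d (back v P))) (cong ℕ.pred lack≡)))

      next : Fin n → (Fin n → Bool) → Fin n → ℕ
      next v P w = if does (w Fin.≟ v) then cost v P else loss v (P ∪ w)

      -- The expected loss of v does not increase when the next vertex is chosen uniformly
      -- among those not yet in P.
      expected-loss : ∀ v P → P v ≡ false →
        sum (λ w → 𝟙 (not (P w)) * next v P w) ≤ sum (λ w → 𝟙 (not (P w)) * loss v P)
      expected-loss v P v∉P with good? v P
      ... | yes good = sum-mono λ w → ℕ.*-monoʳ-≤ (𝟙 (not (P w))) (ℕ.≤-trans (ℕ.≤-reflexive (next-0 w)) z≤n)
        where
        next-0 : ∀ w → next v P w ≡ 0
        next-0 w with does (w Fin.≟ v)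
        ... | true  = cost-good good
        ... | false = loss-good (good-mono w good)
      ... | no bad = by-lack (lack v P) refl
        where
        open ℕ.≤-Reasoning
        Σnext Σloss : ℕ
        Σnext = sum (λ w → 𝟙 (not (P w)) * next v P w)
        Σloss = sum (λ w → 𝟙 (not (P w)) * loss v P)
        loss≡ : ∀ {b} → lack v P ≡ b → loss v P ≡ M + b * (b + 2)
        loss≡ refl = loss-bad bad
        cost≡ : ∀ {b} → lack v P ≡ b → cost v P ≡ 2 * M * suc b
        cost≡ refl = cost-bad bad
        -- `v` and `w₀` are equally likely to come next: one costs 2M, the other makes the loss
        -- zero, and their average is the estimate M. The point masses at `w₀` and `v` express this
        -- without subtraction.
        via-good : lack v P ≡ 0 → ∀ w₀ → adj v w₀ ≡ true → P w₀ ≡ false → Good v (P ∪ w₀) → Σnext ≤ Σloss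
        via-good lack≡ w₀ vw₀ w₀∉P w₀-good = ℕ.+-cancelʳ-≤ M Σnext Σloss (begin
          Σnext + M
            ≡⟨ cong (Σnext +_) (sum-point w₀ M) ⟨
          Σnext + sum (λ w → [ w ≡ w₀ ] * M)
            ≡⟨ ∑-distrib-+ (λ w → 𝟙 (not (P w)) * next v P w) (λ w → [ w ≡ w₀ ] * M) ⟨
          sum (λ w → 𝟙 (not (P w)) * next v P w + [ w ≡ w₀ ] * M)
            ≤⟨ sum-mono termwise ⟩
          sum (λ w → 𝟙 (not (P w)) * loss v P + [ w ≡ v ] * M)
            ≡⟨ ∑-distrib-+ (λ w → 𝟙 (not (P w)) * loss v P) (λ w → [ w ≡ v ] * M) ⟩
          Σloss + sum (λ w → [ w ≡ v ] * M)
            ≡⟨ cong (Σloss +_) (sum-point v M) ⟩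
          Σloss + M ∎)
          where
          termwise : ∀ w → 𝟙 (not (P w)) * next v P w + [ w ≡ w₀ ] * M ≤ 𝟙 (not (P w)) * loss v P + [ w ≡ v ] * M
          termwise w with w Fin.≟ v | w Fin.≟ w₀
          ... | yes refl | yes refl = contradiction refl (adj⇒≢ vw₀)
          ... | yes refl | no _ rewrite v∉P | cost≡ lack≡ | loss≡ lack≡ = ℕ.≤-reflexive (identity M)
            where
            identity : ∀ M → (2 * M * 1 + 0) + 0 ≡ (M + 0 + 0) + (M + 0)
            identity = solve-∀
          ... | no _ | yes refl rewrite w₀∉P | loss-good w₀-good | loss≡ lack≡ = ℕ.≤-reflexive (identity M)
            where
            identity : ∀ M → M + 0 ≡ (M + 0 + 0) + 0
            identity = solve-∀
          ... | no _ | no _ = ℕ.+-mono-≤ (ℕ.*-monoʳ-≤ (𝟙 (not (P w)))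
            (ℕ.≤-trans (loss≤ v (P ∪ w) (lack-mono v P w)) (ℕ.≤-reflexive (≡.sym (loss-bad bad))))) z≤n
        by-lack : ∀ b → lack v P ≡ b → Σnext ≤ Σloss
        by-lack zero lack≡ = let w₀ , vw₀ , w₀∉P , good = becomes-good v P (ℕ.m∸n≡0⇒m≤n lack≡) bad in
          via-good lack≡ w₀ vw₀ w₀∉P good
        -- Each neighbour of `v` not yet inserted lowers the estimate by b(b + 2) - (b - 1)(b + 1) =
        -- 2b + 1, while choosing `v` itself raises it by M(2b + 1) - b(b + 2). Both sides are
        -- padded to avoid subtraction.
        by-lack (suc c) lack≡ = ℕ.+-cancelʳ-≤ (front v P * (2 * b + 1) + b * (b + 2)) Σnext Σloss (begin
          Σnext + (front v P * (2 * b + 1) + b * (b + 2))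
            ≡⟨ cong (Σnext +_) (cong₂ _+_ (*-distribʳ-sum (2 * b + 1) (λ w → 𝟙 (adj v w ∧ not (P w)))) (≡.sym (sum-point v (b * (b + 2))))) ⟩
          Σnext + (sum (λ w → 𝟙 (adj v w ∧ not (P w)) * (2 * b + 1)) + sum (λ w → [ w ≡ v ] * (b * (b + 2))))
            ≡⟨ cong (Σnext +_) (∑-distrib-+ (λ w → 𝟙 (adj v w ∧ not (P w)) * (2 * b + 1)) (λ w → [ w ≡ v ] * (b * (b + 2)))) ⟨
          Σnext + sum (λ w → 𝟙 (adj v w ∧ not (P w)) * (2 * b + 1) + [ w ≡ v ] * (b * (b + 2)))
            ≡⟨ ∑-distrib-+ (λ w → 𝟙 (not (P w)) * next v P w) (λ w → 𝟙 (adj v w ∧ not (P w)) * (2 * b + 1) + [ w ≡ v ] * (b * (b + 2))) ⟨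
          sum (λ w → 𝟙 (not (P w)) * next v P w + (𝟙 (adj v w ∧ not (P w)) * (2 * b + 1) + [ w ≡ v ] * (b * (b + 2))))
            ≤⟨ sum-mono termwise ⟩
          sum (λ w → 𝟙 (not (P w)) * loss v P + [ w ≡ v ] * (M * (2 * b + 1)))
            ≡⟨ ∑-distrib-+ (λ w → 𝟙 (not (P w)) * loss v P) (λ w → [ w ≡ v ] * (M * (2 * b + 1))) ⟩
          Σloss + sum (λ w → [ w ≡ v ] * (M * (2 * b + 1)))
            ≡⟨ cong (Σloss +_) (sum-point v (M * (2 * b + 1))) ⟩
          Σloss + M * (2 * b + 1)
            ≤⟨ ℕ.+-monoʳ-≤ Σloss M≤ ⟩
          Σloss + (front v P * (2 * b + 1) + b * (b + 2)) ∎)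
          where
          b = suc c
          back≤d : back v P ≤ d
          back≤d = ℕ.<⇒≤ (ℕ.m∸n≢0⇒n<m λ lack≡0 → contradiction (trans (≡.sym lack≡) lack≡0) λ ())
          M+b≤ : M + b ≤ front v P + 2
          M+b≤ = ℕ.+-cancelʳ-≤ (back v P) (M + b) (front v P + 2) (begin
            M + b + back v P          ≡⟨ ℕ.+-assoc M b (back v P) ⟩
            M + (b + back v P)        ≡⟨ cong (λ x → M + (x + back v P)) lack≡ ⟨
            M + (lack v P + back v P) ≡⟨ cong (M +_) (ℕ.m∸n+n≡m back≤d) ⟩
            M + d                     ≤⟨ M-bound v ⟩
            degree v + 2              ≤⟨ ℕ.+-monoˡ-≤ 2 (front+back v P) ⟩
            front v P + back v P + 2  ≡⟨ shuffle (front v P) (back v P) ⟩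
            front v P + 2 + back v P  ∎)
            where
            shuffle : ∀ x y → x + y + 2 ≡ x + 2 + y
            shuffle = solve-∀
          M≤ : M * (2 * b + 1) ≤ front v P * (2 * b + 1) + b * (b + 2)
          M≤ = ℕ.+-cancelʳ-≤ (b * (2 * b + 1)) (M * (2 * b + 1)) (front v P * (2 * b + 1) + b * (b + 2)) (begin
            M * (2 * b + 1) + b * (2 * b + 1)  ≡⟨ ℕ.*-distribʳ-+ (2 * b + 1) M b ⟨
            (M + b) * (2 * b + 1)              ≤⟨ ℕ.*-monoˡ-≤ (2 * b + 1) M+b≤ ⟩
            -- The slack is (3b + 2)(b - 1) with b = c + 1. It is zero for b = 1, which is where the
            -- summand 2 in the bound on `M` comes from.
            (front v P + 2) * (2 * b + 1)      ≤⟨ ℕ.m≤m+n _ (3 * c * c + 5 * c) ⟩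
            (front v P + 2) * (2 * b + 1) + (3 * c * c + 5 * c) ≡⟨ identity (front v P) c ⟩
            front v P * (2 * b + 1) + b * (b + 2) + b * (2 * b + 1) ∎)
            where
            identity : ∀ x c → (x + 2) * (2 * suc c + 1) + (3 * c * c + 5 * c) ≡
              x * (2 * suc c + 1) + suc c * (suc c + 2) + suc c * (2 * suc c + 1)
            identity = solve-∀
          termwise : ∀ w → 𝟙 (not (P w)) * next v P w + (𝟙 (adj v w ∧ not (P w)) * (2 * b + 1) + [ w ≡ v ] * (b * (b + 2)))
            ≤ 𝟙 (not (P w)) * loss v P + [ w ≡ v ] * (M * (2 * b + 1))
          termwise w with w Fin.≟ v
          ... | yes refl rewrite v∉P | loopless v | cost≡ lack≡ | loss≡ lack≡ = ℕ.≤-reflexive (identity M c)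
            where
            identity : ∀ M c → (2 * M * suc (suc c) + 0) + (suc c * (suc c + 2) + 0) ≡
              (M + suc c * (suc c + 2) + 0) + (M * (2 * suc c + 1) + 0)
            identity = solve-∀
          ... | no _ with P w in Pw
          ...   | true rewrite Bool.∧-zeroʳ (adj v w) = z≤n
          ...   | false with adj v w in vw
          ...     | false = ℕ.+-monoˡ-≤ 0 (ℕ.+-monoˡ-≤ 0 (ℕ.≤-trans (loss≤ v (P ∪ w) (lack-mono v P w))
                              (ℕ.≤-reflexive (≡.sym (loss-bad bad)))))
          ...     | true rewrite loss≡ lack≡ = begin
            1 * loss v (P ∪ w) + (1 * (2 * b + 1) + 0)
              ≤⟨ ℕ.+-monoˡ-≤ _ (ℕ.*-monoʳ-≤ 1 (loss≤ v (P ∪ w) (lack-∪ lack≡ vw Pw))) ⟩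
            1 * (M + c * (c + 2)) + (1 * (2 * b + 1) + 0)
              ≡⟨ identity M c ⟩
            1 * (M + b * (b + 2)) + 0 ∎
            where
            identity : ∀ M c → 1 * (M + c * (c + 2)) + (1 * (2 * suc c + 1) + 0) ≡ 1 * (M + suc c * (suc c + 2)) + 0
            identity = solve-∀

      remaining : (Fin n → Bool) → ℕ
      remaining P = sum (λ v → 𝟙 (not (P v)) * loss v P)

      -- Derandomisation: exchanging the two sums reduces the average over all choices to
      -- `expected-loss` for each single vertex, and some choice is no worse than the average.
      cheap-next : ∀ P {w₀} → P w₀ ≡ false →
        ∃[ w ] (P w ≡ false × cost w P + remaining (P ∪ w) ≤ remaining P)
      cheap-next P {w₀} w₀∉P = found
        where
        open ℕ.≤-Reasoning
        T : Fin n → ℕ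
        T w = sum (λ v → 𝟙 (not (P v)) * next v P w)
        exchange : ∀ a b x → a * (b * x) ≡ b * (a * x)
        exchange = solve-∀
        average : sum (λ w → 𝟙 (not (P w)) * T w) ≤ sum (λ w → 𝟙 (not (P w)) * remaining P)
        average = begin
          sum (λ w → 𝟙 (not (P w)) * T w)
            ≤⟨ sum-mono (λ w → ℕ.≤-reflexive (*-distribˡ-sum (𝟙 (not (P w))) (λ v → 𝟙 (not (P v)) * next v P w))) ⟩
          sum (λ w → sum (λ v → 𝟙 (not (P w)) * (𝟙 (not (P v)) * next v P w)))
            ≡⟨ ∑-comm (λ w v → 𝟙 (not (P w)) * (𝟙 (not (P v)) * next v P w)) ⟩
          sum (λ v → sum (λ w → 𝟙 (not (P w)) * (𝟙 (not (P v)) * next v P w)))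
            ≤⟨ sum-mono fixed ⟩
          sum (λ v → sum (λ w → 𝟙 (not (P w)) * (𝟙 (not (P v)) * loss v P)))
            ≡⟨ ∑-comm (λ v w → 𝟙 (not (P w)) * (𝟙 (not (P v)) * loss v P)) ⟩
          sum (λ w → sum (λ v → 𝟙 (not (P w)) * (𝟙 (not (P v)) * loss v P)))
            ≤⟨ sum-mono (λ w → ℕ.≤-reflexive (≡.sym (*-distribˡ-sum (𝟙 (not (P w))) (λ v → 𝟙 (not (P v)) * loss v P)))) ⟩
          sum (λ w → 𝟙 (not (P w)) * remaining P) ∎
          where
          pull : ∀ a (f : Fin n → ℕ) → sum (λ w → 𝟙 (not (P w)) * (a * f w)) ≤ a * sum (λ w → 𝟙 (not (P w)) * f w)
          pull a f = begin
            sum (λ w → 𝟙 (not (P w)) * (a * f w)) ≤⟨ sum-mono (λ w → ℕ.≤-reflexive (exchange (𝟙 (not (P w))) a (f w))) ⟩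
            sum (λ w → a * (𝟙 (not (P w)) * f w)) ≡⟨ *-distribˡ-sum a (λ w → 𝟙 (not (P w)) * f w) ⟨
            a * sum (λ w → 𝟙 (not (P w)) * f w)   ∎
          push : ∀ a (f : Fin n → ℕ) → a * sum (λ w → 𝟙 (not (P w)) * f w) ≤ sum (λ w → 𝟙 (not (P w)) * (a * f w))
          push a f = begin
            a * sum (λ w → 𝟙 (not (P w)) * f w)   ≡⟨ *-distribˡ-sum a (λ w → 𝟙 (not (P w)) * f w) ⟩
            sum (λ w → a * (𝟙 (not (P w)) * f w)) ≤⟨ sum-mono (λ w → ℕ.≤-reflexive (exchange a (𝟙 (not (P w))) (f w))) ⟩
            sum (λ w → 𝟙 (not (P w)) * (a * f w)) ∎
          fixed : ∀ v → sum (λ w → 𝟙 (not (P w)) * (𝟙 (not (P v)) * next v P w)) ≤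
            sum (λ w → 𝟙 (not (P w)) * (𝟙 (not (P v)) * loss v P))
          fixed v with P v in Pv
          ... | true  = ℕ.≤-trans (pull 0 (next v P)) z≤n
          ... | false = ℕ.≤-trans (pull 1 (next v P))
                          (ℕ.≤-trans (ℕ.*-monoʳ-≤ 1 (expected-loss v P Pv)) (push 1 (λ _ → loss v P)))
        after : ∀ w → P w ≡ false → cost w P + remaining (P ∪ w) ≤ T w
        after w w∉P = begin
          cost w P + remaining (P ∪ w)
            ≡⟨ cong (_+ remaining (P ∪ w)) (sum-point w (cost w P)) ⟨
          sum (λ v → [ v ≡ w ] * cost w P) + remaining (P ∪ w)
            ≡⟨ ∑-distrib-+ (λ v → [ v ≡ w ] * cost w P) (λ v → 𝟙 (not ((P ∪ w) v)) * loss v (P ∪ w)) ⟨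
          sum (λ v → [ v ≡ w ] * cost w P + 𝟙 (not ((P ∪ w) v)) * loss v (P ∪ w))
            ≤⟨ sum-mono termwise ⟩
          T w ∎
          where
          termwise : ∀ v → [ v ≡ w ] * cost w P + 𝟙 (not ((P ∪ w) v)) * loss v (P ∪ w) ≤ 𝟙 (not (P v)) * next v P w
          termwise v with v Fin.≟ w
          ... | yes refl rewrite w∉P | dec-true (w Fin.≟ w) refl = ℕ.≤-reflexive (ℕ.+-identityʳ (1 * cost w P))
          ... | no v≢w rewrite dec-false (w Fin.≟ v) (v≢w ∘ ≡.sym) = ℕ.≤-refl
        found : ∃[ w ] (P w ≡ false × cost w P + remaining (P ∪ w) ≤ remaining P)
        found = let w , Ww , T≤ = below-average (not ∘ P) T (remaining P) average {w₀} (cong not w₀∉P)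
                in w , Bool.not-injective {y = false} Ww , ℕ.≤-trans (after w (Bool.not-injective {y = false} Ww)) T≤

      -- The counting meets independent families only through these two steps, which the 0-extension
      -- and the 1-extension will provide.
      module Growth (Attains : (Fin n → Bool) → ℕ → Set)
        (zero-step : ∀ P {ρ w j} (U : Fin j → Fin n) → Attains P ρ → P w ≡ false → Distinct U →
          (∀ a → adj w (U a) ≡ true × P (U a) ≡ true) → j ≤ d → Attains (P ∪ w) (j + ρ))
        (one-step : ∀ P {ρ w x y} (U : Fin k → Fin n) → Attains P ρ → P w ≡ false → Distinct (x ∷ y ∷ U) →
          (∀ a → adj w ((x ∷ y ∷ U) a) ≡ true × P ((x ∷ y ∷ U) a) ≡ true) → adj x y ≡ false →
          Attains (P ∪ w) (suc d + ρ)) where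

        step : ∀ {P ρ w} → Attains P ρ → P w ≡ false → Attains (P ∪ w) (gain w P + ρ)
        step {P} {ρ} {w} att w∉P with good? w P
        ... | no bad = subst (λ g → Attains (P ∪ w) (g + ρ)) (≡.sym (gain-bad bad))
         (let U , dist , fU = choose (λ z → adj w z ∧ P z) (d ⊓ back w P) (ℕ.m⊓n≤n d (back w P))
          in zero-step P U att w∉P dist (∧-true ∘ fU) (ℕ.m⊓n≤m d (back w P)))
        ... | yes good@(a≥ , x , y , x≢y , wx , wy , xy) = subst (λ g → Attains (P ∪ w) (g + ρ)) (≡.sym (gain-good good)) (one-step P (proj₁ U) att w∉P
            (distinct₂ x≢y (λ a → proj₁ (proj₂ (fU a))) (λ a → proj₂ (proj₂ (fU a))) (proj₁ (proj₂ U)))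
            (λ { zero → ∧-true wx ; (suc zero) → ∧-true wy ; (suc (suc a)) → proj₁ (fU a) }) xy)
          where
          -- Besides `x` and `y`, k = d - 1 further earlier neighbours are needed for d + 1 new
          -- pairs.
          f : Fin n → Bool
          f z = (adj w z ∧ P z) ∧ (not (does (z Fin.≟ x)) ∧ not (does (z Fin.≟ y)))
          f-many : k ≤ count f
          f-many = ℕ.+-cancelʳ-≤ 2 k (count f) (begin
            k + 2        ≡⟨ ℕ.+-comm k 2 ⟩
            suc d        ≤⟨ a≥ ⟩
            back w P     ≤⟨ sum-mono termwise ⟩
            sum (λ z → 𝟙 (f z) + ([ z ≡ x ] + [ z ≡ y ]))
              ≡⟨ ∑-distrib-+ (λ z → 𝟙 (f z)) (λ z → [ z ≡ x ] + [ z ≡ y ]) ⟩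
            count f + sum (λ z → [ z ≡ x ] + [ z ≡ y ])
              ≡⟨ cong (count f +_) (∑-distrib-+ (λ z → [ z ≡ x ]) (λ z → [ z ≡ y ])) ⟩
            count f + (sum (λ z → [ z ≡ x ]) + sum (λ z → [ z ≡ y ]))
              ≡⟨ cong (count f +_) (cong₂ _+_ (count-point x) (count-point y)) ⟩
            count f + 2  ∎)
            where
            open ℕ.≤-Reasoning
            termwise : ∀ z → 𝟙 (adj w z ∧ P z) ≤ 𝟙 (f z) + ([ z ≡ x ] + [ z ≡ y ])
            termwise z with adj w z ∧ P z | does (z Fin.≟ x) | does (z Fin.≟ y)
            ... | false | _     | _     = z≤n
            ... | true  | true  | _     = s≤s z≤n
            ... | true  | false | true  = s≤s z≤n
            ... | true  | false | false = s≤s z≤n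
          U = choose f k f-many
          not-does : ∀ {z u : Fin n} → not (does (z Fin.≟ u)) ≡ true → z ≢ u
          not-does {z} {u} nd with z Fin.≟ u
          ... | no z≢u = z≢u
          fU : ∀ a → (adj w (proj₁ U a) ≡ true × P (proj₁ U a) ≡ true) × (proj₁ U a ≢ x × proj₁ U a ≢ y)
          fU a = let wP , ≢xy = ∧-true (proj₂ (proj₂ U) a) ; ≢x , ≢y = ∧-true ≢xy
                 in ∧-true wP , (not-does ≢x , not-does ≢y)

        -- Each insertion gains d + 1 less its cost, and by `cheap-next` the costs are paid out of
        -- `remaining P`.
        grow : ∀ R P ρ → count (not ∘ P) ≡ R → Attains P ρ →
          ∃[ P′ ] ∃[ ρ′ ] (Attains P′ ρ′ × 2 * M * suc d * R + 2 * M * ρ ≤ 2 * M * ρ′ + remaining P)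
        grow zero    P ρ _  att = P , ρ , att
          , ℕ.≤-trans (ℕ.≤-reflexive (cong (_+ 2 * M * ρ) (ℕ.*-zeroʳ (2 * M * suc d)))) (ℕ.m≤m+n _ _)
        grow (suc R) P ρ eq att =
          let U , _ , fU = choose (not ∘ P) 1 (ℕ.≤-trans (s≤s z≤n) (ℕ.≤-reflexive (≡.sym eq)))
              w , w∉P , cheap = cheap-next P (Bool.not-injective {y = false} (fU zero))
              P′ , ρ′ , att′ , bound = grow R (P ∪ w) (gain w P + ρ) (fewer w w∉P) (step att w∉P)
          in P′ , ρ′ , att′ , accounting w cheap bound
          where
          open ℕ.≤-Reasoning
          fewer : ∀ w → P w ≡ false → count (not ∘ (P ∪ w)) ≡ R
          fewer w w∉P = ℕ.suc-injective (trans (≡.sym (ℕ.+-comm (count (not ∘ (P ∪ w))) 1))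
            (trans (cong (count (not ∘ (P ∪ w)) +_) (≡.sym (count-point w)))
            (trans (≡.sym (∑-distrib-+ (λ z → 𝟙 (not ((P ∪ w) z))) (λ z → [ z ≡ w ])))
            (trans (ℕ.≤-antisym (sum-mono (ℕ.≤-reflexive ∘ termwise)) (sum-mono (ℕ.≤-reflexive ∘ ≡.sym ∘ termwise))) eq))))
            where
            termwise : ∀ z → 𝟙 (not ((P ∪ w) z)) + [ z ≡ w ] ≡ 𝟙 (not (P z))
            termwise z with z Fin.≟ w
            ... | yes refl rewrite w∉P = refl
            ... | no _ = ℕ.+-identityʳ _
          accounting : ∀ w {ρ′} → cost w P + remaining (P ∪ w) ≤ remaining P →
            2 * M * suc d * R + 2 * M * (gain w P + ρ) ≤ 2 * M * ρ′ + remaining (P ∪ w) →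
            2 * M * suc d * suc R + 2 * M * ρ ≤ 2 * M * ρ′ + remaining P
          accounting w {ρ′} cheap bound = begin
            2 * M * suc d * suc R + 2 * M * ρ
              ≡⟨ split (2 * M) (suc d) R ρ ⟩
            2 * M * suc d + (2 * M * suc d * R + 2 * M * ρ)
              ≡⟨ cong (_+ (2 * M * suc d * R + 2 * M * ρ)) (cost+gain w P) ⟩
            cost w P + 2 * M * gain w P + (2 * M * suc d * R + 2 * M * ρ)
              ≡⟨ regroup (cost w P) (2 * M) (gain w P) (2 * M * suc d * R) ρ ⟩
            cost w P + (2 * M * suc d * R + 2 * M * (gain w P + ρ))
              ≤⟨ ℕ.+-monoʳ-≤ (cost w P) bound ⟩
            cost w P + (2 * M * ρ′ + remaining (P ∪ w))
              ≡⟨ commute (cost w P) (2 * M * ρ′) (remaining (P ∪ w)) ⟩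
            2 * M * ρ′ + (cost w P + remaining (P ∪ w))
              ≤⟨ ℕ.+-monoʳ-≤ (2 * M * ρ′) cheap ⟩
            2 * M * ρ′ + remaining P ∎
            where
            split : ∀ m e R ρ → m * e * suc R + m * ρ ≡ m * e + (m * e * R + m * ρ)
            split = solve-∀
            regroup : ∀ c m g x ρ → c + m * g + (x + m * ρ) ≡ c + (x + m * (g + ρ))
            regroup = solve-∀
            commute : ∀ a b c → a + (b + c) ≡ b + (a + c)
            commute = solve-∀

        -- At the start a vertex lacks at most d earlier neighbours, so its estimated loss is at
        -- most M + d(d + 2).
        attains-many : Attains (λ _ → false) 0 →
          ∃[ P ] ∃[ ρ ] (Attains P ρ × 2 * M * suc d * n ≤ 2 * M * ρ + n * (M + d * (d + 2)))
        attains-many att = let P , ρ , att′ , bound = grow n (λ _ → false) 0 (trans (sum-const n 1) (ℕ.*-identityʳ n)) att in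
          P , ρ , att′ , ℕ.≤-trans (ℕ.m≤m+n _ (2 * M * 0)) (ℕ.≤-trans bound (ℕ.+-monoʳ-≤ (2 * M * ρ)
            (ℕ.≤-trans (sum-mono λ v → ℕ.≤-trans (ℕ.≤-reflexive (ℕ.*-identityˡ (loss v (λ _ → false))))
                (loss≤ v (λ _ → false) (ℕ.m∸n≤m d (back v (λ _ → false)))))
              (ℕ.≤-reflexive (sum-const n (M + d * (d + 2)))))))

open Counting

-- Generic frameworks: the maximal rank and the closure of a graph.

search-Fin : ∀ {n} {P : Fin n → Set} → (∀ i → Dec (P i)) → (∀ i → P i) ⊎ ∃[ i ] ¬ P i
search-Fin P? with Fin.all? P?
... | yes all = inj₁ all
... | no ¬all = inj₂ (Fin.¬∀⟶∃¬ _ _ P? ¬all)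

search-Fin² : ∀ {m n} {P : Fin m × Fin n → Set} → (∀ i → Dec (P i)) → (∀ i → P i) ⊎ ∃[ i ] ¬ P i
search-Fin² P? with search-Fin (λ i → Fin.all? λ j → P? (i , j))
... | inj₁ all         = inj₁ λ (i , j) → all i j
... | inj₂ (i , ¬all) with search-Fin (λ j → P? (i , j))
...   | inj₁ all       = contradiction all ¬all
...   | inj₂ (j , ¬p)  = inj₂ ((i , j) , ¬p)

-- Counts the pairs among the first `m` vertices that meet the first `d`; for m ≥ d this is dm - d(d
-- + 1)/2.
baseSize : ℕ → ℕ → ℕ
baseSize d zero    = 0
baseSize d (suc m) = m ⊓ d ℕ.+ baseSize d m

module Framework (S : Scalars) (n d : ℕ) where
  open import Data.Vec.Functional using (_∷_; _++_)
  open ScalarAlgebra S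
  open Polynomials S
  open LinearAlgebra S
  open Elimination S
  open Rows S n d

  module _ {p : Placement} (generic : Independent (flat p)) (d≤n : d ≤ n) where
    open AtGeneric {p} generic
    open Generic generic

    -- Vertices are inserted in their natural order by 0-extensions, each joined to all earlier ones
    -- among the first d. The last clause, used by `T-spans`, says that no such pair is missed.
    base : ∀ m → m ≤ n → Σ[ E ∈ (Fin (baseSize d m) → Pair) ] (Ind p E
      × (∀ b → toℕ (proj₁ (E b)) < m × toℕ (proj₂ (E b)) < m)
      × (∀ {u v} → toℕ u < toℕ v → toℕ v < m → toℕ u < d → ∃[ b ] E b ≡ (v , u)))
    base zero    _   = (λ ()) , (λ _ _ ()) , (λ ()) , λ _ ()
    base (suc m) m<n with base m (ℕ.<⇒≤ m<n)
    ... | E , ind , E<m , has = star v U ++ E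
      , zero-extension U-distinct U≢v (ℕ.m⊓n≤n m d) avoids ind
      , ∀-split (m ⊓ d)
          (λ a → subst below (≡.sym (++-↑ˡ (star v U) E a))
            (ℕ.≤-reflexive (cong suc toℕ-v) , ℕ.<-trans (U<m a) ℕ.≤-refl))
          (λ b → subst below (≡.sym (++-↑ʳ (star v U) E b))
            (ℕ.m<n⇒m<1+n (proj₁ (E<m b)) , ℕ.m<n⇒m<1+n (proj₂ (E<m b))))
      , has′
      where
      below : Pair → Set
      below e = toℕ (proj₁ e) < suc m × toℕ (proj₂ e) < suc m
      v : Fin n
      v = fromℕ< m<n
      toℕ-v : toℕ v ≡ m
      toℕ-v = Fin.toℕ-fromℕ< m<n
      U : Fin (m ⊓ d) → Fin n
      U a = inject≤ a (ℕ.≤-trans (ℕ.m⊓n≤n m d) d≤n)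
      toℕ-U : ∀ a → toℕ (U a) ≡ toℕ a
      toℕ-U a = Fin.toℕ-inject≤ a _
      U<m : ∀ a → toℕ (U a) < m
      U<m a = subst (_< m) (≡.sym (toℕ-U a)) (ℕ.<-≤-trans (Fin.toℕ<n a) (ℕ.m⊓n≤m m d))
      U-distinct : Distinct U
      U-distinct {a} {b} eq = Fin.toℕ-injective (≡.trans (≡.sym (toℕ-U a)) (≡.trans (cong toℕ eq) (toℕ-U b)))
      below⇒≢v : ∀ {u} → toℕ u < m → u ≢ v
      below⇒≢v u<m refl = ℕ.<-irrefl toℕ-v u<m
      U≢v : ∀ a → U a ≢ v
      U≢v a = below⇒≢v (U<m a)
      avoids : Avoids v E
      avoids b = below⇒≢v (proj₁ (E<m b)) ∘ ≡.sym , below⇒≢v (proj₂ (E<m b)) ∘ ≡.sym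
      has′ : ∀ {u w} → toℕ u < toℕ w → toℕ w < suc m → toℕ u < d → ∃[ b ] (star v U ++ E) b ≡ (w , u)
      has′ {u} {w} u<w w<1+m u<d with toℕ w ℕ.≟ m
      ... | no w≢m = let b , eq = has u<w (ℕ.≤∧≢⇒< (ℕ.s≤s⁻¹ w<1+m) w≢m) u<d in
            (m ⊓ d) ↑ʳ b , ≡.trans (++-↑ʳ (star v U) E b) eq
      ... | yes w≡m = a ↑ˡ baseSize d m , ≡.trans (++-↑ˡ (star v U) E a) (cong₂ _,_ v≡w Ua≡u)
            where
            u<m⊓d : toℕ u < m ⊓ d
            u<m⊓d = ℕ.⊓-glb (subst (toℕ u <_) w≡m u<w) u<d
            a = fromℕ< u<m⊓d
            v≡w : v ≡ w
            v≡w = Fin.toℕ-injective (≡.trans toℕ-v (≡.sym w≡m))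
            Ua≡u : U a ≡ u
            Ua≡u = Fin.toℕ-injective (≡.trans (toℕ-U a) (Fin.toℕ-fromℕ< u<m⊓d))

    T : Fin (baseSize d n) → Pair
    T = proj₁ (base n ℕ.≤-refl)

    T-independent : Ind p T
    T-independent = proj₁ (proj₂ (base n ℕ.≤-refl))

    T-spans : ∀ ψ → (∀ b → ⟪ ψ , row p (T b) ⟫ ≈ 0#) → ∀ u v → tension ψ u v ≈ 0#
    T-spans ψ kills u v = every
      where
      ordered : ∀ {u v} → toℕ u < toℕ v → toℕ u < d → tension ψ v u ≈ 0#
      ordered {u} {v} u<v u<d = let b , eq = proj₂ (proj₂ (proj₂ (base n ℕ.≤-refl))) u<v (Fin.toℕ<n v) u<d in
        ≈-trans (reflexive (cong (λ e → ⟪ ψ , row p e ⟫) (≡.sym eq))) (kills b)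
      from-core : ∀ {u v} → u ≢ v → toℕ u < d → tension ψ u v ≈ 0#
      from-core {u} {v} u≢v u<d with ℕ.<-cmp (toℕ u) (toℕ v)
      ... | tri< u<v _ _ = ≈-trans (tension-swap ψ u v) (ordered u<v u<d)
      ... | tri≈ _ u≡v _ = contradiction (Fin.toℕ-injective u≡v) u≢v
      ... | tri> _ _ v<u = ordered v<u (ℕ.<-trans v<u u<d)
      core : Fin d → Fin n
      core a = inject≤ a d≤n
      core<d : ∀ a → toℕ (core a) < d
      core<d a = subst (_< d) (≡.sym (Fin.toℕ-inject≤ a d≤n)) (Fin.toℕ<n a)
      core-distinct : Distinct core
      core-distinct {a} {b} eq = Fin.toℕ-injective
        (≡.trans (≡.sym (Fin.toℕ-inject≤ a d≤n)) (≡.trans (cong toℕ eq) (Fin.toℕ-inject≤ b d≤n)))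
      core≢ : ∀ {w} → ¬ (toℕ w < d) → ∀ a → core a ≢ w
      core≢ w≮d a refl = w≮d (core<d a)
      to-core : ∀ {w} → ¬ (toℕ w < d) → ∀ a → tension ψ w (core a) ≈ 0#
      to-core w≮d a = ≈-trans (tension-swap ψ _ _) (from-core (core≢ w≮d a) (core<d a))
      every : tension ψ u v ≈ 0#
      every with u Fin.≟ v | toℕ u ℕ.<? d | toℕ v ℕ.<? d
      ... | yes refl | _       | _       = tension-loop ψ u
      ... | no u≢v   | yes u<d | _       = from-core u≢v u<d
      ... | no u≢v   | no _    | yes v<d = ≈-trans (tension-swap ψ u v) (from-core (u≢v ∘ ≡.sym) v<d)
      ... | no u≢v   | no u≮d  | no v≮d  = clique-closure ψ core
        (∷-distinct (λ { zero → u≢v ∘ ≡.sym ; (suc a) → core≢ u≮d a }) (∷-distinct (core≢ v≮d) core-distinct))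
        (λ a b a≢b → from-core (a≢b ∘ core-distinct) (core<d a)) (to-core u≮d) (to-core v≮d)

    rows-bound : ∀ {r r′} (B : Fin r → Pair) (A : Fin r′ → Pair) → Ind p B → Ind p A →
      (∀ k ψ → (∀ b → ⟪ ψ , row p (B b) ⟫ ≈ 0#) → ⟪ ψ , row p (A k) ⟫ ≈ 0#) → r′ ≤ r
    rows-bound B A indB indA spans = Steinitz (rowP ∘ B) (flat p) (λ k → row p (A k))
      (LI-cong (λ k j → ≈-sym (ev-rowP p (B k) j)) indB) indA
      λ k ψ ψB≈0 → spans k ψ λ b → ≈-trans (≈-sym (⟪⟫-cong ψ (ev-rowP p (B b)))) (ψB≈0 b)

    rank≤ : ∀ {r} (A : Fin r → Pair) → Ind p A → r ≤ baseSize d n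
    rank≤ A ind = rows-bound T A T-independent ind λ k ψ kills → T-spans ψ kills _ _

    module OfGraph (adj : Fin n → Fin n → Bool)
      (symmetric : ∀ u v → adj u v ≡ adj v u) (loopless : ∀ v → adj v v ≡ false) where

      isEdge : Pair → Bool
      isEdge (u , v) = adj u v ∧ does (u Fin.<? v)

      private
        pairs : Fin (n ℕ.* n) → Pair
        pairs = remQuot n
        abstract
          result : Σ[ r ∈ ℕ ] Σ[ ρ ∈ (Fin r → Fin (n ℕ.* n)) ] ((∀ k → isEdge (pairs (ρ k)) ≡ true)
            × Certificate (rowP ∘ pairs ∘ ρ) (flat p)
            × (∀ i → isEdge (pairs i) ≡ true →
                Span (λ k → at (rowP (pairs (ρ k))) (flat p)) (at (rowP (pairs i)) (flat p))))
          result = basis search-Fin² (rowP ∘ pairs) (isEdge ∘ pairs)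

      r : ℕ
      r = proj₁ result

      B : Fin r → Pair
      B = pairs ∘ proj₁ (proj₂ result)

      B-edges : ∀ k → isEdge (B k) ≡ true
      B-edges = proj₁ (proj₂ (proj₂ result))

      certificate : Certificate (rowP ∘ B) (flat p)
      certificate = proj₁ (proj₂ (proj₂ (proj₂ result)))

      B-independent : Ind p B
      B-independent = LI-cong (λ k → ev-rowP p (B k))
        (Certificate.independent-at certificate (flat p) (Certificate.s≉0 certificate))

      -- The infinitesimal motions of the graph: by `edge-tension`, killing the basis means killing
      -- all edge rows.
      Kills : Functional Column → Set
      Kills ψ = ∀ k → ⟪ ψ , row p (B k) ⟫ ≈ 0#

      private
        kills⇒ : ∀ {ψ} → Kills ψ → ∀ k → ⟪ ψ , at (rowP (B k)) (flat p) ⟫ ≈ 0#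
        kills⇒ {ψ} kills k = ≈-trans (⟪⟫-cong ψ (ev-rowP p (B k))) (kills k)

        ordered-edge : ∀ {u v} → adj u v ≡ true → u Fin.< v → ∀ {ψ} → Kills ψ → tension ψ u v ≈ 0#
        ordered-edge {u} {v} uv u<v {ψ} kills = ≈-trans (≈-sym (⟪⟫-cong ψ (ev-rowP p (u , v))))
          (subst (λ e → ⟪ ψ , at (rowP e) (flat p) ⟫ ≈ 0#) (Fin.remQuot-combine u v)
            (proj₂ (proj₂ (proj₂ (proj₂ result))) (combine u v)
              (≡.trans (cong isEdge (Fin.remQuot-combine u v)) (cong₂ _∧_ uv (dec-true (u Fin.<? v) u<v)))
              ψ (kills⇒ {ψ} kills)))

      edge-tension : ∀ {u v} → adj u v ≡ true → ∀ {ψ} → Kills ψ → tension ψ u v ≈ 0#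
      edge-tension {u} {v} uv {ψ} kills with Fin.<-cmp u v
      ... | tri< u<v _ _  = ordered-edge uv u<v {ψ} kills
      ... | tri≈ _ refl _ = tension-loop ψ u
      ... | tri> _ _ v<u  = ≈-trans (tension-swap ψ u v) (ordered-edge (≡.trans (symmetric v u) uv) v<u {ψ} kills)

      abstract
        -- The negative answer comes with an explicit motion that changes the length of uv;
        -- `one-step` relies on it.
        spanned? : ∀ u v → (∀ ψ → Kills ψ → tension ψ u v ≈ 0#) ⊎ ∃[ ψ ] (Kills ψ × ¬ (tension ψ u v ≈ 0#))
        spanned? u v with span? search-Fin² certificate (rowP (u , v))
        ... | inj₁ span = inj₁ λ ψ kills → ≈-trans (≈-sym (⟪⟫-cong ψ (ev-rowP p (u , v)))) (span ψ (kills⇒ {ψ} kills))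
        ... | inj₂ (ψ , kills , ψ≉0) = inj₂ (ψ
          , (λ k → ≈-trans (≈-sym (⟪⟫-cong ψ (ev-rowP p (B k)))) (kills k))
          , λ ψ≈0 → ψ≉0 (≈-trans (⟪⟫-cong ψ (ev-rowP p (u , v))) ψ≈0))

      abstract
        -- The closure of the edge set in the generic rigidity matroid.
        closed : Fin n → Fin n → Bool
        closed u v = not (does (u Fin.≟ v)) ∧ [ (λ _ → true) , (λ _ → false) ]′ (spanned? u v)

        closed⇒tension : ∀ {u v} → closed u v ≡ true → ∀ ψ → Kills ψ → tension ψ u v ≈ 0#
        closed⇒tension {u} {v} uv with u Fin.≟ v | spanned? u v
        ... | no _ | inj₁ span = span

        tension⇒closed : ∀ {u v} → u ≢ v → (∀ ψ → Kills ψ → tension ψ u v ≈ 0#) → closed u v ≡ true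
        tension⇒closed {u} {v} u≢v span with u Fin.≟ v | spanned? u v
        ... | yes u≡v | _                      = contradiction u≡v u≢v
        ... | no _    | inj₁ _                 = refl
        ... | no _    | inj₂ (ψ , kills , ψ≉0) = contradiction (span ψ kills) ψ≉0

        not-closed⇒motion : ∀ {u v} → u ≢ v → closed u v ≡ false → ∃[ ψ ] (Kills ψ × ¬ (tension ψ u v ≈ 0#))
        not-closed⇒motion {u} {v} u≢v uv with u Fin.≟ v | spanned? u v
        ... | yes u≡v | _           = contradiction u≡v u≢v
        ... | no _    | inj₂ motion = motion

        closed⇒≢ : ∀ {u v} → closed u v ≡ true → u ≢ v
        closed⇒≢ {u} {v} uv with u Fin.≟ v
        ... | no u≢v = u≢v

      closed-loopless : ∀ v → closed v v ≡ false
      closed-loopless v with closed v v in vv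
      ... | false = refl
      ... | true  = contradiction refl (closed⇒≢ {v} vv)

      closed-swap : ∀ {u v} → closed u v ≡ true → closed v u ≡ true
      closed-swap {u} {v} uv = tension⇒closed (closed⇒≢ uv ∘ ≡.sym)
        λ ψ kills → ≈-trans (tension-swap ψ v u) (closed⇒tension uv ψ kills)

      closed-symmetric : ∀ u v → closed u v ≡ closed v u
      closed-symmetric u v with closed u v in uv | closed v u in vu
      ... | true  | true  = refl
      ... | false | false = refl
      ... | true  | false = contradiction (≡.trans (≡.sym (closed-swap uv)) vu) λ ()
      ... | false | true  = contradiction (≡.trans (≡.sym (closed-swap vu)) uv) λ ()

      adj⇒closed : ∀ {u v} → adj u v ≡ true → closed u v ≡ true
      adj⇒closed {u} {v} uv = tension⇒closed
        (λ { refl → contradiction (≡.trans (≡.sym uv) (loopless u)) λ () }) λ ψ kills → edge-tension uv {ψ} kills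

      closed-clique : ∀ {x y} (U : Fin d → Fin n) → Distinct (x ∷ y ∷ U) →
        (∀ a b → a ≢ b → closed (U a) (U b) ≡ true) →
        (∀ a → closed x (U a) ≡ true) → (∀ a → closed y (U a) ≡ true) → closed x y ≡ true
      closed-clique U dist inside from-x from-y = tension⇒closed
        (λ x≡y → contradiction (dist {zero} {suc zero} x≡y) λ ()) λ ψ kills → clique-closure ψ U dist
          (λ a b a≢b → closed⇒tension (inside a b a≢b) ψ kills)
          (λ a → closed⇒tension (from-x a) ψ kills) (λ a → closed⇒tension (from-y a) ψ kills)

      -- Passing to the closure does not raise the rank, so independent families may use its pairs
      -- as if they were edges.
      r≥ : ∀ {ρ} (E : Fin ρ → Pair) → Ind p E → (∀ b → closed (proj₁ (E b)) (proj₂ (E b)) ≡ true) → ρ ≤ r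
      r≥ E ind E-closed = rows-bound B E B-independent ind λ k ψ kills → closed⇒tension (E-closed k) ψ kills

      complete⇒rank : (∀ {x y} → x ≢ y → closed x y ≡ true) → baseSize d n ≤ r
      complete⇒rank complete = rows-bound B T B-independent T-independent λ k ψ kills →
        all-tensions ψ kills (proj₁ (T k)) (proj₂ (T k))
        where
        all-tensions : ∀ ψ → Kills ψ → ∀ u v → tension ψ u v ≈ 0#
        all-tensions ψ kills u v with u Fin.≟ v
        ... | yes refl = tension-loop ψ u
        ... | no u≢v   = closed⇒tension (complete u≢v) ψ kills

      Attains : (Fin n → Bool) → ℕ → Set
      Attains P ρ = Σ[ E ∈ (Fin ρ → Pair) ] (Ind p E × (∀ b → closed (proj₁ (E b)) (proj₂ (E b)) ≡ true)
        × (∀ b → P (proj₁ (E b)) ≡ true × P (proj₂ (E b)) ≡ true))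

      outside : ∀ {P : Fin n → Bool} {w u} → P w ≡ false → P u ≡ true → u ≢ w
      outside w∉P Pu refl = contradiction (≡.trans (≡.sym w∉P) Pu) λ ()

      attach : ∀ {P ρ w j} (U : Fin j → Fin n) (E : Fin ρ → Pair) →
        (∀ a → closed w (U a) ≡ true × P (U a) ≡ true) →
        (∀ b → closed (proj₁ (E b)) (proj₂ (E b)) ≡ true) → (∀ b → P (proj₁ (E b)) ≡ true × P (proj₂ (E b)) ≡ true) →
        (∀ b → closed (proj₁ ((star w U ++ E) b)) (proj₂ ((star w U ++ E) b)) ≡ true)
        × (∀ b → (P ∪ w) (proj₁ ((star w U ++ E) b)) ≡ true × (P ∪ w) (proj₂ ((star w U ++ E) b)) ≡ true)
      attach {P} {ρ} {w} {j} U E wU E-closed E-in =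
        ∀-split j (λ a → subst (λ e → closed (proj₁ e) (proj₂ e) ≡ true) (≡.sym (++-↑ˡ (star w U) E a)) (proj₁ (wU a)))
                  (λ b → subst (λ e → closed (proj₁ e) (proj₂ e) ≡ true) (≡.sym (++-↑ʳ (star w U) E b)) (E-closed b))
        , ∀-split j (λ a → subst within (≡.sym (++-↑ˡ (star w U) E a)) (∪-here P w , ∪-there P w (proj₂ (wU a))))
                    (λ b → subst within (≡.sym (++-↑ʳ (star w U) E b))
                      (∪-there P w (proj₁ (E-in b)) , ∪-there P w (proj₂ (E-in b))))
        where
        within : Pair → Set
        within e = (P ∪ w) (proj₁ e) ≡ true × (P ∪ w) (proj₂ e) ≡ true

      avoids-outside : ∀ {P ρ w} {E : Fin ρ → Pair} → P w ≡ false →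
        (∀ b → P (proj₁ (E b)) ≡ true × P (proj₂ (E b)) ≡ true) → Avoids w E
      avoids-outside {P} w∉P E-in b =
        outside {P} w∉P (proj₁ (E-in b)) ∘ ≡.sym , outside {P} w∉P (proj₂ (E-in b)) ∘ ≡.sym

      zero-step : ∀ P {ρ w j} (U : Fin j → Fin n) → Attains P ρ → P w ≡ false → Distinct U →
        (∀ a → closed w (U a) ≡ true × P (U a) ≡ true) → j ≤ d → Attains (P ∪ w) (j ℕ.+ ρ)
      zero-step P {w = w} U (E , ind , E-closed , E-in) w∉P dist wU j≤d = star w U ++ E
        , zero-extension dist (λ a → outside {P} w∉P (proj₂ (wU a))) j≤d (avoids-outside {P} w∉P E-in) ind
        , attach {P} U E wU E-closed E-in

      one-step : ∀ {k} → suc k ≤ d → ∀ P {ρ w x y} (U : Fin k → Fin n) → Attains P ρ → P w ≡ false → Distinct (x ∷ y ∷ U) →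
        (∀ a → closed w ((x ∷ y ∷ U) a) ≡ true × P ((x ∷ y ∷ U) a) ≡ true) → closed x y ≡ false →
        Attains (P ∪ w) (suc (suc k) ℕ.+ ρ)
      one-step k<d P {w = w} {x} {y} U (E , ind , E-closed , E-in) w∉P dist wU xy =
        star w (x ∷ y ∷ U) ++ E
        , one-extension dist (λ a → outside {P} w∉P (proj₂ (wU a))) k<d (avoids-outside {P} w∉P E-in) with-xy
        , attach {P} (x ∷ y ∷ U) E wU E-closed E-in
        where
        motion = not-closed⇒motion (λ x≡y → contradiction (dist {zero} {suc zero} x≡y) λ ()) xy
        ψ = proj₁ motion
        -- A motion of the graph with nonzero tension on xy kills every pair of the closure, hence
        -- `E`; applied to a relation it isolates the coefficient of xy.
        with-xy : Ind p ((x , y) ∷ E)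
        with-xy c rel = λ { zero → c₀≈0 ; (suc b) → rest b }
          where
          c₀≈0 : c zero ≈ 0#
          c₀≈0 = cancel (begin
            tension ψ x y * c zero
              ≈⟨ ≈-trans (*-comm _ _) (≈-sym (+-identityʳ _)) ⟩
            c zero * tension ψ x y + 0#
              ≈⟨ +-congˡ (≈-sym (sum-0 (λ b → c (suc b) * ⟪ ψ , row p (E b) ⟫) λ b →
                   ≈-trans (*-congˡ (closed⇒tension (E-closed b) ψ (proj₁ (proj₂ motion)))) (zeroʳ _))) ⟩
            sum (λ b → c b * ⟪ ψ , row p (((x , y) ∷ E) b) ⟫)
              ≈⟨ ≈-sym (⟪⟫-combination ψ c (λ b → row p (((x , y) ∷ E) b))) ⟩
            ⟪ ψ , (λ j → sum (λ b → c b * row p (((x , y) ∷ E) b) j)) ⟫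
              ≈⟨ ⟪⟫-0 ψ rel ⟩
            0# ∎) (proj₂ (proj₂ motion))
          rest : ∀ b → c (suc b) ≈ 0#
          rest = ind (c ∘ suc) λ j → ≈-trans (≈-sym (≈-trans (+-congʳ (≈-trans (*-congʳ c₀≈0) (zeroˡ _))) (+-identityˡ _))) (rel j)

-- The number of rows and the numerical estimates.

module Arithmetic where
  open import Data.Nat.Combinatorics using (_C_; nC1≡n; nCk+nC[k+1]≡[n+1]C[k+1])
  open import Data.Nat.Base using (_+_; _*_; _^_; >-nonZero)

  triangle : ℕ → ℕ
  triangle zero    = 0
  triangle (suc m) = m + triangle m

  C2≡triangle : ∀ m → m C 2 ≡ triangle m
  C2≡triangle zero    = refl
  C2≡triangle (suc m) = trans (≡.sym (nCk+nC[k+1]≡[n+1]C[k+1] m 1)) (cong₂ _+_ (nC1≡n m) (C2≡triangle m))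

  double-triangle : ∀ m → 2 * triangle (suc m) ≡ m * suc m
  double-triangle zero    = refl
  double-triangle (suc m) = trans (expand m (triangle (suc m))) (trans (cong (2 * suc m +_) (double-triangle m)) (collect m))
    where
    expand : ∀ m x → 2 * (suc m + x) ≡ 2 * suc m + 2 * x
    expand = solve-∀
    collect : ∀ m → 2 * suc m + m * suc m ≡ suc m * suc (suc m)
    collect = solve-∀

  baseSize-small : ∀ d m → m ≤ d → baseSize d m ≡ triangle m
  baseSize-small d zero    _   = refl
  baseSize-small d (suc m) m<d = cong₂ _+_ (ℕ.m≤n⇒m⊓n≡m (ℕ.<⇒≤ m<d)) (baseSize-small d m (ℕ.<⇒≤ m<d))

  baseSize-large : ∀ d j → baseSize d (j + d) ≡ j * d + triangle d
  baseSize-large d zero    = baseSize-small d d ℕ.≤-refl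
  baseSize-large d (suc j) = trans (cong₂ _+_ (ℕ.m≥n⇒m⊓n≡n (ℕ.m≤n+m d j)) (baseSize-large d j)) (≡.sym (ℕ.+-assoc d (j * d) (triangle d)))

  baseSize+triangle : ∀ {d n} → d ≤ n → baseSize d n + triangle (suc d) ≡ d * n
  baseSize+triangle {d} {n} d≤n = begin
    baseSize d n + (d + triangle d)        ≡⟨ cong (λ x → baseSize d x + (d + triangle d)) (ℕ.m∸n+n≡m d≤n) ⟨
    baseSize d (j + d) + (d + triangle d)  ≡⟨ cong (_+ (d + triangle d)) (baseSize-large d j) ⟩
    j * d + triangle d + (d + triangle d)  ≡⟨ regroup j d (triangle d) ⟩
    j * d + 2 * (d + triangle d) ∸ d       ≡⟨ cong (λ x → j * d + x ∸ d) (double-triangle d) ⟩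
    j * d + d * suc d ∸ d                  ≡⟨ cong (_∸ d) (collect j d) ⟩
    d * (j + d) + d ∸ d                    ≡⟨ ℕ.m+n∸n≡m (d * (j + d)) d ⟩
    d * (j + d)                            ≡⟨ cong (d *_) (ℕ.m∸n+n≡m d≤n) ⟩
    d * n                                  ∎
    where
    open ≡.≡-Reasoning
    j = n ∸ d
    regroup : ∀ j d t → j * d + t + (d + t) ≡ j * d + 2 * (d + t) ∸ d
    regroup j d t = trans (≡.sym (ℕ.m+n∸n≡m (j * d + t + (d + t)) d)) (cong (_∸ d) (identity j d t))
      where
      identity : ∀ j d t → j * d + t + (d + t) + d ≡ j * d + 2 * (d + t)
      identity = solve-∀
    collect : ∀ j d → j * d + d * suc d ≡ d * (j + d) + d
    collect = solve-∀

  baseSize-formula : ∀ {d n} → d ≤ n → d * n ∸ (d + 1) C 2 ≡ baseSize d n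
  baseSize-formula {d} {n} d≤n = begin
    d * n ∸ (d + 1) C 2                            ≡⟨ cong (λ x → d * n ∸ x C 2) (ℕ.+-comm d 1) ⟩
    d * n ∸ suc d C 2                              ≡⟨ cong₂ _∸_ (≡.sym (baseSize+triangle d≤n)) (C2≡triangle (suc d)) ⟩
    baseSize d n + triangle (suc d) ∸ triangle (suc d) ≡⟨ ℕ.m+n∸n≡m (baseSize d n) (triangle (suc d)) ⟩
    baseSize d n                                   ∎
    where open ≡.≡-Reasoning

  -- The hypothesis multiplied out: 8(2d² + d + 2) is exactly (4d + 1)² + 15.
  size-bound : ∀ {n d} → (4 * d + 1) ^ 2 + 15 ≤ 8 * n → 2 * d * d + d + 2 ≤ n
  size-bound {n} {d} h = ℕ.*-cancelˡ-≤ 8 (ℕ.≤-trans (ℕ.≤-reflexive (identity d)) h)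
    where
    identity : ∀ d → 8 * (2 * d * d + d + 2) ≡ (4 * d + 1) * ((4 * d + 1) * 1) + 15
    identity = solve-∀

  module _ {d n M : ℕ} (0<d : 0 < d) (size : 2 * d * d + d + 2 ≤ n) (M-large : n + 2 ≤ 2 * M + d) where

    -- Divided by 4M: the error n d(d + 2)/2M is covered by the surplus n/2 together with the amount
    -- d(d + 1)/2 by which the target stays below dn.
    margin : 2 * (n * (d * (d + 2))) ≤ 2 * M * (n + d * suc d)
    margin with ℕ.m≤n⇒∃[o]m+o≡n size
    ... | t , refl = ℕ.≤-trans (polynomial d 0<d) (ℕ.*-monoˡ-≤ (2 * d * d + d + 2 + t + d * suc d) M≥)
      where
      M≥ : 2 * d * d + 4 + t ≤ 2 * M
      M≥ = ℕ.+-cancelʳ-≤ d (2 * d * d + 4 + t) (2 * M) (ℕ.≤-trans (ℕ.≤-reflexive (identity d t)) M-large)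
        where
        identity : ∀ d t → 2 * d * d + 4 + t + d ≡ 2 * d * d + d + 2 + t + 2
        identity = solve-∀
      -- The difference of the sides is 2d⁴ - 6d³ + 8d² + 8 + t(3d² - 2d + 6) + t². Written in k = d
      -- - 2 it has only nonnegative coefficients; d = 1 is treated separately.
      polynomial : ∀ d → 0 < d → 2 * ((2 * d * d + d + 2 + t) * (d * (d + 2))) ≤
        (2 * d * d + 4 + t) * (2 * d * d + d + 2 + t + d * suc d)
      polynomial (suc zero) _ = ℕ.≤-trans (ℕ.m≤m+n _ (12 + 7 * t + t * t)) (ℕ.≤-reflexive (identity t))
        where
        identity : ∀ t → 2 * ((5 + t) * 3) + (12 + 7 * t + t * t) ≡ (6 + t) * (5 + t + 2)
        identity = solve-∀
      polynomial (suc (suc k)) _ = ℕ.≤-trans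
        (ℕ.m≤m+n _ (2 * k * k * k * k + 10 * k * k * k + 20 * k * k + 24 * k + 24 + t * (3 * k * k + 10 * k + 14) + t * t))
        (ℕ.≤-reflexive (identity k t))
        where
        identity : ∀ k t → 2 * ((2 * suc (suc k) * suc (suc k) + suc (suc k) + 2 + t) * (suc (suc k) * (suc (suc k) + 2))) +
            (2 * k * k * k * k + 10 * k * k * k + 20 * k * k + 24 * k + 24 + t * (3 * k * k + 10 * k + 14) + t * t)
          ≡ (2 * suc (suc k) * suc (suc k) + 4 + t) *
            (2 * suc (suc k) * suc (suc k) + suc (suc k) + 2 + t + suc (suc k) * suc (suc (suc k)))
        identity = solve-∀

    -- The factor 4M clears the denominators of the unit 1/2M and of d(d + 1)/2. Cancelling it needs
    -- M > 0, which d ≤ n and the lower bound on M enforce.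
    baseSize≤ : ∀ {ρ} → d ≤ n → 2 * M * suc d * n ≤ 2 * M * ρ + n * (M + d * (d + 2)) → baseSize d n ≤ ρ
    baseSize≤ {ρ} d≤n h = ℕ.*-cancelˡ-≤ (4 * m) {{4m≢0}}
      (ℕ.+-cancelʳ-≤ (4 * m * τ + 4 * m * n) (4 * m * baseSize d n) (4 * m * ρ) (begin
        4 * m * baseSize d n + (4 * m * τ + 4 * m * n)
          ≡⟨ collect m (baseSize d n) τ n ⟩
        2 * (2 * m * (baseSize d n + τ)) + 4 * m * n
          ≡⟨ cong (λ x → 2 * (2 * m * x) + 4 * m * n) (baseSize+triangle d≤n) ⟩
        2 * (2 * m * (d * n)) + 4 * m * n
          ≡⟨ factor m d n ⟩
        2 * (2 * m * suc d * n)
          ≤⟨ ℕ.*-monoʳ-≤ 2 h ⟩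
        2 * (2 * m * ρ + n * (m + d * (d + 2)))
          ≡⟨ spread m ρ n (d * (d + 2)) ⟩
        4 * m * ρ + 2 * m * n + 2 * (n * (d * (d + 2)))
          ≤⟨ ℕ.+-monoʳ-≤ (4 * m * ρ + 2 * m * n) margin ⟩
        4 * m * ρ + 2 * m * n + 2 * m * (n + d * suc d)
          ≡⟨ cong (λ x → 4 * m * ρ + 2 * m * n + 2 * m * (n + x)) (double-triangle d) ⟨
        4 * m * ρ + 2 * m * n + 2 * m * (n + 2 * τ)
          ≡⟨ final m ρ n τ ⟩
        4 * m * ρ + (4 * m * τ + 4 * m * n) ∎))
      where
      open ℕ.≤-Reasoning
      m = M
      positive : ∀ M → n + 2 ≤ 2 * M + d → 0 < M
      positive (suc _) _ = s≤s z≤n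
      positive zero    le = contradiction (ℕ.≤-trans le d≤n) (ℕ.<⇒≱ (ℕ.m<m+n n (s≤s z≤n)))
      4m≢0 = ℕ.m*n≢0 4 m {{_}} {{>-nonZero (positive M M-large)}}
      τ = triangle (suc d)
      collect : ∀ m b τ n → 4 * m * b + (4 * m * τ + 4 * m * n) ≡ 2 * (2 * m * (b + τ)) + 4 * m * n
      collect = solve-∀
      factor : ∀ m d n → 2 * (2 * m * (d * n)) + 4 * m * n ≡ 2 * (2 * m * suc d * n)
      factor = solve-∀
      spread : ∀ m ρ n x → 2 * (2 * m * ρ + n * (m + x)) ≡ 4 * m * ρ + 2 * m * n + 2 * (n * x)
      spread = solve-∀
      final : ∀ m ρ n τ → 4 * m * ρ + 2 * m * n + 2 * m * (n + 2 * τ) ≡ 4 * m * ρ + (4 * m * τ + 4 * m * n)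
      final = solve-∀

open Arithmetic

-- From the minimum degree to the rank.

open SemiringSum ℕ.+-*-semiring using (sum; ∑-distrib-+)

∣tabulate∣ : ∀ {n} (f : Fin n → Bool) → ∣ Vec.tabulate f ∣ ≡ count f
∣tabulate∣ {zero}  f = refl
∣tabulate∣ {suc n} f with f zero
... | true  = cong suc (∣tabulate∣ (f ∘ suc))
... | false = ∣tabulate∣ (f ∘ suc)

δ≤degree : ∀ {n} (G : Graph n) v → δ G ≤ count (D.adj G v)
δ≤degree {n} G v = subst (δ G ≤_) (∣tabulate∣ (D.adj G v))
  (All.tabulate⁻ (min≤xs n (List.tabulate (D.degree G))) v)

-- Every vertex other than x and y lies in at most two of the neighbourhoods, and
-- x and y lie in none.
common-neighbours : ∀ {n} (adj : Fin n → Fin n → Bool) → (∀ u v → adj u v ≡ adj v u) → (∀ v → adj v v ≡ false) →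
  ∀ {x y} → x ≢ y → adj x y ≡ false → count (adj x) ℕ.+ count (adj y) ℕ.+ 2 ≤ n ℕ.+ count (λ z → adj x z ∧ adj y z)
common-neighbours {n} adj symmetric loopless {x} {y} x≢y xy = begin
  count (adj x) ℕ.+ count (adj y) ℕ.+ 2
    ≡⟨ cong₂ ℕ._+_ (∑-distrib-+ (λ z → 𝟙 (adj x z)) (λ z → 𝟙 (adj y z)))
         (≡.trans (∑-distrib-+ (λ z → [ z ≡ x ]) (λ z → [ z ≡ y ])) (cong₂ ℕ._+_ (count-point x) (count-point y))) ⟨
  sum (λ z → 𝟙 (adj x z) ℕ.+ 𝟙 (adj y z)) ℕ.+ sum (λ z → [ z ≡ x ] ℕ.+ [ z ≡ y ])
    ≡⟨ ∑-distrib-+ (λ z → 𝟙 (adj x z) ℕ.+ 𝟙 (adj y z)) (λ z → [ z ≡ x ] ℕ.+ [ z ≡ y ]) ⟨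
  sum (λ z → 𝟙 (adj x z) ℕ.+ 𝟙 (adj y z) ℕ.+ ([ z ≡ x ] ℕ.+ [ z ≡ y ]))
    ≤⟨ sum-mono pointwise ⟩
  sum (λ z → 1 ℕ.+ 𝟙 (adj x z ∧ adj y z))
    ≡⟨ ∑-distrib-+ (λ _ → 1) (λ z → 𝟙 (adj x z ∧ adj y z)) ⟩
  sum {n} (λ _ → 1) ℕ.+ count (λ z → adj x z ∧ adj y z)
    ≡⟨ cong (ℕ._+ count (λ z → adj x z ∧ adj y z)) (≡.trans (sum-const n 1) (ℕ.*-identityʳ n)) ⟩
  n ℕ.+ count (λ z → adj x z ∧ adj y z) ∎
  where
  open ℕ.≤-Reasoning
  pointwise : ∀ z → 𝟙 (adj x z) ℕ.+ 𝟙 (adj y z) ℕ.+ ([ z ≡ x ] ℕ.+ [ z ≡ y ]) ≤ 1 ℕ.+ 𝟙 (adj x z ∧ adj y z)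
  pointwise z with z Fin.≟ x | z Fin.≟ y
  ... | yes refl | yes refl = contradiction refl x≢y
  ... | yes refl | no _ rewrite loopless x | symmetric y x | xy = ℕ.≤-refl
  ... | no _ | yes refl rewrite loopless y | xy = ℕ.≤-refl
  ... | no _ | no _ with adj x z | adj y z
  ...   | true  | true  = ℕ.≤-refl
  ...   | true  | false = ℕ.≤-refl
  ...   | false | true  = ℕ.≤-refl
  ...   | false | false = z≤n

does⇒ : ∀ {A : Set} (a? : Dec A) → does a? ≡ true → A
does⇒ (yes a) _ = a

count-mono : ∀ {n} {f g : Fin n → Bool} → (∀ z → f z ≡ true → g z ≡ true) → count f ≤ count g
count-mono {f = f} {g} f⇒g = sum-mono λ z → pointwise z
  where
  pointwise : ∀ z → 𝟙 (f z) ≤ 𝟙 (g z)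
  pointwise z with f z in fz
  ... | false = z≤n
  ... | true  = ℕ.≤-reflexive (cong 𝟙 (≡.sym (f⇒g z fz)))

module _ (S : Scalars) {n : ℕ} (adj : Fin n → Fin n → Bool)
  (symmetric : ∀ u v → adj u v ≡ adj v u) (loopless : ∀ v → adj v v ≡ false)
  {D₀ : ℕ} (D₀≤ : ∀ v → D₀ ≤ count (adj v)) where

  incomplete⇒baseSize≤rank : ∀ d {p} (generic : Polynomials.Independent S (Rows.flat S n d p)) (d≤n : d ≤ n) →
    2 ℕ.* d ℕ.* d ℕ.+ d ℕ.+ 2 ≤ n → n ℕ.+ d ≤ 2 ℕ.* (D₀ ℕ.+ 1) →
    let open Framework.OfGraph S n d {p} generic d≤n adj symmetric loopless in
    ∀ {x y} → x ≢ y → closed x y ≡ false → baseSize d n ≤ r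
  -- In dimension zero the empty clique joins every pair, so the closure cannot miss one.
  incomplete⇒baseSize≤rank zero {p} generic d≤n size dense {x} {y} x≢y xy = contradiction
    (≡.trans (≡.sym xy) (closed-clique (λ ()) (∷-distinct (λ { zero → x≢y ∘ ≡.sym ; (suc ()) }) (∷-distinct {U = λ ()} (λ ()) (λ { {()} })))
      (λ ()) (λ ()) (λ ()))) λ ()
    where open Framework.OfGraph S n zero {p} generic d≤n adj symmetric loopless
  incomplete⇒baseSize≤rank (suc k) {p} generic d≤n size dense {x} {y} x≢y xy =
    let P , ρ , (E , ind , E-closed , _) , bound = attains-many ((λ ()) , (λ _ _ ()) , (λ ()) , λ ())
    in ℕ.≤-trans (baseSize≤ (s≤s z≤n) size M-large d≤n bound) (r≥ E ind E-closed)
    where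
    open Framework.OfGraph S n (suc k) {p} generic d≤n adj symmetric loopless
    d = suc k
    -- The largest value that the lower bound `D₀` on the degrees permits in `M-bound`; the density
    -- turns it into 2M + d ≥ n + 2.
    M = D₀ ℕ.+ 2 ∸ d
    -- Makes every degree exceed d, and shows that the subtraction in `M` does not truncate.
    half-size : d ℕ.* d ℕ.+ d ≤ D₀
    half-size = ℕ.*-cancelˡ-≤ 2 (ℕ.+-cancelʳ-≤ 2 _ _ (begin
      2 ℕ.* (d ℕ.* d ℕ.+ d) ℕ.+ 2            ≡⟨ identity d ⟩
      2 ℕ.* d ℕ.* d ℕ.+ d ℕ.+ 2 ℕ.+ d        ≤⟨ ℕ.+-monoˡ-≤ d size ⟩
      n ℕ.+ d                                ≤⟨ dense ⟩
      2 ℕ.* (D₀ ℕ.+ 1)                       ≡⟨ ℕ.*-distribˡ-+ 2 D₀ 1 ⟩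
      2 ℕ.* D₀ ℕ.+ 2                         ∎))
      where
      open ℕ.≤-Reasoning
      identity : ∀ d → 2 ℕ.* (d ℕ.* d ℕ.+ d) ℕ.+ 2 ≡ 2 ℕ.* d ℕ.* d ℕ.+ d ℕ.+ 2 ℕ.+ d
      identity = solve-∀
    d<D₀ : d < D₀
    d<D₀ = ℕ.≤-trans (ℕ.+-monoˡ-≤ d (ℕ.*-mono-≤ {1} {d} {1} (s≤s z≤n) (s≤s z≤n))) half-size
    M+d : M ℕ.+ d ≡ D₀ ℕ.+ 2
    M+d = ℕ.m∸n+n≡m (ℕ.≤-trans (ℕ.<⇒≤ d<D₀) (ℕ.m≤m+n D₀ 2))
    M-large : n ℕ.+ 2 ≤ 2 ℕ.* M ℕ.+ d
    M-large = ℕ.+-cancelʳ-≤ d _ _ (begin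
      n ℕ.+ 2 ℕ.+ d            ≡⟨ shuffle n d ⟩
      n ℕ.+ d ℕ.+ 2            ≤⟨ ℕ.+-monoˡ-≤ 2 dense ⟩
      2 ℕ.* (D₀ ℕ.+ 1) ℕ.+ 2   ≡⟨ twice D₀ ⟩
      2 ℕ.* (D₀ ℕ.+ 2)         ≡⟨ cong (2 ℕ.*_) M+d ⟨
      2 ℕ.* (M ℕ.+ d)          ≡⟨ spread M d ⟩
      2 ℕ.* M ℕ.+ d ℕ.+ d      ∎)
      where
      open ℕ.≤-Reasoning
      shuffle : ∀ n d → n ℕ.+ 2 ℕ.+ d ≡ n ℕ.+ d ℕ.+ 2
      shuffle = solve-∀
      twice : ∀ x → 2 ℕ.* (x ℕ.+ 1) ℕ.+ 2 ≡ 2 ℕ.* (x ℕ.+ 2)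
      twice = solve-∀
      spread : ∀ m d → 2 ℕ.* (m ℕ.+ d) ≡ 2 ℕ.* m ℕ.+ d ℕ.+ d
      spread = solve-∀
    degree≥ : ∀ v → D₀ ≤ count (closed v)
    degree≥ v = ℕ.≤-trans (D₀≤ v) (count-mono {f = adj v} {closed v} λ z → adj⇒closed)
    -- The common neighbours are found in the graph itself: a pair missing from the closure is not
    -- an edge.
    common : ∀ {x y} → x ≢ y → closed x y ≡ false →
      Σ[ U ∈ (Fin d → Fin n) ] (Distinct U × (∀ a → closed x (U a) ≡ true) × (∀ a → closed y (U a) ≡ true))
    common {x} {y} x≢y xy = let U , dist , U-common = choose (λ z → adj x z ∧ adj y z) d many in
      U , dist , (λ a → adj⇒closed (proj₁ (∧-true (U-common a))))
        , λ a → adj⇒closed (proj₂ (∧-true {adj x (U a)} (U-common a)))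
      where
      open ℕ.≤-Reasoning
      not-adj : adj x y ≡ false
      not-adj = Bool.¬-not λ xy′ → contradiction (≡.trans (≡.sym xy) (adj⇒closed xy′)) λ ()
      many : d ≤ count (λ z → adj x z ∧ adj y z)
      many = ℕ.+-cancelˡ-≤ n _ _ (begin
        n ℕ.+ d                               ≤⟨ dense ⟩
        2 ℕ.* (D₀ ℕ.+ 1)                      ≡⟨ twice D₀ ⟩
        D₀ ℕ.+ D₀ ℕ.+ 2                       ≤⟨ ℕ.+-monoˡ-≤ 2 (ℕ.+-mono-≤ (D₀≤ x) (D₀≤ y)) ⟩
        count (adj x) ℕ.+ count (adj y) ℕ.+ 2 ≤⟨ common-neighbours adj symmetric loopless x≢y not-adj ⟩
        n ℕ.+ count (λ z → adj x z ∧ adj y z) ∎)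
        where
        twice : ∀ x → 2 ℕ.* (x ℕ.+ 1) ≡ x ℕ.+ x ℕ.+ 2
        twice = solve-∀
    open Greedy closed closed-symmetric closed-loopless k using (module Closed; Complete)
    incomplete : ¬ Complete
    incomplete complete = contradiction (≡.trans (≡.sym xy) (complete x≢y)) λ ()
    M-bound : ∀ v → M ℕ.+ d ≤ count (closed v) ℕ.+ 2
    M-bound v = ℕ.≤-trans (ℕ.≤-reflexive M+d) (ℕ.+-monoˡ-≤ 2 (degree≥ v))
    degree-bound : ∀ v → suc d ≤ count (closed v)
    degree-bound v = ℕ.≤-trans d<D₀ (degree≥ v)
    open Closed closed-clique common incomplete M M-bound degree-bound using (module Growth)
    open Growth Attains zero-step (one-step ℕ.≤-refl)

  baseSize≤rank : ∀ d {p} (generic : Polynomials.Independent S (Rows.flat S n d p)) (d≤n : d ≤ n) →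
    2 ℕ.* d ℕ.* d ℕ.+ d ℕ.+ 2 ≤ n → n ℕ.+ d ≤ 2 ℕ.* (D₀ ℕ.+ 1) →
    baseSize d n ≤ Framework.OfGraph.r S n d {p} generic d≤n adj symmetric loopless
  baseSize≤rank d {p} generic d≤n size dense
    with Fin.any? (λ x → Fin.any? λ y → ¬? (x Fin.≟ y) ×-dec (closed x y Bool.≟ false))
    where open Framework.OfGraph S n d {p} generic d≤n adj symmetric loopless
  ... | no none = complete⇒rank λ {x} {y} x≢y → Bool.¬-not λ xy → none (x , y , x≢y , xy)
    where open Framework.OfGraph S n d {p} generic d≤n adj symmetric loopless
  ... | yes (x , y , x≢y , xy) = incomplete⇒baseSize≤rank d generic d≤n size dense x≢y xy

  rank : ∀ {d p} → Polynomials.Independent S (Rows.flat S n d p) →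
    2 ℕ.* d ℕ.* d ℕ.+ d ℕ.+ 2 ≤ n → n ℕ.+ d ≤ 2 ℕ.* (D₀ ℕ.+ 1) →
    (Σ[ E ∈ (Fin (baseSize d n) → Fin n × Fin n) ]
      ((∀ k → adj (proj₁ (E k)) (proj₂ (E k)) ≡ true × proj₁ (E k) Fin.< proj₂ (E k)) × Rows.Ind S n d p E))
    × (∀ {r} (A : Fin r → Fin n × Fin n) → Rows.Ind S n d p A → r ≤ baseSize d n)
  rank {d} {p} generic size dense =
    (F.B ∘ pick , edges , independent) , Framework.rank≤ S n d {p} generic d≤n
    where
    open Rows S n d
    d≤n : d ≤ n
    d≤n = ℕ.≤-trans (ℕ.m≤n+m d (2 ℕ.* d ℕ.* d)) (ℕ.≤-trans (ℕ.m≤m+n _ 2) size)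
    module F = Framework.OfGraph S n d {p} generic d≤n adj symmetric loopless
    enough : baseSize d n ≤ F.r
    enough = baseSize≤rank d {p} generic d≤n size dense
    -- Trims the basis of the edge rows to the exact number that `HasRank` asks for; a subfamily
    -- keeps its certificate.
    pick : Fin (baseSize d n) → Fin F.r
    pick k = inject≤ k enough
    pick-injective : ∀ {a b} → pick a ≡ pick b → a ≡ b
    pick-injective {a} {b} eq = Fin.toℕ-injective
      (≡.trans (≡.sym (Fin.toℕ-inject≤ a enough)) (≡.trans (cong Fin.toℕ eq) (Fin.toℕ-inject≤ b enough)))
    edges : ∀ k → adj (proj₁ (F.B (pick k))) (proj₂ (F.B (pick k))) ≡ true
      × proj₁ (F.B (pick k)) Fin.< proj₂ (F.B (pick k))
    edges k = let uv , u<v = ∧-true (F.B-edges (pick k)) in uv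
      , does⇒ (proj₁ (F.B (pick k)) Fin.<? proj₂ (F.B (pick k))) u<v
    independent : Ind p (F.B ∘ pick)
    independent = LI-cong (λ k → ev-rowP p (F.B (pick k)))
      (Certificate.independent-at C (flat p) (Certificate.s≉0 C))
      where
      open Elimination S using (restrict; module Certificate)
      C = restrict pick-injective F.certificate

-- Return to the reals and to the rigidity matrix of the statement.

open import Data.List.Base using ([]; _∷_)
open RealNumbers using (termwise; wrap; unwrap; ℝ-commutativeRing; ≋0-stable; *-cancel-≋0; fromℚ-nonzero)

ℝ-scalars : Scalars
ℝ-scalars = record
  { commutativeRing = ℝ-commutativeRing
  ; embedding = record
    { ⟦_⟧ = fromℚ
    ; +-homo = λ _ _ → termwise λ _ → refl ; *-homo = λ _ _ → termwise λ _ → refl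
    ; -‿homo = λ _ → termwise λ _ → refl ; 0-homo = termwise λ _ → refl ; 1-homo = termwise λ _ → refl }
  ; stable = ≋0-stable
  ; cancel = *-cancel-≋0
  ; faithful = fromℚ-nonzero }

open Polynomials ℝ-scalars using (ev; Independent; module Prod; module Pow)

power≡ : ∀ k x → k Pow.× x ≡ x D.^ k
power≡ zero    x = refl
power≡ (suc k) x = cong (x D.*_) (power≡ k x)

product≡ : ∀ {m} {f g : Vector.Vector ℝ m} → (∀ i → f i ≡ g i) → Prod.sum f ≡ D.product g
product≡ {zero}  f≡g = refl
product≡ {suc m} f≡g = cong₂ D._*_ (f≡g zero) (product≡ (f≡g ∘ suc))

ev≡eval : ∀ {m} (f : Polynomial m) x → ev f x ≡ D.eval f x
ev≡eval []            x = refl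
ev≡eval ((c , k) ∷ f) x = cong₂ (λ a b → fromℚ c D.* a D.+ b)
  (product≡ λ i → power≡ (Vec.lookup k i) (x i)) (ev≡eval f x)

module Real {n d : ℕ} where
  open Rows ℝ-scalars n d
  open CommutativeRing ℝ-commutativeRing using (_≈_; +-cong; *-identityˡ; zeroˡ; +-identityʳ; +-identityˡ)
    renaming (refl to ≈-refl; sym to ≈-sym; trans to ≈-trans)

  generic⇒independent : {p : D.Placement n d} → D.Generic p → Independent (flat p)
  generic⇒independent {p} generic f fp≈0 = generic f (subst (λ x → D._≈_ x D.0ℝ) (ev≡eval f (flat p)) (unwrap fp≈0))

  row≈rigidityMatrix : ∀ (G : Graph n) (p : D.Placement n d) (e : Edge G) j →
    row p (Edge.u e , Edge.v e) j ≈ rigidityMatrix G p e j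
  row≈rigidityMatrix G p e (w , i) with w Fin.≟ Edge.u e | w Fin.≟ Edge.v e
  ... | yes refl | yes refl = contradiction (Edge.u<v e) (Fin.<-irrefl refl)
  ... | yes _    | no _     = ≈-trans (+-cong (*-identityˡ _) (zeroˡ _)) (+-identityʳ _)
  ... | no _     | yes _    = ≈-trans (+-cong (zeroˡ _) (*-identityˡ _)) (+-identityˡ _)
  ... | no _     | no _     = ≈-trans (+-cong (zeroˡ _) (zeroˡ _)) (+-identityʳ _)

  Ind⇒rows : ∀ {r} (G : Graph n) (p : D.Placement n d) (ρ : Fin r → Edge G) →
    Ind p (λ k → Edge.u (ρ k) , Edge.v (ρ k)) → LinearlyIndependentRows (rigidityMatrix G p) ρ
  Ind⇒rows G p ρ ind c rel k = unwrap (LI-cong (λ k → row≈rigidityMatrix G p (ρ k)) ind c (λ j → wrap (rel j)) k)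

  rows⇒Ind : ∀ {r} (G : Graph n) (p : D.Placement n d) (ρ : Fin r → Edge G) →
    LinearlyIndependentRows (rigidityMatrix G p) ρ → Ind p (λ k → Edge.u (ρ k) , Edge.v (ρ k))
  rows⇒Ind G p ρ li = LI-cong (λ k j → ≈-sym (row≈rigidityMatrix G p (ρ k) j))
    λ c rel k → wrap (li c (λ j → unwrap (rel j)) k)

open import Data.Nat.Base using (_+_; _*_; _^_)

theorem1p1 : ∀ (n d : ℕ) → 2 ≤ n → (4 * d + 1) ^ 2 + 15 ≤ 8 * n →
    (G : Graph n) → n + d ≤ 2 * (δ G + 1) → Rigid d G
theorem1p1 n d _ size G dense p generic =
  -- Because d ≤ n, the subtraction in the required rank does not truncate, and its value is
  -- `baseSize d n`.
  subst (D.HasRank (rigidityMatrix G p)) (≡.sym (baseSize-formula d≤n))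
    ((edges , Ind⇒rows G p edges (proj₂ (proj₂ (proj₁ R)))) , dependent)
  where
  open Real {n} {d}
  size′ : 2 * d * d + d + 2 ≤ n
  size′ = size-bound {n} {d} size
  d≤n : d ≤ n
  d≤n = ℕ.≤-trans (ℕ.m≤n+m d (2 * d * d)) (ℕ.≤-trans (ℕ.m≤m+n _ 2) size′)
  R = rank ℝ-scalars (D.adj G) (D.symmetric G) (D.loopless G) (δ≤degree G) {d} {p}
    (generic⇒independent {p} generic) size′ dense
  edges : Fin (baseSize d n) → Edge G
  edges k = record
    { u = proj₁ (proj₁ (proj₁ R) k) ; v = proj₂ (proj₁ (proj₁ R) k)
    ; u<v = proj₂ (proj₁ (proj₂ (proj₁ R)) k)
    ; adjacent = Equivalence.from Bool.T-≡ (proj₁ (proj₁ (proj₂ (proj₁ R)) k)) }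
  dependent : (ρ : Fin (suc (baseSize d n)) → Edge G) → ¬ LinearlyIndependentRows (rigidityMatrix G p) ρ
  dependent ρ li = ℕ.<-irrefl refl (proj₂ R (λ k → Edge.u (ρ k) , Edge.v (ρ k)) (rows⇒Ind G p ρ li))
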